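{- Let $\Lambda\cong\mathbb{Z}^d$ be a lattice with an endomorphism $F$ satisfying $\ker(F-1)=\ker(F-1)^2$, and let $\Lambda'\subseteq\Lambda$ be a full-rank $F$-stable sublattice. Write the characteristic polynomial of $F$ on $\Lambda$ as $\pm(t-1)^r p(t)$ with $p(1)>0$. Then $$\left|\left(\Lambda/\Lambda'\right)^{F}\right|=\left|\frac{\Lambda^F}{\Lambda'^F}\right|\cdot\frac{p(1)}{|\mathfrak{B}|\cdot|\mathcal{T}'|},$$ and for all integers $e\ge1$, $$\left|\left(\Lambda/e\Lambda'\right)^{F}\right|=\left|\left(\Lambda/\Lambda'\right)^{F}\right|\cdot|\mathfrak{B}[e]|\cdot e^r.$$ Moreover $\mathcal{T}'$ and $\mathfrak{B}$ are finite abelian groups and $|\mathcal{T}'|\cdot|\mathfrak{B}|$ divides $p(1)$. If $\Lambda'$ is the dual lattice of $\Lambda$ with respect to a non-degenerate $F$-invariant symmetric $\mathbb{Q}$-valued bilinear pairing on $\Lambda\otimes\mathbb{Q}$, then $\mathcal{T}\cong\mathcal{T}'$ and $\mathfrak{B}$ admits a perfect antisymmetric $\mathbb{Q}/\mathbb{Z}$-valued pairing; in particular the orders of $\mathfrak{B}$ and of $\mathfrak{B}[e]$ are each either a square or twice a square.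
   Context: $V=\Lambda\otimes_{\mathbb{Z}}\mathbb{Q}$ with $F$ extended linearly; $V^F$ is the $1$-eigenspace and $W=(F-1)V$ (the sum of generalised eigenspaces of $F$ for eigenvalues other than $1$), so $V=V^F\oplus W$. For a full-rank $F$-stable lattice $M\subseteq V$, the separation group is $\mathcal{T}(M)=M/\big((M\cap V^F)+(M\cap W)\big)$; write $\mathcal{T}=\mathcal{T}(\Lambda)$, $\mathcal{T}'=\mathcal{T}(\Lambda')$. Define $\mathfrak{B}=\mathfrak{B}_{\Lambda,\Lambda'}=\dfrac{\Lambda+\{v\in V: Fv-v\in\Lambda'\}}{\Lambda+V^F}$ (equivalently, the image in $V/\Lambda$ of $F$-invariant elements of $V/\Lambda'$, modulo the image of $V^F$). $M^F$ denotes $F$-fixed points and $\mathfrak{B}[e]$ the $e$-torsion. The dual lattice of $\Lambda$ is $\{v\in V:(v,\lambda)\in\mathbb{Z}\ \forall\lambda\in\Lambda\}$. -}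

module Defs where

open import Data.Nat as ℕ using (ℕ; zero; suc)
open import Data.Integer as ℤ using (ℤ; +_)
open import Data.Rational as ℚ using (ℚ)
open import Data.Fin using (Fin; zero; suc; punchIn; _≟_)
open import Data.List using (List; []; _∷_)
open import Data.Bool using (if_then_else_)
open import Data.Product using (Σ; ∃; ∃-syntax; _×_; proj₁)
open import Data.Sum using (_⊎_)
open import Relation.Nullary.Decidable using (⌊_⌋)
open import Relation.Binary.PropositionalEquality using (_≡_)
open import Function.Base using (_∘_)

∑ : {A : Set} → A → (A → A → A) → (n : ℕ) → (Fin n → A) → A
∑ z _⊕_ zero    f = z
∑ z _⊕_ (suc n) f = f zero ⊕ ∑ z _⊕_ n (f ∘ suc)

record RingOps (A : Set) : Set where
  field
    zer one : A
    add mul : A → A → A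
    neg : A → A

module _ {A : Set} (R : RingOps A) where
  open RingOps R

  altSign : {n : ℕ} → Fin n → A
  altSign zero    = one
  altSign (suc j) = neg (altSign j)

  det : (n : ℕ) → (Fin n → Fin n → A) → A
  det zero    M = one
  det (suc n) M =
    ∑ zer add (suc n) (λ j →
      mul (altSign j) (mul (M zero j) (det n (λ i k → M (suc i) (punchIn j k)))))

-- Integer polynomials as little-endian coefficient lists

Poly : Set
Poly = List ℤ

pAdd : Poly → Poly → Poly
pAdd []       q        = q
pAdd (a ∷ p)  []       = a ∷ p
pAdd (a ∷ p)  (b ∷ q)  = (a ℤ.+ b) ∷ pAdd p q

pScale : ℤ → Poly → Poly
pScale c []      = []
pScale c (a ∷ p) = (c ℤ.* a) ∷ pScale c p

pMul : Poly → Poly → Poly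
pMul []      q = []
pMul (a ∷ p) q = pAdd (pScale a q) (+ 0 ∷ pMul p q)

pNeg : Poly → Poly
pNeg = pScale (ℤ.- (+ 1))

pConst : ℤ → Poly
pConst c = c ∷ []

pX : Poly
pX = + 0 ∷ + 1 ∷ []

pPow : Poly → ℕ → Poly
pPow p zero    = pConst (+ 1)
pPow p (suc n) = pMul p (pPow p n)

coeff : Poly → ℕ → ℤ
coeff []      k       = + 0
coeff (a ∷ p) zero    = a
coeff (a ∷ p) (suc k) = coeff p k

_≐_ : Poly → Poly → Set
p ≐ q = ∀ k → coeff p k ≡ coeff q k

eval : Poly → ℤ → ℤ
eval []      x = + 0
eval (a ∷ p) x = a ℤ.+ x ℤ.* eval p x

polyOps : RingOps Poly
polyOps = record { zer = [] ; one = pConst (+ 1) ; add = pAdd ; mul = pMul ; neg = pNeg }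

Vecℤ Vecℚ : ℕ → Set
Vecℤ d = Fin d → ℤ
Vecℚ d = Fin d → ℚ

Mat : ℕ → Set
Mat d = Fin d → Fin d → ℤ

intOps : RingOps ℤ
intOps = record { zer = + 0 ; one = + 1 ; add = ℤ._+_ ; mul = ℤ._*_ ; neg = ℤ.-_ }

charPoly : {d : ℕ} → Mat d → Poly
charPoly {d} F = det polyOps d (λ i j →
  pAdd (if ⌊ i ≟ j ⌋ then pX else []) (pNeg (pConst (F i j))))

detℤ : {d : ℕ} → Mat d → ℤ
detℤ {d} B = det intOps d B

ιℚ : ℤ → ℚ
ιℚ z = z ℚ./ 1

ι : {d : ℕ} → Vecℤ d → Vecℚ d
ι x i = ιℚ (x i)

mvℤ : {d : ℕ} → Mat d → Vecℤ d → Vecℤ d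
mvℤ {d} M x i = ∑ (+ 0) ℤ._+_ d (λ j → M i j ℤ.* x j)

mvℚ : {d : ℕ} → Mat d → Vecℚ d → Vecℚ d
mvℚ {d} M v i = ∑ ℚ.0ℚ ℚ._+_ d (λ j → ιℚ (M i j) ℚ.* v j)

_+ℤ_ _-ℤ_ : {d : ℕ} → Vecℤ d → Vecℤ d → Vecℤ d
(x +ℤ y) i = x i ℤ.+ y i
(x -ℤ y) i = x i ℤ.- y i

_·ℤ_ : {d : ℕ} → ℤ → Vecℤ d → Vecℤ d
(c ·ℤ x) i = c ℤ.* x i

_+ℚ_ _-ℚ_ : {d : ℕ} → Vecℚ d → Vecℚ d → Vecℚ d
(u +ℚ v) i = u i ℚ.+ v i
(u -ℚ v) i = u i ℚ.- v i

_·ℚ_ : {d : ℕ} → ℚ → Vecℚ d → Vecℚ d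
(c ·ℚ u) i = c ℚ.* u i

zeroℚ : {d : ℕ} → Vecℚ d
zeroℚ i = ℚ.0ℚ

_≗ℤ_ : {d : ℕ} → Vecℤ d → Vecℤ d → Set
x ≗ℤ y = ∀ i → x i ≡ y i

_≗ℚ_ : {d : ℕ} → Vecℚ d → Vecℚ d → Set
u ≗ℚ v = ∀ i → u i ≡ v i

-- Finite cardinality of a type modulo an (equivalence) relation:
-- a bijection between Fin n and the quotient.

record HasCard (A : Set) (_≈_ : A → A → Set) (n : ℕ) : Set where
  field
    to        : Fin n → A
    from      : A → Fin n
    from-resp : ∀ {x y} → x ≈ y → from x ≡ from y
    from-to   : ∀ i → from (to i) ≡ i
    to-from   : ∀ x → to (from x) ≈ x

IsInt : ℚ → Set
IsInt q = ∃[ z ] q ≡ ιℚ z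

_≡QZ_ : ℚ → ℚ → Set
q ≡QZ q' = IsInt (q ℚ.- q')

IsSqOr2Sq : ℕ → Set
IsSqOr2Sq n = ∃[ k ] (n ≡ k ℕ.* k ⊎ n ≡ 2 ℕ.* (k ℕ.* k))

-- The setting: Λ = ℤ^d, F : Mat d acting on it, Λ' = B ℤ^d.

module Setting {d : ℕ} (F B : Mat d) where

  inΛ'e : ℤ → Vecℤ d → Set
  inΛ'e e x = ∃[ c ] (x ≗ℤ (e ·ℤ mvℤ B c))

  inΛ' : Vecℤ d → Set
  inΛ' x = ∃[ c ] (x ≗ℤ mvℤ B c)

  inΛℚ : Vecℚ d → Set
  inΛℚ v = ∃[ x ] (v ≗ℚ ι x)

  inΛ'ℚ : Vecℚ d → Set
  inΛ'ℚ v = ∃[ c ] (v ≗ℚ ι (mvℤ B c))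

  FixedV : Vecℚ d → Set
  FixedV v = mvℚ F v ≗ℚ v

  inW : Vecℚ d → Set
  inW v = ∃[ u ] (v ≗ℚ (mvℚ F u -ℚ u))

  -- (Λ / L)^F for a sublattice L ⊆ Λ given by a predicate
  QFixCar : (Vecℤ d → Set) → Set
  QFixCar L = Σ (Vecℤ d) (λ x → L (mvℤ F x -ℤ x))

  QFixRel : (L : Vecℤ d → Set) → QFixCar L → QFixCar L → Set
  QFixRel L x y = L (proj₁ x -ℤ proj₁ y)

  FixQCar : Set
  FixQCar = Σ (Vecℤ d) (λ x → mvℤ F x ≗ℤ x)

  FixQRel : FixQCar → FixQCar → Set
  FixQRel x y = inΛ' (proj₁ x -ℤ proj₁ y) × (mvℤ F (proj₁ x -ℤ proj₁ y) ≗ℤ (proj₁ x -ℤ proj₁ y))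

  -- 𝔅 = (Λ + {v : Fv - v ∈ Λ'}) / (Λ + V^F)
  inΛ+VF : Vecℚ d → Set
  inΛ+VF u = ∃[ x ] ∃[ w ] (FixedV w × (u ≗ℚ (ι x +ℚ w)))

  inBnum : Vecℚ d → Set
  inBnum u = ∃[ x ] ∃[ v ] (inΛ'ℚ (mvℚ F v -ℚ v) × (u ≗ℚ (ι x +ℚ v)))

  BCar : Set
  BCar = Σ (Vecℚ d) inBnum

  BRel : BCar → BCar → Set
  BRel u u' = inΛ+VF (proj₁ u -ℚ proj₁ u')

  BeCar : ℕ → Set
  BeCar e = Σ BCar (λ u → inΛ+VF (ιℚ (+ e) ·ℚ proj₁ u))

  BeRel : (e : ℕ) → BeCar e → BeCar e → Set
  BeRel e u u' = BRel (proj₁ u) (proj₁ u')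

  -- separation group 𝒯(M) = M / ((M ∩ V^F) + (M ∩ W))
  TCar : (Vecℚ d → Set) → Set
  TCar M = Σ (Vecℚ d) M

  TRelV : (Vecℚ d → Set) → Vecℚ d → Vecℚ d → Set
  TRelV M u u' = ∃[ a ] ∃[ b ] (M a × FixedV a × M b × inW b × ((u -ℚ u') ≗ℚ (a +ℚ b)))

  TRel : (M : Vecℚ d → Set) → TCar M → TCar M → Set
  TRel M u u' = TRelV M (proj₁ u) (proj₁ u')

  record TIso (M N : Vecℚ d → Set) : Set where
    field
      f       : TCar M → TCar N
      resp    : ∀ x y → TRel M x y → TRel N (f x) (f y)
      additive : ∀ x y z → proj₁ z ≗ℚ (proj₁ x +ℚ proj₁ y) →
                 TRelV N (proj₁ (f z)) (proj₁ (f x) +ℚ proj₁ (f y))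
      injective : ∀ x y → TRel N (f x) (f y) → TRel M x y
      surjective : ∀ y → ∃[ x ] TRel N (f x) y

  IsHomQZ : (BCar → ℚ) → Set
  IsHomQZ χ = (∀ x y → BRel x y → χ x ≡QZ χ y)
            × (∀ x y z → proj₁ z ≗ℚ (proj₁ x +ℚ proj₁ y) → χ z ≡QZ (χ x ℚ.+ χ y))

  record PerfectAntisymPairing : Set where
    field
      β : BCar → BCar → ℚ
      homˡ : ∀ y → IsHomQZ (λ x → β x y)
      homʳ : ∀ x → IsHomQZ (λ y → β x y)
      antisym : ∀ x y → β x y ≡QZ (ℚ.- β y x)
      -- perfect: x ↦ β x (-) is a bijection 𝔅 → Hom(𝔅, ℚ/ℤ)
      nondeg : ∀ x → (∀ y → IsInt (β x y)) → inΛ+VF (proj₁ x)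
      onto   : ∀ χ → IsHomQZ χ → ∃[ x ] (∀ y → β x y ≡QZ χ y)

  record GoodPairing (b : Vecℚ d → Vecℚ d → ℚ) : Set where
    field
      addˡ : ∀ u u' v → b (u +ℚ u') v ≡ b u v ℚ.+ b u' v
      scaleˡ : ∀ c u v → b (c ·ℚ u) v ≡ c ℚ.* b u v
      symm : ∀ u v → b u v ≡ b v u
      Finv : ∀ u v → b (mvℚ F u) (mvℚ F v) ≡ b u v
      nondegen : ∀ u → (∀ v → b u v ≡ ℚ.0ℚ) → u ≗ℚ zeroℚ

  IsDual : (Vecℚ d → Vecℚ d → ℚ) → Set
  IsDual b = ∀ v → (inΛ'ℚ v → ∀ x → IsInt (b v (ι x)))
                 × ((∀ x → IsInt (b v (ι x))) → inΛ'ℚ v)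

{-# OPTIONS --safe #-}
-- Put A = F − 1. Since ker A = ker A², some polynomial P in A satisfies A P A = D A with D ≠ 0, so E = A P is D
-- times the projection of V onto W along V^F. Applying A turns 𝔅, 𝒯′ and (Λ/Λ′)^F modulo Λ^F into consecutive
-- quotients in the chain A(Λ′ ∩ W) ⊆ AΛ′ ⊆ Λ′ ∩ AΛ ⊆ Λ′ ∩ W, and the counting formulas become multiplicativity of
-- the index together with [Λ′ ∩ W : A(Λ′ ∩ W)] = p(1). The latter, and r = rank Λ^F, follow by comparing, for one
-- large integer s, the index of (s − A) on Λ, which is s^r |p(1 + s)|, with its index on Λ′^F ⊕ (Λ′ ∩ W), and reducing
-- modulo s.
--
-- In the self-dual case E is self-adjoint, so 𝒯 and 𝒯′ are ℤᵈ modulo the vectors that E, respectively its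
-- transpose, makes divisible by D; a square integer matrix is equivalent to its transpose. The pairing on 𝔅 is
-- (u, v) ↦ b((F − 1)u, v). The order of a group with a nondegenerate antisymmetric pairing is divided by q² when
-- passing to x^⊥/⟨x⟩ for an isotropic x of prime order q; without isotropic elements the order is at most 2.

module Submission where

open import Defs
open import Algebra.Structures using (IsCommutativeSemiring; IsCommutativeRing)
open import Data.Bool using (if_then_else_)
open import Data.Empty using (⊥; ⊥-elim)
open import Data.Fin as Fin using (Fin; zero; suc; inject₁; punchIn; punchOut; toℕ; fromℕ<; combine; remQuot)
import Data.Fin.Properties as Finₚ
open import Data.Integer as ℤ using (ℤ; +_; -[1+_]; ∣_∣)
open import Data.Integer.Divisibility using (_∣_)
import Data.Integer.Divisibility.Signed as Signed
import Data.Integer.DivMod as ℤDM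
import Data.Integer.Properties as ℤₚ
open import Data.Integer.Tactic.RingSolver using (solve-∀)
open import Data.List.Relation.Unary.All as ListAll using ([]; _∷_)
open import Data.Maybe using (just; nothing)
open import Data.List using (List; []; _∷_; _++_; map)
open import Data.Nat as ℕ using (ℕ; zero; suc; _≤_; _^_; z≤n; s≤s)
import Data.Nat.Divisibility as ℕD
open import Data.Nat.Tactic.RingSolver using () renaming (solve-∀ to ℕ-solve-∀)
open import Data.Nat.Induction using (<-wellFounded)
open import Data.Nat.Primality using (Prime; prime⇒irreducible; prime⇒nonZero; prime⇒nonTrivial)
open import Data.Nat.Primality.Factorisation using (PrimeFactorisation; factorise)
open import Data.Nat.ListAction using (product)
import Data.Nat.Properties as ℕₚ
open import Data.Product using (Σ; ∃; ∃-syntax; _×_; _,_; proj₁; proj₂)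
open import Data.Rational as ℚ using (ℚ)
import Data.Rational.Properties as ℚₚ
import Data.Rational.Unnormalised as ℚᵘ
import Data.Rational.Unnormalised.Properties as ℚᵘₚ
open import Data.Sum using (_⊎_; inj₁; inj₂)
open import Data.Unit using (⊤; tt)
open import Data.Vec.Functional using () renaming (_∷_ to _◂_; _++_ to _⧺_)
import Data.Vec.Functional.Properties as Vecₚ
open import Function.Base using (_∘_; id)
open import Induction.WellFounded using (Acc; acc)
open import Relation.Nullary using (¬_; Dec; yes; no)
open import Relation.Binary.Definitions using (tri<; tri≈; tri>)
open import Relation.Nullary.Decidable using (⌊_⌋; map′; _×-dec_; ¬?)
open import Relation.Binary.PropositionalEquality using (_≡_; _≢_; refl; sym; trans; cong; cong₂; subst; subst₂; module ≡-Reasoning)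
open import Tactic.RingSolver using () renaming (solve-∀ to ring-∀)
open import Tactic.RingSolver.Core.AlmostCommutativeRing using (AlmostCommutativeRing; fromCommutativeRing)
open import Level using (0ℓ)

-- Finite sums and linear maps

-- For r > 0 the index of AΛ in Λ is infinite, and Λ may be strictly larger than Λ^F ⊕ (Λ ∩ W), so
-- p(1) cannot be read off after a change of basis of Λ. The shifted map s - A is injective on Λ and
-- preserves M = Λ′^F ⊕ (Λ′ ∩ W), so the unknown index [Λ : M] cancels from the two computations of
-- [Λ : (s - A)M]. Indices know determinants only up to sign; s therefore has to exceed the sum of
-- the two absolute values compared, which settles both signs. Finiteness of the groups is a result:
-- membership in the image of an integer matrix is decidable, and a decidable intermediate group
-- splits a finite index into two factors. The isomorphism between 𝒯 and 𝒯′ is not canonical.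
-- Duality replaces E by its transpose, so choices are unavoidable; the equivalence of a matrix with
-- its transpose makes them. The pairing of 𝔅 may degenerate on 𝔅[e]. Its order is therefore found
-- as |𝔅| divided by |𝔅/𝔅[e]|, where e times the pairing is nondegenerate on 𝔅/𝔅[e].

module Sums {A : Set} {_⊕_ _⊗_ : A → A → A} {0# 1# : A}
            (isSemiring : IsCommutativeSemiring _≡_ _⊕_ _⊗_ 0# 1#) where
  private module R = IsCommutativeSemiring isSemiring

  sum : (n : ℕ) → (Fin n → A) → A
  sum = ∑ 0# _⊕_

  sum-cong : ∀ n {f g : Fin n → A} → (∀ i → f i ≡ g i) → sum n f ≡ sum n g
  sum-cong zero    eq = refl
  sum-cong (suc n) eq = cong₂ _⊕_ (eq zero) (sum-cong n (eq ∘ suc))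

  interchange : ∀ a b c d → ((a ⊕ b) ⊕ (c ⊕ d)) ≡ ((a ⊕ c) ⊕ (b ⊕ d))
  interchange a b c d = trans (R.+-assoc a b (c ⊕ d)) (trans (cong (a ⊕_)
    (trans (sym (R.+-assoc b c d)) (trans (cong (_⊕ d) (R.+-comm b c)) (R.+-assoc c b d))))
    (sym (R.+-assoc a c (b ⊕ d))))

  sum-+ : ∀ n (f g : Fin n → A) → sum n (λ i → f i ⊕ g i) ≡ (sum n f ⊕ sum n g)
  sum-+ zero    f g = sym (R.+-identityˡ 0#)
  sum-+ (suc n) f g = trans (cong ((f zero ⊕ g zero) ⊕_) (sum-+ n (f ∘ suc) (g ∘ suc)))
    (interchange _ _ _ _)

  sum-*ˡ : ∀ n c (f : Fin n → A) → sum n (λ i → c ⊗ f i) ≡ (c ⊗ sum n f)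
  sum-*ˡ zero    c f = sym (R.zeroʳ c)
  sum-*ˡ (suc n) c f = trans (cong ((c ⊗ f zero) ⊕_) (sum-*ˡ n c (f ∘ suc))) (sym (R.distribˡ c _ _))

  sum-zero : ∀ n {f : Fin n → A} → (∀ i → f i ≡ 0#) → sum n f ≡ 0#
  sum-zero zero    eq = refl
  sum-zero (suc n) eq = trans (cong₂ _⊕_ (eq zero) (sum-zero n (eq ∘ suc))) (R.+-identityˡ 0#)

  sum-swap : ∀ m n (f : Fin m → Fin n → A) →
             sum m (λ i → sum n (f i)) ≡ sum n (λ j → sum m (λ i → f i j))
  sum-swap zero    n f = sym (sum-zero n (λ _ → refl))
  sum-swap (suc m) n f = trans (cong (sum n (f zero) ⊕_) (sum-swap m n (f ∘ suc)))
    (sym (sum-+ n (f zero) (λ j → sum m (λ i → f (suc i) j))))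

module Sumℤ = Sums ℤₚ.+-*-isCommutativeSemiring
module Sumℚ = Sums (IsCommutativeRing.isCommutativeSemiring ℚₚ.+-*-isCommutativeRing)
open Sumℤ using (sum; sum-cong; sum-+; sum-*ˡ; sum-zero; sum-swap) public

+-congˡ : ∀ a {b c : ℤ} → b ≡ c → a ℤ.+ b ≡ a ℤ.+ c
+-congˡ a p = cong₂ ℤ._+_ (refl {x = a}) p

dot : {n : ℕ} → Vecℤ n → Vecℤ n → ℤ
dot {n} g x = sum n (λ j → g j ℤ.* x j)

dot-cong : {n : ℕ} {g g' x x' : Vecℤ n} → g ≗ℤ g' → x ≗ℤ x' → dot g x ≡ dot g' x'
dot-cong p q = sum-cong _ (λ j → cong₂ ℤ._*_ (p j) (q j))

dot-comm : {n : ℕ} (g x : Vecℤ n) → dot g x ≡ dot x g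
dot-comm g x = sum-cong _ (λ j → ℤₚ.*-comm (g j) (x j))

dot-+ʳ : {n : ℕ} (g x y : Vecℤ n) → dot g (x +ℤ y) ≡ dot g x ℤ.+ dot g y
dot-+ʳ g x y = trans (sum-cong _ (λ j → ℤₚ.*-distribˡ-+ (g j) (x j) (y j))) (sum-+ _ (λ j → g j ℤ.* x j) (λ j → g j ℤ.* y j))

dot-·ʳ : {n : ℕ} (g : Vecℤ n) (c : ℤ) (x : Vecℤ n) → dot g (c ·ℤ x) ≡ c ℤ.* dot g x
dot-·ʳ g c x = trans (sum-cong _ (λ j → comm3 (g j) c (x j))) (sum-*ˡ _ c (λ j → g j ℤ.* x j))
  where
  comm3 : ∀ a b c → a ℤ.* (b ℤ.* c) ≡ b ℤ.* (a ℤ.* c)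
  comm3 = solve-∀

0v : {n : ℕ} → Vecℤ n
0v _ = + 0

-- Recursive in both indices, so that `e (suc j)` computes to `e j` with a 0 in front; `e-diag`
-- relates it to the decision `i ≟ j` inside `charPoly`.
e : {n : ℕ} → Fin n → Vecℤ n
e zero    zero    = + 1
e zero    (suc i) = + 0
e (suc j) zero    = + 0
e (suc j) (suc i) = e j i

dot-0ˡ : {n : ℕ} {g : Vecℤ n} (x : Vecℤ n) → g ≗ℤ 0v → dot g x ≡ + 0
dot-0ˡ x p = sum-zero _ (λ j → trans (cong (ℤ._* x j) (p j)) (ℤₚ.*-zeroˡ (x j)))

dot-0ʳ : {n : ℕ} (g : Vecℤ n) {x : Vecℤ n} → x ≗ℤ 0v → dot g x ≡ + 0
dot-0ʳ g p = trans (dot-comm g _) (dot-0ˡ g p)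

dot-e : {n : ℕ} (g : Vecℤ n) (j : Fin n) → dot g (e j) ≡ g j
dot-e {suc n} g zero = trans (cong₂ ℤ._+_ (ℤₚ.*-identityʳ (g zero)) (dot-0ʳ (g ∘ suc) {λ _ → + 0} (λ _ → refl)))
  (ℤₚ.+-identityʳ (g zero))
dot-e {suc n} g (suc j) = trans (cong (ℤ._+ dot (g ∘ suc) (e j)) (ℤₚ.*-zeroʳ (g zero)))
  (trans (ℤₚ.+-identityˡ _) (dot-e (g ∘ suc) j))

≗-sym : {n : ℕ} {x y : Vecℤ n} → x ≗ℤ y → y ≗ℤ x
≗-sym p i = sym (p i)

≗-trans : {n : ℕ} {x y z : Vecℤ n} → x ≗ℤ y → y ≗ℤ z → x ≗ℤ z
≗-trans p q i = trans (p i) (q i)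

infixr 30 _⨾_
_⨾_ : {n : ℕ} {x y z : Vecℤ n} → x ≗ℤ y → y ≗ℤ z → x ≗ℤ z
_⨾_ = ≗-trans

+ℤ-cong : {n : ℕ} {x x' y y' : Vecℤ n} → x ≗ℤ x' → y ≗ℤ y' → (x +ℤ y) ≗ℤ (x' +ℤ y')
+ℤ-cong p q i = cong₂ ℤ._+_ (p i) (q i)

-ℤ-cong : {n : ℕ} {x x' y y' : Vecℤ n} → x ≗ℤ x' → y ≗ℤ y' → (x -ℤ y) ≗ℤ (x' -ℤ y')
-ℤ-cong p q i = cong₂ ℤ._-_ (p i) (q i)

·ℤ-cong : {n : ℕ} (c : ℤ) {x x' : Vecℤ n} → x ≗ℤ x' → (c ·ℤ x) ≗ℤ (c ·ℤ x')
·ℤ-cong c p i = cong (c ℤ.*_) (p i)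

·ℤ-cancel : {n : ℕ} {c : ℤ} {x y : Vecℤ n} → c ≢ + 0 → (c ·ℤ x) ≗ℤ (c ·ℤ y) → x ≗ℤ y
·ℤ-cancel {c = c} {x} {y} c≢0 p i = ℤₚ.*-cancelˡ-≡ c (x i) (y i) {{ℤ.≢-nonZero c≢0}} (p i)

-- Vectors are functions compared pointwise, without function extensionality; respecting `≗ℤ` is
-- therefore part of the data.
record Lin (n m : ℕ) : Set where
  constructor lin
  field
    fn     : Vecℤ n → Vecℤ m
    fcong  : ∀ {x y} → x ≗ℤ y → fn x ≗ℤ fn y
    fadd   : ∀ x y → fn (x +ℤ y) ≗ℤ (fn x +ℤ fn y)
    fscale : ∀ c x → fn (c ·ℤ x) ≗ℤ (c ·ℤ fn x)

  f0 : ∀ {x} → x ≗ℤ 0v → fn x ≗ℤ 0v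
  f0 {x} p = fcong (λ i → trans (p i) (sym (ℤₚ.*-zeroˡ (x i)))) ⨾ fscale (+ 0) x ⨾ λ i → ℤₚ.*-zeroˡ (fn x i)

  fsub : ∀ x y → fn (x -ℤ y) ≗ℤ (fn x -ℤ fn y)
  fsub x y = fcong {x -ℤ y} {x +ℤ (-[1+ 0 ] ·ℤ y)} (λ i → h (x i) (y i)) ⨾ fadd x _ ⨾
    λ i → trans (+-congˡ (fn x i) (fscale -[1+ 0 ] y i)) (sym (h (fn x i) (fn y i)))
    where
    h : ∀ a b → a ℤ.- b ≡ a ℤ.+ -[1+ 0 ] ℤ.* b
    h = solve-∀

open Lin public

matVec : {m n : ℕ} → (Fin m → Fin n → ℤ) → Vecℤ n → Vecℤ m
matVec M x i = dot (M i) x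

matLin : {m n : ℕ} → (Fin m → Fin n → ℤ) → Lin n m
matLin M .fn = matVec M
matLin M .fcong p i = dot-cong {g = M i} (λ _ → refl) p
matLin M .fadd x y i = dot-+ʳ (M i) x y
matLin M .fscale c x i = dot-·ʳ (M i) c x

idLin : {n : ℕ} → Lin n n
idLin = lin id id (λ _ _ _ → refl) (λ _ _ _ → refl)

infixr 9 _∘L_
_∘L_ : {k m n : ℕ} → Lin m k → Lin n m → Lin n k
(f ∘L g) .fn x = fn f (fn g x)
(f ∘L g) .fcong p = fcong f (fcong g p)
(f ∘L g) .fadd x y = fcong f (fadd g x y) ⨾ fadd f _ _
(f ∘L g) .fscale c x = fcong f (fscale g c x) ⨾ fscale f c _

infixl 6 _+L_ _-L_
_+L_ _-L_ : {m n : ℕ} → Lin n m → Lin n m → Lin n m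
(f +L g) .fn x = fn f x +ℤ fn g x
(f +L g) .fcong p = +ℤ-cong (fcong f p) (fcong g p)
(f +L g) .fadd x y i = trans (cong₂ ℤ._+_ (fadd f x y i) (fadd g x y i)) (h (fn f x i) (fn f y i) (fn g x i) (fn g y i))
  where
  h : ∀ a b c d → (a ℤ.+ b) ℤ.+ (c ℤ.+ d) ≡ (a ℤ.+ c) ℤ.+ (b ℤ.+ d)
  h = solve-∀
(f +L g) .fscale c x i = trans (cong₂ ℤ._+_ (fscale f c x i) (fscale g c x i)) (sym (ℤₚ.*-distribˡ-+ c _ _))
(f -L g) .fn x = fn f x -ℤ fn g x
(f -L g) .fcong p = -ℤ-cong (fcong f p) (fcong g p)
(f -L g) .fadd x y i = trans (cong₂ ℤ._-_ (fadd f x y i) (fadd g x y i)) (h (fn f x i) (fn f y i) (fn g x i) (fn g y i))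
  where
  h : ∀ a b c d → (a ℤ.+ b) ℤ.- (c ℤ.+ d) ≡ (a ℤ.- c) ℤ.+ (b ℤ.- d)
  h = solve-∀
(f -L g) .fscale c x i = trans (cong₂ ℤ._-_ (fscale f c x i) (fscale g c x i)) (h c (fn f x i) (fn g x i))
  where
  h : ∀ a b c → a ℤ.* b ℤ.- a ℤ.* c ≡ a ℤ.* (b ℤ.- c)
  h = solve-∀

infixl 7 _·L_
_·L_ : {m n : ℕ} → ℤ → Lin n m → Lin n m
(c ·L f) .fn x = c ·ℤ fn f x
(c ·L f) .fcong p = ·ℤ-cong c (fcong f p)
(c ·L f) .fadd x y i = trans (cong (c ℤ.*_) (fadd f x y i)) (ℤₚ.*-distribˡ-+ c _ _)
(c ·L f) .fscale k x i = trans (cong (c ℤ.*_) (fscale f k x i)) (h c k (fn f x i))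
  where
  h : ∀ a b c → a ℤ.* (b ℤ.* c) ≡ b ℤ.* (a ℤ.* c)
  h = solve-∀

consˡ : {n : ℕ} → Lin n (suc n)
consˡ .fn x = + 0 ◂ x
consˡ .fcong p zero = refl
consˡ .fcong p (suc i) = p i
consˡ .fadd x y zero = refl
consˡ .fadd x y (suc i) = refl
consˡ .fscale c x zero = sym (ℤₚ.*-zeroʳ c)
consˡ .fscale c x (suc i) = refl

mat : {m n : ℕ} → Lin n m → Fin m → Fin n → ℤ
mat f i j = fn f (e j) i

matVec-mat : {m n : ℕ} (f : Lin n m) (x : Vecℤ n) → matVec (mat f) x ≗ℤ fn f x
matVec-mat {n = zero}  f x i = sym (f0 f {x} (λ ()) i)
matVec-mat {n = suc n} f x i = begin
  mat f i zero ℤ.* x zero ℤ.+ dot (λ j → mat f i (suc j)) (x ∘ suc)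
    ≡⟨ +-congˡ (mat f i zero ℤ.* x zero) (trans
         (dot-cong {g = λ j → mat f i (suc j)} (λ j → fcong f (λ { zero → refl ; (suc k) → refl }) i) (λ _ → refl))
         (matVec-mat (f ∘L consˡ) (x ∘ suc) i)) ⟩
  mat f i zero ℤ.* x zero ℤ.+ fn f (+ 0 ◂ (x ∘ suc)) i
    ≡⟨ cong (ℤ._+ fn f (+ 0 ◂ (x ∘ suc)) i) (trans (ℤₚ.*-comm (mat f i zero) (x zero)) (sym (fscale f (x zero) (e zero) i))) ⟩
  fn f (x zero ·ℤ e zero) i ℤ.+ fn f (+ 0 ◂ (x ∘ suc)) i
    ≡⟨ sym (fadd f _ _ i) ⟩
  fn f ((x zero ·ℤ e zero) +ℤ (+ 0 ◂ (x ∘ suc))) i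
    ≡⟨ fcong f split i ⟩
  fn f x i ∎
  where
  open ≡-Reasoning
  split : ((x zero ·ℤ e zero) +ℤ (+ 0 ◂ (x ∘ suc))) ≗ℤ x
  split zero    = trans (ℤₚ.+-identityʳ _) (ℤₚ.*-identityʳ _)
  split (suc k) = trans (cong (ℤ._+ x (suc k)) (ℤₚ.*-zeroʳ (x zero))) (ℤₚ.+-identityˡ _)

-- Adjacent column operations and the determinant

e-same : {n : ℕ} (a : Fin n) → e a a ≡ + 1
e-same zero    = refl
e-same (suc a) = e-same a

e-diff : {n : ℕ} (a k : Fin n) → k ≢ a → e a k ≡ + 0
e-diff zero    zero    k≢a = ⊥-elim (k≢a refl)
e-diff zero    (suc k) k≢a = refl
e-diff (suc a) zero    k≢a = refl
e-diff (suc a) (suc k) k≢a = e-diff a k (k≢a ∘ cong suc)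

-- Adds `c` times entry `b` to entry `a`. The factor `e a k` replaces a case distinction on `k`, so
-- that linearity is a ring identity.
addCol : {n : ℕ} → Fin n → Fin n → ℤ → Lin n n
addCol a b c .fn g k = g k ℤ.+ (c ℤ.* g b) ℤ.* e a k
addCol a b c .fcong p k = cong₂ (λ x y → x ℤ.+ (c ℤ.* y) ℤ.* e a k) (p k) (p b)
addCol a b c .fadd x y k = h c (x k) (y k) (x b) (y b) (e a k)
  where
  h : ∀ c x y u v d → (x ℤ.+ y) ℤ.+ (c ℤ.* (u ℤ.+ v)) ℤ.* d ≡ (x ℤ.+ (c ℤ.* u) ℤ.* d) ℤ.+ (y ℤ.+ (c ℤ.* v) ℤ.* d)
  h = solve-∀
addCol a b c .fscale s x k = h c s (x k) (x b) (e a k)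
  where
  h : ∀ c s x u d → s ℤ.* x ℤ.+ (c ℤ.* (s ℤ.* u)) ℤ.* d ≡ s ℤ.* (x ℤ.+ (c ℤ.* u) ℤ.* d)
  h = solve-∀

addCol-at : {n : ℕ} (a b : Fin n) (c : ℤ) (g : Vecℤ n) → fn (addCol a b c) g a ≡ g a ℤ.+ c ℤ.* g b
addCol-at a b c g = +-congˡ (g a) (trans (cong ((c ℤ.* g b) ℤ.*_) (e-same a)) (ℤₚ.*-identityʳ (c ℤ.* g b)))

addCol-off : {n : ℕ} (a b : Fin n) (c : ℤ) (g : Vecℤ n) → ∀ k → k ≢ a → fn (addCol a b c) g k ≡ g k
addCol-off a b c g k k≢a = trans (+-congˡ (g k) (trans (cong ((c ℤ.* g b) ℤ.*_) (e-diff a k k≢a)) (ℤₚ.*-zeroʳ (c ℤ.* g b)))) (ℤₚ.+-identityʳ (g k))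

addCol-inverse : {n : ℕ} (a b : Fin n) → a ≢ b → ∀ c c' → c ℤ.+ c' ≡ + 0 → (g : Vecℤ n) → fn (addCol a b c) (fn (addCol a b c') g) ≗ℤ g
addCol-inverse a b a≢b c c' c+c'≡0 g k = trans (cong (λ t → (g k ℤ.+ (c' ℤ.* g b) ℤ.* e a k) ℤ.+ (c ℤ.* t) ℤ.* e a k) (addCol-off a b c' g b (a≢b ∘ sym)))
  (trans (h c c' (g k) (g b) (e a k)) (trans (cong (λ t → g k ℤ.+ (t ℤ.* g b) ℤ.* e a k) c+c'≡0) (h₀ (g k) (g b) (e a k))))
  where
  h : ∀ c c' x u d → (x ℤ.+ (c' ℤ.* u) ℤ.* d) ℤ.+ (c ℤ.* u) ℤ.* d ≡ x ℤ.+ ((c ℤ.+ c') ℤ.* u) ℤ.* d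
  h = solve-∀
  h₀ : ∀ x u d → x ℤ.+ (+ 0 ℤ.* u) ℤ.* d ≡ x
  h₀ = solve-∀

addCol-dot : {n : ℕ} (a b : Fin n) (c : ℤ) (g x : Vecℤ n) → dot x (fn (addCol a b c) g) ≡ dot x g ℤ.+ (c ℤ.* g b) ℤ.* x a
addCol-dot a b c g x = trans (dot-cong {g = x} (λ _ → refl) (λ _ → refl)) (trans (dot-+ʳ x g ((c ℤ.* g b) ·ℤ e a))
  (+-congˡ (dot x g) (trans (dot-·ʳ x (c ℤ.* g b) (e a)) (cong ((c ℤ.* g b) ℤ.*_) (dot-e x a)))))

addCol-adj : {n : ℕ} (a b : Fin n) (c : ℤ) (g x : Vecℤ n) → dot (fn (addCol a b c) g) x ≡ dot g (fn (addCol b a c) x)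
addCol-adj a b c g x = trans (dot-comm (fn (addCol a b c) g) x) (trans (addCol-dot a b c g x)
  (trans (cong₂ ℤ._+_ (dot-comm x g) (h c (g b) (x a))) (sym (addCol-dot b a c x g))))
  where
  h : ∀ c u v → (c ℤ.* u) ℤ.* v ≡ (c ℤ.* v) ℤ.* u
  h = solve-∀

-- A unimodular matrix U, acting on columns by act and, transposed, on rows by row.
record Uni (n : ℕ) : Set where
  field
    row row⁻ act act⁻ : Lin n n
    row-row⁻ : ∀ g → fn row (fn row⁻ g) ≗ℤ g
    row⁻-row : ∀ g → fn row⁻ (fn row g) ≗ℤ g
    act-act⁻ : ∀ x → fn act (fn act⁻ x) ≗ℤ x
    act⁻-act : ∀ x → fn act⁻ (fn act x) ≗ℤ x
    adj : ∀ g x → dot (fn row g) x ≡ dot g (fn act x)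

open Uni public

idUni : {n : ℕ} → Uni n
idUni .row = idLin
idUni .row⁻ = idLin
idUni .act = idLin
idUni .act⁻ = idLin
idUni .row-row⁻ g i = refl
idUni .row⁻-row g i = refl
idUni .act-act⁻ g i = refl
idUni .act⁻-act g i = refl
idUni .adj g x = refl

infixl 8 _▹_
_▹_ : {n : ℕ} → Uni n → Uni n → Uni n
(u ▹ v) .row = row v ∘L row u
(u ▹ v) .row⁻ = row⁻ u ∘L row⁻ v
(u ▹ v) .act = act u ∘L act v
(u ▹ v) .act⁻ = act⁻ v ∘L act⁻ u
(u ▹ v) .row-row⁻ g = fcong (row v) (row-row⁻ u _) ⨾ row-row⁻ v g
(u ▹ v) .row⁻-row g = fcong (row⁻ u) (row⁻-row v _) ⨾ row⁻-row u g
(u ▹ v) .act-act⁻ g = fcong (act u) (act-act⁻ v _) ⨾ act-act⁻ u g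
(u ▹ v) .act⁻-act g = fcong (act⁻ v) (act⁻-act u _) ⨾ act⁻-act v g
(u ▹ v) .adj g x = trans (adj v (fn (row u) g) x) (adj u g (fn (act v) x))

-- Only neighbouring columns interact, because the determinant is shown to vanish for two equal
-- neighbouring columns; `det-op` rests on this.
data Op (n : ℕ) : Set where
  opL opR : Fin n → ℤ → Op n

target source : {n : ℕ} → Op n → Fin (suc n)
target (opL p _) = inject₁ p
target (opR p _) = suc p
source (opL p _) = suc p
source (opR p _) = inject₁ p

coef : {n : ℕ} → Op n → ℤ
coef (opL _ c) = c
coef (opR _ c) = c

inject₁≢suc : {n : ℕ} (p : Fin n) → inject₁ p ≢ suc p
inject₁≢suc (suc p) q = inject₁≢suc p (Finₚ.suc-injective q)

target≢source : {n : ℕ} (o : Op n) → target o ≢ source o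
target≢source (opL p _) = inject₁≢suc p
target≢source (opR p _) = inject₁≢suc p ∘ sym

opUni : {n : ℕ} → Op n → Uni (suc n)
opUni o = record
  { row = addCol a b c ; row⁻ = addCol a b (ℤ.- c) ; act = addCol b a c ; act⁻ = addCol b a (ℤ.- c)
  ; row-row⁻ = addCol-inverse a b a≢b c (ℤ.- c) (ℤₚ.+-inverseʳ c)
  ; row⁻-row = addCol-inverse a b a≢b (ℤ.- c) c (ℤₚ.+-inverseˡ c)
  ; act-act⁻ = addCol-inverse b a (a≢b ∘ sym) c (ℤ.- c) (ℤₚ.+-inverseʳ c)
  ; act⁻-act = addCol-inverse b a (a≢b ∘ sym) (ℤ.- c) c (ℤₚ.+-inverseˡ c)
  ; adj = addCol-adj a b c }
  where
  a = target o
  b = source o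
  c = coef o
  a≢b = target≢source o

opsUni : {n : ℕ} → List (Op n) → Uni (suc n)
opsUni []       = idUni
opsUni (o ∷ os) = opUni o ▹ opsUni os

opsUni-++ : {n : ℕ} (os os' : List (Op n)) (g : Vecℤ (suc n)) →
            fn (row (opsUni (os ++ os'))) g ≗ℤ fn (row (opsUni os')) (fn (row (opsUni os)) g)
opsUni-++ []       os' g i = refl
opsUni-++ (o ∷ os) os' g = opsUni-++ os os' (fn (row (opUni o)) g)

shift : {n : ℕ} → Op n → Op (suc n)
shift (opL p c) = opL (suc p) c
shift (opR p c) = opR (suc p) c

row-shift : {n : ℕ} (o : Op n) (g : Vecℤ (suc (suc n))) →
            fn (row (opUni (shift o))) g ≗ℤ (g zero ◂ fn (row (opUni o)) (g ∘ suc))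
row-shift (opL p c) g zero    = addCol-off (suc (inject₁ p)) (suc (suc p)) c g zero (λ ())
row-shift (opL p c) g (suc k) = refl
row-shift (opR p c) g zero    = addCol-off (suc (suc p)) (suc (inject₁ p)) c g zero (λ ())
row-shift (opR p c) g (suc k) = refl

row-shifts : {n : ℕ} (os : List (Op n)) (g : Vecℤ (suc (suc n))) →
             fn (row (opsUni (map shift os))) g ≗ℤ (g zero ◂ fn (row (opsUni os)) (g ∘ suc))
row-shifts []       g zero    = refl
row-shifts []       g (suc k) = refl
row-shifts (o ∷ os) g = fcong (row (opsUni (map shift os))) (row-shift o g) ⨾ row-shifts os _

module _ {n : ℕ} where
  Reducible : Vecℤ (suc n) → Set
  Reducible g = Σ (List (Op n)) λ os → ∀ k → fn (row (opsUni os)) g (suc k) ≡ + 0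

  red-op : (o : Op n) (g : Vecℤ (suc n)) → Reducible (fn (row (opUni o)) g) → Reducible g
  red-op o g (os , p) = (o ∷ os) , p

  red-ops : (os : List (Op n)) (g : Vecℤ (suc n)) → Reducible (fn (row (opsUni os)) g) → Reducible g
  red-ops os g (os' , p) = (os ++ os') , λ k → trans (opsUni-++ os os' g (suc k)) (p k)

mod-step : ∀ b a .{{_ : ℤ.NonZero a}} → b ℤ.+ (ℤ.- (b ℤDM./ a)) ℤ.* a ≡ + (b ℤDM.% a)
mod-step b a = trans (cong (ℤ._+ (ℤ.- (b ℤDM./ a)) ℤ.* a) (ℤDM.a≡a%n+[a/n]*n b a)) (h (+ (b ℤDM.% a)) (b ℤDM./ a) a)
  where
  h : ∀ r q a → (r ℤ.+ q ℤ.* a) ℤ.+ (ℤ.- q) ℤ.* a ≡ r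
  h = solve-∀

-- Each round divides twice: the second entry becomes `r = b % a`, then the head becomes `a % r`,
-- which is below `r` and so below `∣ a ∣`. This is the descent.
euclid : {n : ℕ} (g : Vecℤ (suc (suc n))) → (∀ k → g (suc (suc k)) ≡ + 0) → Acc ℕ._<_ ∣ g zero ∣ → Reducible g
euclid {n} g rest (acc rec) with g zero ℤ.≟ + 0
-- A zero head first receives the second entry, which is then subtracted from its old place.
... | yes g0≡0 = red-op (opL zero (+ 1)) g (red-op (opR zero -[1+ 0 ]) g₁ ([] , λ where
      zero    → trans (addCol-at (suc zero) zero -[1+ 0 ] g₁) (trans (cong₂ (λ x y → x ℤ.+ -[1+ 0 ] ℤ.* y)
                  (addCol-off zero (suc zero) (+ 1) g (suc zero) (λ ())) (trans (addCol-at zero (suc zero) (+ 1) g) (cong (ℤ._+ + 1 ℤ.* g (suc zero)) g0≡0)))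
                  (h (g (suc zero))))
      (suc k) → trans (addCol-off (suc zero) zero -[1+ 0 ] g₁ (suc (suc k)) (λ ())) (trans (addCol-off zero (suc zero) (+ 1) g (suc (suc k)) (λ ())) (rest k))))
  where
  g₁ = fn (addCol zero (suc zero) (+ 1)) g
  h : ∀ b → b ℤ.+ -[1+ 0 ] ℤ.* (+ 0 ℤ.+ + 1 ℤ.* b) ≡ + 0
  h = solve-∀
... | no g0≢0 = red-op (opR zero (ℤ.- (b ℤDM./ a))) g (step (+ r ℤ.≟ + 0))
  where
  a = g zero
  b = g (suc zero)
  instance
    nz : ℤ.NonZero a
    nz = ℤ.≢-nonZero g0≢0
  r = b ℤDM.% a
  g₁ = fn (addCol (suc zero) zero (ℤ.- (b ℤDM./ a))) g
  g₁0 : g₁ zero ≡ a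
  g₁0 = addCol-off (suc zero) zero (ℤ.- (b ℤDM./ a)) g zero (λ ())
  g₁1 : g₁ (suc zero) ≡ + r
  g₁1 = trans (addCol-at (suc zero) zero (ℤ.- (b ℤDM./ a)) g) (mod-step b a)
  rest₁ : ∀ k → g₁ (suc (suc k)) ≡ + 0
  rest₁ k = trans (addCol-off (suc zero) zero (ℤ.- (b ℤDM./ a)) g (suc (suc k)) (λ ())) (rest k)
  step : Dec (+ r ≡ + 0) → Reducible g₁
  step (yes r≡0) = [] , λ { zero → trans g₁1 r≡0 ; (suc k) → rest₁ k }
  step (no r≢0) = red-op (opL zero q) g₁ (euclid g₂ (λ k → trans (addCol-off zero (suc zero) q g₁ (suc (suc k)) (λ ())) (rest₁ k))
      (rec (subst (ℕ._< ∣ a ∣) (sym (cong ∣_∣ g₂0)) (ℕₚ.<-trans (ℤDM.n%d<d a (+ r)) (ℤDM.n%d<d b a)))))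
    where
    instance
      nzr : ℤ.NonZero (+ r)
      nzr = ℤ.≢-nonZero r≢0
    q = ℤ.- (a ℤDM./ + r)
    g₂ = fn (addCol zero (suc zero) q) g₁
    g₂0 : g₂ zero ≡ + (a ℤDM.% + r)
    g₂0 = trans (addCol-at zero (suc zero) q g₁) (trans (cong₂ (λ x t → x ℤ.+ q ℤ.* t) g₁0 g₁1) (mod-step a (+ r)))

-- The tail is reduced first, by operations moved one place to the right; then only two entries can
-- be nonzero and `euclid` applies.
reduceRow : {n : ℕ} (g : Vecℤ (suc n)) → Reducible g
reduceRow {zero}  g = [] , λ ()
reduceRow {suc n} g with reduceRow (g ∘ suc)
... | os , p = red-ops (map shift os) g (euclid _ (λ k → trans (row-shifts os g (suc (suc k))) (p k)) (<-wellFounded _))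

abstract
  -- Opaque, so that type checking never unfolds the Euclidean algorithm.
  reduce : {n : ℕ} (g : Vecℤ (suc n)) → Reducible g
  reduce = reduceRow

-- Multilinearity and alternation in the columns

detℤ-cong : {n : ℕ} {M N : Mat n} → (∀ i j → M i j ≡ N i j) → detℤ M ≡ detℤ N
detℤ-cong {zero}  eq = refl
detℤ-cong {suc n} eq = sum-cong (suc n) (λ j → cong₂ (λ a b → altSign intOps j ℤ.* (a ℤ.* b)) (eq zero j)
  (detℤ-cong (λ i k → eq (suc i) (punchIn j k))))

minor : {n : ℕ} → Mat (suc n) → Fin (suc n) → Mat n
minor M j i k = M (suc i) (punchIn j k)

-- In the expansion along row 0 the term of column `p` splits through its entry; every other term
-- splits through its minor, by induction, column `p` having become column `punchOut j≢p` there.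
det-linear : {n : ℕ} (M M' M'' : Mat n) (c : ℤ) (p : Fin n) →
             (∀ i k → k ≢ p → M i k ≡ M' i k) → (∀ i k → k ≢ p → M i k ≡ M'' i k) →
             (∀ i → M i p ≡ M' i p ℤ.+ c ℤ.* M'' i p) → detℤ M ≡ detℤ M' ℤ.+ c ℤ.* detℤ M''
det-linear {suc n} M M' M'' c p eq' eq'' eqp = trans (sum-cong (suc n) term)
  (trans (sum-+ (suc n) t' (λ j → c ℤ.* t'' j)) (+-congˡ (sum (suc n) t') (sum-*ˡ (suc n) c t'')))
  where
  t t' t'' : Fin (suc n) → ℤ
  t   j = altSign intOps j ℤ.* (M zero j ℤ.* detℤ (minor M j))
  t'  j = altSign intOps j ℤ.* (M' zero j ℤ.* detℤ (minor M' j))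
  t'' j = altSign intOps j ℤ.* (M'' zero j ℤ.* detℤ (minor M'' j))
  h : ∀ s a b c D → s ℤ.* ((a ℤ.+ c ℤ.* b) ℤ.* D) ≡ s ℤ.* (a ℤ.* D) ℤ.+ c ℤ.* (s ℤ.* (b ℤ.* D))
  h = solve-∀
  h' : ∀ s a c D D' → s ℤ.* (a ℤ.* (D ℤ.+ c ℤ.* D')) ≡ s ℤ.* (a ℤ.* D) ℤ.+ c ℤ.* (s ℤ.* (a ℤ.* D'))
  h' = solve-∀
  term : ∀ j → t j ≡ t' j ℤ.+ c ℤ.* t'' j
  term j with j Finₚ.≟ p
  ... | yes refl = begin
    t j
      ≡⟨ cong (λ a → altSign intOps j ℤ.* (a ℤ.* detℤ (minor M j))) (eqp zero) ⟩
    altSign intOps j ℤ.* ((M' zero j ℤ.+ c ℤ.* M'' zero j) ℤ.* detℤ (minor M j))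
      ≡⟨ h (altSign intOps j) (M' zero j) (M'' zero j) c (detℤ (minor M j)) ⟩
    altSign intOps j ℤ.* (M' zero j ℤ.* detℤ (minor M j)) ℤ.+ c ℤ.* (altSign intOps j ℤ.* (M'' zero j ℤ.* detℤ (minor M j)))
      ≡⟨ cong₂ (λ a b → altSign intOps j ℤ.* (M' zero j ℤ.* a) ℤ.+ c ℤ.* (altSign intOps j ℤ.* (M'' zero j ℤ.* b)))
           (detℤ-cong (λ i k → eq' (suc i) (punchIn j k) (Finₚ.punchInᵢ≢i j k)))
           (detℤ-cong (λ i k → eq'' (suc i) (punchIn j k) (Finₚ.punchInᵢ≢i j k))) ⟩
    t' j ℤ.+ c ℤ.* t'' j ∎
    where open ≡-Reasoning
  ... | no j≢p = trans (cong (λ D → altSign intOps j ℤ.* (M zero j ℤ.* D)) (det-linear (minor M j) (minor M' j) (minor M'' j) c q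
                   (λ i k k≢q → eq' (suc i) (punchIn j k) (λ e → k≢q (Finₚ.punchIn-injective j k q (trans e (sym jq)))))
                   (λ i k k≢q → eq'' (suc i) (punchIn j k) (λ e → k≢q (Finₚ.punchIn-injective j k q (trans e (sym jq)))))
                   (λ i → subst (λ z → M (suc i) z ≡ M' (suc i) z ℤ.+ c ℤ.* M'' (suc i) z) (sym jq) (eqp (suc i)))))
                 (trans (h' (altSign intOps j) (M zero j) c (detℤ (minor M' j)) (detℤ (minor M'' j)))
                   (cong₂ (λ a b → altSign intOps j ℤ.* (a ℤ.* detℤ (minor M' j)) ℤ.+ c ℤ.* (altSign intOps j ℤ.* (b ℤ.* detℤ (minor M'' j))))
                     (eq' zero j j≢p) (eq'' zero j j≢p)))
    where
    q = punchOut j≢p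
    jq : punchIn j q ≡ p
    jq = Finₚ.punchIn-punchOut j≢p

sum-pair : {n : ℕ} (p : Fin n) (f : Fin (suc n) → ℤ) → f (inject₁ p) ℤ.+ f (suc p) ≡ + 0 →
           (∀ j → j ≢ inject₁ p → j ≢ suc p → f j ≡ + 0) → sum (suc n) f ≡ + 0
sum-pair {suc n} zero f eq other = trans (sym (ℤₚ.+-assoc (f zero) (f (suc zero)) _))
  (trans (cong₂ ℤ._+_ eq (sum-zero n (λ j → other (suc (suc j)) (λ ()) (λ ())))) refl)
sum-pair {suc n} (suc p) f eq other = trans (cong₂ ℤ._+_ (other zero (λ ()) (λ ())) (sum-pair p (f ∘ suc) eq
  (λ j a b → other (suc j) (a ∘ Finₚ.suc-injective) (b ∘ Finₚ.suc-injective)))) refl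

-- Omitting one of two neighbouring columns or the other leaves the same columns, except at one
-- position, where each choice shows the column that the other omits.
punchIn-adjacent : {n : ℕ} (p k : Fin n) → punchIn (inject₁ p) k ≡ punchIn (suc p) k
  ⊎ (punchIn (inject₁ p) k ≡ suc p × punchIn (suc p) k ≡ inject₁ p)
punchIn-adjacent zero    zero    = inj₂ (refl , refl)
punchIn-adjacent zero    (suc k) = inj₁ refl
punchIn-adjacent (suc p) zero    = inj₁ refl
punchIn-adjacent (suc p) (suc k) with punchIn-adjacent p k
... | inj₁ q       = inj₁ (cong suc q)
... | inj₂ (q , r) = inj₂ (cong suc q , cong suc r)

adjacent-in-minor : {n : ℕ} (p : Fin (suc (suc n))) (j : Fin (suc (suc (suc n)))) → j ≢ inject₁ p → j ≢ suc p →
  Σ (Fin (suc n)) λ q → punchIn j (inject₁ q) ≡ inject₁ p × punchIn j (suc q) ≡ suc p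
adjacent-in-minor zero    zero          a b = ⊥-elim (a refl)
adjacent-in-minor zero    (suc zero)    a b = ⊥-elim (b refl)
adjacent-in-minor zero    (suc (suc j)) a b = zero , refl , refl
adjacent-in-minor (suc p) zero          a b = p , refl , refl
adjacent-in-minor {zero} (suc zero) (suc zero) a b = ⊥-elim (a refl)
adjacent-in-minor {zero} (suc zero) (suc (suc zero)) a b = ⊥-elim (b refl)
adjacent-in-minor {suc n} (suc p) (suc j) a b with adjacent-in-minor p j (a ∘ cong suc) (b ∘ cong suc)
... | q , r , s = suc q , cong suc r , cong suc s

altSign-inject₁ : {n : ℕ} (p : Fin n) → altSign intOps (inject₁ p) ≡ altSign intOps p
altSign-inject₁ zero    = refl
altSign-inject₁ (suc p) = cong ℤ.-_ (altSign-inject₁ p)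

-- The two equal columns contribute equal minors with opposite signs. Every other minor still
-- contains both columns, side by side, and vanishes by induction.
det-alternating : {n : ℕ} (M : Mat (suc n)) (p : Fin n) → (∀ i → M i (inject₁ p) ≡ M i (suc p)) → detℤ M ≡ + 0
minor-vanishes : {n : ℕ} (M : Mat (suc n)) (p : Fin n) → (∀ i → M i (inject₁ p) ≡ M i (suc p)) →
                 ∀ j → j ≢ inject₁ p → j ≢ suc p → detℤ (minor M j) ≡ + 0

det-alternating {n} M p eq = sum-pair p t pair other
  where
  t : Fin (suc n) → ℤ
  t j = altSign intOps j ℤ.* (M zero j ℤ.* detℤ (minor M j))
  same : ∀ i k → minor M (inject₁ p) i k ≡ minor M (suc p) i k
  same i k with punchIn-adjacent p k
  ... | inj₁ q       = cong (M (suc i)) q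
  ... | inj₂ (q , r) = trans (cong (M (suc i)) q) (trans (sym (eq (suc i))) (cong (M (suc i)) (sym r)))
  h : ∀ s x → s ℤ.* x ℤ.+ (ℤ.- s) ℤ.* x ≡ + 0
  h = solve-∀
  pair : t (inject₁ p) ℤ.+ t (suc p) ≡ + 0
  pair = trans (cong (ℤ._+ t (suc p)) (cong₂ ℤ._*_ (altSign-inject₁ p) (cong₂ ℤ._*_ (eq zero) (detℤ-cong same))))
    (h (altSign intOps p) (M zero (suc p) ℤ.* detℤ (minor M (suc p))))
  vanish : ∀ j → detℤ (minor M j) ≡ + 0 → t j ≡ + 0
  vanish j z = trans (cong (λ D → altSign intOps j ℤ.* (M zero j ℤ.* D)) z)
    (trans (cong (altSign intOps j ℤ.*_) (ℤₚ.*-zeroʳ (M zero j))) (ℤₚ.*-zeroʳ (altSign intOps j)))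
  other : ∀ j → j ≢ inject₁ p → j ≢ suc p → t j ≡ + 0
  other j a b = vanish j (minor-vanishes M p eq j a b)

minor-vanishes {suc zero} M zero eq zero a b = ⊥-elim (a refl)
minor-vanishes {suc zero} M zero eq (suc zero) a b = ⊥-elim (b refl)
minor-vanishes {suc (suc n)} M p eq j a b = let q , r , s = adjacent-in-minor p j a b in det-alternating {suc n} (minor M j) q
  (λ i → trans (cong (M (suc i)) r) (trans (eq (suc i)) (cong (M (suc i)) (sym s))))

replaceCol : {n : ℕ} → Mat n → Fin n → Vecℤ n → Mat n
replaceCol M p v i k = if ⌊ k Finₚ.≟ p ⌋ then v i else M i k

replaceCol-at : {n : ℕ} (M : Mat n) (p : Fin n) (v : Vecℤ n) → ∀ i → replaceCol M p v i p ≡ v i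
replaceCol-at M p v i with p Finₚ.≟ p
... | yes _  = refl
... | no p≢p = ⊥-elim (p≢p refl)

replaceCol-off : {n : ℕ} (M : Mat n) (p : Fin n) (v : Vecℤ n) → ∀ i k → k ≢ p → replaceCol M p v i k ≡ M i k
replaceCol-off M p v i k k≢p with k Finₚ.≟ p
... | yes k≡p = ⊥-elim (k≢p k≡p)
... | no _    = refl

adjacent-equal : {n : ℕ} (o : Op n) (M : Mat (suc n)) → (∀ i → M i (target o) ≡ M i (source o)) → detℤ M ≡ + 0
adjacent-equal (opL p _) M eq = det-alternating M p eq
adjacent-equal (opR p _) M eq = det-alternating M p (λ i → sym (eq i))

-- By linearity in column `a` the determinant changes by `c` times that of `N`, where column `a` is
-- replaced by its neighbour `b` and so occurs twice.
det-op : {n : ℕ} (o : Op n) (M : Mat (suc n)) → detℤ (λ i → fn (row (opUni o)) (M i)) ≡ detℤ M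
det-op o M = trans (det-linear (λ i → fn (addCol a b c) (M i)) M N c a
    (λ i → addCol-off a b c (M i))
    (λ i k k≢ → trans (addCol-off a b c (M i) k k≢) (sym (replaceCol-off M a col i k k≢)))
    (λ i → trans (addCol-at a b c (M i)) (cong (λ t → M i a ℤ.+ c ℤ.* t) (sym (replaceCol-at M a col i)))))
  (trans (cong (λ D → detℤ M ℤ.+ c ℤ.* D) (adjacent-equal o N (λ i → trans (replaceCol-at M a col i)
    (sym (replaceCol-off M a col i b (target≢source o ∘ sym))))))
    (trans (+-congˡ (detℤ M) (ℤₚ.*-zeroʳ c)) (ℤₚ.+-identityʳ (detℤ M))))
  where
  a = target o
  b = source o
  c = coef o
  col = λ i → M i b
  N = replaceCol M a col

det-ops : {n : ℕ} (os : List (Op n)) (M : Mat (suc n)) → detℤ (λ i → fn (row (opsUni os)) (M i)) ≡ detℤ M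
det-ops []       M = refl
det-ops (o ∷ os) M = trans (det-ops os (λ i → fn (row (opUni o)) (M i))) (det-op o M)

-- Kernels and images of integer matrices

headL : {n : ℕ} → Lin (suc n) 1
headL = lin (λ x _ → x zero) (λ p _ → p zero) (λ _ _ _ → refl) (λ _ _ _ → refl)

tailL : {n : ℕ} → Lin (suc n) n
tailL = lin (_∘ suc) (_∘ suc) (λ _ _ _ → refl) (λ _ _ _ → refl)

pairL : {l m : ℕ} → Lin l 1 → Lin l m → Lin l (suc m)
pairL h t .fn x = fn h x zero ◂ fn t x
pairL h t .fcong p zero    = fcong h p zero
pairL h t .fcong p (suc i) = fcong t p i
pairL h t .fadd x y zero    = fadd h x y zero
pairL h t .fadd x y (suc i) = fadd t x y i
pairL h t .fscale c x zero    = fscale h c x zero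
pairL h t .fscale c x (suc i) = fscale t c x i

zeroL : {l m : ℕ} → Lin l m
zeroL = lin (λ _ → 0v) (λ _ _ → refl) (λ _ _ _ → refl) (λ c _ _ → sym (ℤₚ.*-zeroʳ c))

consHead : {n : ℕ} → Lin 1 (suc n)
consHead = pairL idLin zeroL

-- ℤˡ = S ℤᵏ ⊕ U ℤᵏ′ with U spanning the kernel of G, and C a left inverse of G S up to the scalar D.
record Rank {l m : ℕ} (G : Lin l m) : Set where
  field
    k k′ : ℕ
    S : Lin k l
    U : Lin k′ l
    T : Lin l k
    V : Lin l k′
    decomp : ∀ x → x ≗ℤ (fn S (fn T x) +ℤ fn U (fn V x))
    VU : ∀ b → fn V (fn U b) ≗ℤ b
    GU : ∀ b → fn G (fn U b) ≗ℤ 0v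
    C : Lin m k
    D : ℤ
    D≢0 : D ≢ + 0
    CGS : ∀ a → fn C (fn G (fn S a)) ≗ℤ (D ·ℤ a)

  GST : ∀ x → fn G x ≗ℤ fn G (fn S (fn T x))
  GST x = fcong G (decomp x) ⨾ fadd G _ _ ⨾ λ i → trans (+-congˡ (fn G (fn S (fn T x)) i) (GU (fn V x) i)) (ℤₚ.+-identityʳ _)

  kernel : ∀ x → fn G x ≗ℤ 0v → x ≗ℤ fn U (fn V x)
  kernel x Gx≡0 i = trans (decomp x i) (trans (cong (ℤ._+ fn U (fn V x) i) (f0 S Tx≡0 i)) (ℤₚ.+-identityˡ _))
    where
    Tx≡0 : fn T x ≗ℤ 0v
    Tx≡0 = ·ℤ-cancel D≢0 (≗-sym (CGS (fn T x)) ⨾ f0 C (≗-sym (GST x) ⨾ Gx≡0) ⨾ λ i → sym (ℤₚ.*-zeroʳ D))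

-- In the new coordinates the functional `g` sees only the first one; its coefficient is, up to
-- sign, the gcd of the entries of `g`.
dot-row : {n : ℕ} (g : Vecℤ (suc n)) (r : Reducible g) (y : Vecℤ (suc n)) →
          dot g (fn (act (opsUni (proj₁ r))) y) ≡ fn (row (opsUni (proj₁ r))) g zero ℤ.* y zero
dot-row g (os , p) y = trans (sym (adj (opsUni os) g y)) (trans
  (+-congˡ (fn (row (opsUni os)) g zero ℤ.* y zero) (dot-0ˡ (y ∘ suc) p)) (ℤₚ.+-identityʳ _))

-- Row 0 is imposed after all the others. On the kernel `U` of those it is a functional, which
-- `dot-row` turns into `γ` times one coordinate. If `γ` is 0 nothing changes; otherwise the
-- corresponding vector moves from `U` to `S`.
rankData : {l m : ℕ} (G : Lin l m) → Rank G
rankData {l} {zero} G = record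
  { k = zero ; k′ = l ; S = zeroL ; U = idLin ; T = zeroL ; V = idLin
  ; decomp = λ x i → sym (ℤₚ.+-identityˡ (x i)) ; VU = λ b i → refl ; GU = λ b ()
  ; C = zeroL ; D = + 1 ; D≢0 = λ () ; CGS = λ a () }
rankData {l} {suc m} G = extend (rankData (tailL ∘L G))
  where
  extend : Rank (tailL ∘L G) → Rank G
  extend R = go k′ U V decomp VU GU
    where
    open Rank R
    go : (k′ : ℕ) (U : Lin k′ l) (V : Lin l k′) → (∀ x → x ≗ℤ (fn S (fn T x) +ℤ fn U (fn V x))) →
         (∀ b → fn V (fn U b) ≗ℤ b) → (∀ b → (fn G (fn U b) ∘ suc) ≗ℤ 0v) → Rank G
    go zero U V decomp VU GU = record
      { k = k ; k′ = zero ; S = S ; U = U ; T = T ; V = V ; decomp = decomp ; VU = VU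
      ; GU = λ b → f0 (G ∘L U) (λ ()) ; C = C ∘L tailL ; D = D ; D≢0 = D≢0 ; CGS = CGS }
    go (suc j) U V decomp VU GU = cases (γ ℤ.≟ + 0)
      where
      g : Vecℤ (suc j)
      g = mat (G ∘L U) zero
      r = reduce g
      u = opsUni (proj₁ r)
      γ = fn (row u) g zero
      Gact : ∀ y → fn G (fn U (fn (act u) y)) zero ≡ γ ℤ.* y zero
      Gact y = trans (sym (matVec-mat (G ∘L U) (fn (act u) y) zero)) (dot-row g r y)
      cases : Dec (γ ≡ + 0) → Rank G
      cases (yes γ≡0) = record
        { k = k ; k′ = suc j ; S = S ; U = U ; T = T ; V = V ; decomp = decomp ; VU = VU
        ; GU = λ b → λ { zero → trans (fcong (G ∘L U) (≗-sym (act-act⁻ u b)) zero)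
                                  (trans (Gact (fn (act⁻ u) b)) (trans (cong (ℤ._* fn (act⁻ u) b zero) γ≡0) (ℤₚ.*-zeroˡ (fn (act⁻ u) b zero))))
                       ; (suc i) → GU b i }
        ; C = C ∘L tailL ; D = D ; D≢0 = D≢0 ; CGS = CGS }
      cases (no γ≢0) = record
        { k = suc k ; k′ = j ; S = S′ ; U = U′ ; T = T′ ; V = V′ ; decomp = dec′
        ; VU = λ b i → trans (fcong (act⁻ u) (VU _) (suc i)) (act⁻-act u _ (suc i))
        ; GU = λ b → λ { zero → trans (Gact (+ 0 ◂ b)) (ℤₚ.*-zeroʳ γ) ; (suc i) → GU _ i }
        ; C = C′ ; D = γ ℤ.* D ; D≢0 = λ z → [_] (ℤₚ.i*j≡0⇒i≡0∨j≡0 γ z) ; CGS = cgs }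
        where
        [_] : γ ≡ + 0 ⊎ D ≡ + 0 → ⊥
        [ inj₁ z ] = γ≢0 z
        [ inj₂ z ] = D≢0 z
        S′ = (S ∘L tailL) +L (U ∘L act u ∘L consHead ∘L headL)
        U′ = U ∘L act u ∘L consˡ
        T′ = pairL (headL ∘L act⁻ u ∘L V) T
        V′ = tailL ∘L act⁻ u ∘L V
        -- On `S′ a` row 0 takes its value at `S` of the tail of `a` plus `γ` times the head of `a`.
        -- As `C` returns `D` times that tail, the difference formed here leaves `γ D` times the
        -- head; the tail is scaled by `γ` to match.
        C′ = pairL ((D ·L headL) -L (headL ∘L G ∘L S ∘L C ∘L tailL)) (γ ·L (C ∘L tailL))
        UA = U ∘L act u
        dec′ : ∀ x → x ≗ℤ (fn S′ (fn T′ x) +ℤ fn U′ (fn V′ x))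
        dec′ x i = begin
          x i
            ≡⟨ decomp x i ⟩
          s ℤ.+ fn U (fn V x) i
            ≡⟨ +-congˡ s (trans (fcong U (≗-sym (act-act⁻ u (fn V x))) i)
                 (trans (fcong UA (λ { zero → sym (ℤₚ.+-identityʳ _) ; (suc q) → sym (ℤₚ.+-identityˡ _) }) i) (fadd UA hd tl i))) ⟩
          s ℤ.+ (fn UA hd i ℤ.+ fn UA tl i)
            ≡⟨ sym (ℤₚ.+-assoc s (fn UA hd i) (fn UA tl i)) ⟩
          (s ℤ.+ fn UA hd i) ℤ.+ fn UA tl i ∎
          where
          open ≡-Reasoning
          s = fn S (fn T x) i
          hd = fn (consHead ∘L headL) (fn (act⁻ u) (fn V x))
          tl = + 0 ◂ (fn (act⁻ u) (fn V x) ∘ suc)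
        h : ∀ D x g y → D ℤ.* (x ℤ.+ g ℤ.* y) ℤ.- D ℤ.* x ≡ (g ℤ.* D) ℤ.* y
        h = solve-∀
        cgs : ∀ a → fn C′ (fn G (fn S′ a)) ≗ℤ ((γ ℤ.* D) ·ℤ a)
        cgs a = λ
          { zero → trans (cong₂ (λ p q → D ℤ.* p ℤ.- q)
                     (trans (fadd G (fn S (a ∘ suc)) _ zero) (+-congˡ (fn G (fn S (a ∘ suc)) zero) (Gact hd)))
                     (trans (fcong (G ∘L S) Ct zero) (fscale (G ∘L S) D (a ∘ suc) zero)))
                   (h D (fn G (fn S (a ∘ suc)) zero) γ (a zero))
          ; (suc i) → trans (cong (γ ℤ.*_) (Ct i)) (sym (ℤₚ.*-assoc γ D (a (suc i)))) }
          where
          hd : Vecℤ (suc j)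
          hd = a zero ◂ 0v
          Ct : fn C (fn G (fn S′ a) ∘ suc) ≗ℤ (D ·ℤ (a ∘ suc))
          Ct = fcong C (λ i → trans (fadd G (fn S (a ∘ suc)) _ (suc i))
                 (trans (+-congˡ (fn G (fn S (a ∘ suc)) (suc i)) (GU (fn (act u ∘L consHead ∘L headL) a) i)) (ℤₚ.+-identityʳ _))) ⨾ CGS (a ∘ suc)

abstract
  rank : {l m : ℕ} (G : Lin l m) → Rank G
  rank = rankData

_≗?_ : {n : ℕ} (x y : Vecℤ n) → Dec (x ≗ℤ y)
x ≗? y = Finₚ.all? (λ i → x i ℤ.≟ y i)

Im : {l m : ℕ} → Lin l m → Vecℤ m → Set
Im G y = ∃[ x ] (y ≗ℤ fn G x)

Multiple : {n : ℕ} → ℤ → Vecℤ n → Set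
Multiple c x = ∃[ y ] (x ≗ℤ (c ·ℤ y))

multiple? : {n : ℕ} (c : ℤ) (x : Vecℤ n) → Dec (Multiple c x)
multiple? c x = map′ (λ f → (λ i → Signed.quotient (f i)) , λ i → trans (Signed._∣_.equality (f i)) (ℤₚ.*-comm (Signed.quotient (f i)) c))
  (λ (y , p) i → Signed.divides (y i) (trans (p i) (ℤₚ.*-comm c (y i)))) (Finₚ.all? (λ i → c Signed.∣? x i))

-- If y = G x then C y = D (T x), so y determines the only candidate preimage in the span of `S`:
-- divide C y by `D` and test the result.
im? : {l m : ℕ} (G : Lin l m) (y : Vecℤ m) → Dec (Im G y)
im? G y with multiple? D (fn C y)
  where open Rank (rank G)
... | no ¬p = no λ (x , p) → ¬p (fn T x , fcong C (p ⨾ GST x) ⨾ CGS (fn T x))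
  where open Rank (rank G)
... | yes (a , p) = map′ (λ q → fn S a , q) (λ (x , q) → q ⨾ GST x ⨾ fcong (G ∘L S)
        (·ℤ-cancel D≢0 (≗-sym (CGS (fn T x)) ⨾ fcong C (≗-sym (q ⨾ GST x)) ⨾ p))) (y ≗? fn G (fn S a))
  where open Rank (rank G)

-- After column operations row 0 involves only the first coordinate; setting it to 0 leaves one
-- equation and one unknown fewer.
dependent : {n : ℕ} (G : Lin (suc n) n) → ∃[ x ] (¬ (x ≗ℤ 0v) × fn G x ≗ℤ 0v)
dependent {zero}  G = e zero , (λ p → 1≢0 (p zero)) , λ ()
  where
  1≢0 : + 1 ≢ + 0
  1≢0 ()
dependent {suc n} G with dependent (tailL ∘L G ∘L act (opsUni (proj₁ (reduce (mat G zero)))) ∘L consˡ)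
... | y , y≢0 , p = x , (λ x≡0 → y≢0 (λ i → trans (sym (act⁻-act u (+ 0 ◂ y) (suc i))) (f0 (act⁻ u) x≡0 (suc i)))) , λ
  { zero → trans (sym (matVec-mat G x zero)) (trans (dot-row (mat G zero) r (+ 0 ◂ y)) (ℤₚ.*-zeroʳ (fn (row u) (mat G zero) zero)))
  ; (suc i) → p i }
  where
  r = reduce (mat G zero)
  u = opsUni (proj₁ r)
  x = fn (act u) (+ 0 ◂ y)

-- Cardinalities of quotients

open HasCard public

record Bij {A B : Set} (_≈_ : A → A → Set) (_≋_ : B → B → Set) : Set where
  field
    fun  : A → B
    resp : ∀ {x y} → x ≈ y → fun x ≋ fun y
    inj  : ∀ {x y} → fun x ≋ fun y → x ≈ y
    surj : ∀ y → ∃[ x ] (fun x ≋ y)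
    ≋-sym   : ∀ {x y} → x ≋ y → y ≋ x
    ≋-trans : ∀ {x y z} → x ≋ y → y ≋ z → x ≋ z

module _ {A B : Set} {_≈_ : A → A → Set} {_≋_ : B → B → Set} (f : Bij _≈_ _≋_) {n : ℕ} where
  open Bij f

  card-→ : HasCard A _≈_ n → HasCard B _≋_ n
  card-→ h .to i = fun (to h i)
  card-→ h .from b = from h (proj₁ (surj b))
  card-→ h .from-resp {b} {b'} p =
    from-resp h (inj (≋-trans (proj₂ (surj b)) (≋-trans p (≋-sym (proj₂ (surj b'))))))
  card-→ h .from-to i = trans (from-resp h (inj (proj₂ (surj (fun (to h i)))))) (from-to h i)
  card-→ h .to-from b = ≋-trans (resp (to-from h (proj₁ (surj b)))) (proj₂ (surj b))

  card-← : HasCard B _≋_ n → HasCard A _≈_ n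
  card-← h .to i = proj₁ (surj (to h i))
  card-← h .from a = from h (fun a)
  card-← h .from-resp p = from-resp h (resp p)
  card-← h .from-to i = trans (from-resp h (proj₂ (surj (to h i)))) (from-to h i)
  card-← h .to-from a = inj (≋-trans (proj₂ (surj (to h (from h (fun a))))) (to-from h (fun a)))

card-unique : {A : Set} {_≈_ : A → A → Set} → (∀ {x y} → x ≈ y → y ≈ x) → (∀ {x y z} → x ≈ y → y ≈ z → x ≈ z) →
              {m n : ℕ} → HasCard A _≈_ m → HasCard A _≈_ n → m ≡ n
card-unique {_≈_ = _≈_} sy tr h h' = ℕₚ.≤-antisym (le h h') (le h' h)
  where
  le : {m n : ℕ} → HasCard _ _≈_ m → HasCard _ _≈_ n → m ≤ n
  le h h' = Finₚ.injective⇒≤ {f = λ i → from h' (to h i)} (λ {i} {j} eq → trans (sym (from-to h i)) (trans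
    (from-resp h (tr (sy (to-from h' (to h i))) (subst (λ k → to h' (from h' (to h i)) ≈ to h j) eq
      (subst (λ k → to h' k ≈ to h j) (sym eq) (to-from h' (to h j)))))) (from-to h j)))

-- The element 0 opens a class of its own only if nothing later is equivalent to it; each class is
-- thus represented by its last element.
quotient-Fin : ∀ n (_~_ : Fin n → Fin n → Set) → (∀ i j → Dec (i ~ j)) → (∀ i → i ~ i) →
               (∀ {i j} → i ~ j → j ~ i) → (∀ {i j k} → i ~ j → j ~ k → i ~ k) → ∃[ m ] HasCard (Fin n) _~_ m
quotient-Fin zero    _~_ dec rf sy tr = zero , record { to = id ; from = id ; from-resp = λ { {()} } ; from-to = λ () ; to-from = λ () }
quotient-Fin (suc n) _~_ dec rf sy tr
  with quotient-Fin n (λ i j → suc i ~ suc j) (λ i j → dec (suc i) (suc j)) (λ i → rf (suc i)) sy tr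
     | Finₚ.any? (λ j → dec zero (suc j))
... | m , h | yes (j , 0~j) = m , record
  { to = λ i → suc (to h i)
  ; from = fr
  ; from-resp = λ { {zero} {zero} p → refl
                  ; {zero} {suc y} p → from-resp h (tr (sy 0~j) p)
                  ; {suc x} {zero} p → from-resp h (tr p 0~j)
                  ; {suc x} {suc y} p → from-resp h p }
  ; from-to = from-to h
  ; to-from = λ { zero → tr (to-from h j) (sy 0~j) ; (suc i) → to-from h i } }
  where
  fr : Fin (suc n) → Fin m
  fr zero    = from h j
  fr (suc i) = from h i
... | m , h | no ¬p = suc m , record
  { to = t
  ; from = fr
  ; from-resp = λ { {zero} {zero} p → refl
                  ; {zero} {suc y} p → ⊥-elim (¬p (y , p))
                  ; {suc x} {zero} p → ⊥-elim (¬p (x , sy p))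
                  ; {suc x} {suc y} p → cong suc (from-resp h p) }
  ; from-to = λ { zero → refl ; (suc i) → cong suc (from-to h i) }
  ; to-from = λ { zero → rf zero ; (suc i) → to-from h i } }
  where
  t : Fin (suc m) → Fin (suc n)
  t zero    = zero
  t (suc i) = suc (to h i)
  fr : Fin (suc n) → Fin (suc m)
  fr zero    = zero
  fr (suc i) = suc (from h i)

subset-Fin : ∀ n (P : Fin n → Set) → (∀ i → Dec (P i)) → ∃[ m ] HasCard (Σ (Fin n) P) (λ x y → proj₁ x ≡ proj₁ y) m
subset-Fin zero    P dec = zero , record { to = λ () ; from = λ () ; from-resp = λ { {()} } ; from-to = λ () ; to-from = λ () }
subset-Fin (suc n) P dec with subset-Fin n (P ∘ suc) (dec ∘ suc) | dec zero
... | m , h | yes p0 = suc m , record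
  { to = t
  ; from = fr
  ; from-resp = λ { {zero , _} {zero , _} p → refl ; {suc x , _} {suc y , _} p → cong suc (from-resp h (Finₚ.suc-injective p)) }
  ; from-to = λ { zero → refl ; (suc i) → cong suc (from-to h i) }
  ; to-from = λ { (zero , _) → refl ; (suc i , p) → cong suc (to-from h (i , p)) } }
  where
  t : Fin (suc m) → Σ (Fin (suc n)) P
  t zero    = zero , p0
  t (suc i) = suc (proj₁ (to h i)) , proj₂ (to h i)
  fr : Σ (Fin (suc n)) P → Fin (suc m)
  fr (zero , _)  = zero
  fr (suc i , p) = suc (from h (i , p))
... | m , h | no ¬p0 = m , record
  { to = λ i → suc (proj₁ (to h i)) , proj₂ (to h i)
  ; from = fr
  ; from-resp = λ { {zero , q} p → ⊥-elim (¬p0 q) ; {suc x , _} {zero , q} p → ⊥-elim (¬p0 q)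
                  ; {suc x , _} {suc y , _} p → from-resp h (Finₚ.suc-injective p) }
  ; from-to = from-to h
  ; to-from = λ { (zero , q) → ⊥-elim (¬p0 q) ; (suc i , p) → cong suc (to-from h (i , p)) } }
  where
  fr : Σ (Fin (suc n)) P → Fin m
  fr (zero , q)  = ⊥-elim (¬p0 q)
  fr (suc i , p) = from h (i , p)

-- Subgroups of ℤⁿ and their indices

record Sub {n : ℕ} (H : Vecℤ n → Set) : Set where
  field
    ≗∈ : ∀ {x y} → x ≗ℤ y → H x → H y
    0∈ : H 0v
    -∈ : ∀ {x y} → H x → H y → H (x -ℤ y)

  neg∈ : ∀ {x} → H x → H (0v -ℤ x)
  neg∈ = -∈ 0∈

  +∈ : ∀ {x y} → H x → H y → H (x +ℤ y)
  +∈ {x} {y} p q = ≗∈ (λ i → h (x i) (y i)) (-∈ p (neg∈ q))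
    where
    h : ∀ a b → a ℤ.- (+ 0 ℤ.- b) ≡ a ℤ.+ b
    h = solve-∀

  swap∈ : ∀ x y → H (x -ℤ y) → H (y -ℤ x)
  swap∈ x y p = ≗∈ (λ i → h (x i) (y i)) (neg∈ p)
    where
    h : ∀ a b → + 0 ℤ.- (a ℤ.- b) ≡ b ℤ.- a
    h = solve-∀

  trans∈ : ∀ x y z → H (x -ℤ y) → H (y -ℤ z) → H (x -ℤ z)
  trans∈ x y z p q = ≗∈ (λ i → h (x i) (y i) (z i)) (+∈ p q)
    where
    h : ∀ a b c → (a ℤ.- b) ℤ.+ (b ℤ.- c) ≡ a ℤ.- c
    h = solve-∀

  refl∈ : ∀ x y → x ≗ℤ y → H (x -ℤ y)
  refl∈ x y p = ≗∈ (λ i → sym (ℤₚ.i≡j⇒i-j≡0 (p i))) 0∈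

  back∈ : ∀ x y → H (x -ℤ y) → H y → H x
  back∈ x y p q = ≗∈ (λ i → h (x i) (y i)) (+∈ p q)
    where
    h : ∀ a b → (a ℤ.- b) ℤ.+ b ≡ a
    h = solve-∀

  ℕ·∈ : ∀ k {x} → H x → H ((+ k) ·ℤ x)
  ℕ·∈ zero    {x} p = ≗∈ (λ i → sym (ℤₚ.*-zeroˡ (x i))) 0∈
  ℕ·∈ (suc k) {x} p = ≗∈ (λ i → h (+ k) (x i)) (+∈ p (ℕ·∈ k p))
    where
    h : ∀ c a → a ℤ.+ c ℤ.* a ≡ (+ 1 ℤ.+ c) ℤ.* a
    h = solve-∀

  ·∈ : ∀ c {x} → H x → H (c ·ℤ x)
  ·∈ (+ k)    p = ℕ·∈ k p
  ·∈ -[1+ k ] {x} p = ≗∈ (λ i → h (+ suc k) (x i)) (neg∈ (ℕ·∈ (suc k) p))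
    where
    h : ∀ c a → + 0 ℤ.- c ℤ.* a ≡ (ℤ.- c) ℤ.* a
    h = solve-∀

open Sub public

Quot : {n : ℕ} (H K : Vecℤ n → Set) → Σ (Vecℤ n) H → Σ (Vecℤ n) H → Set
Quot H K x y = K (proj₁ x -ℤ proj₁ y)

-- For suitable predicates this unfolds to the cardinality statements for (Λ/Λ′)^F and for Λ^F/Λ′^F,
-- so that indices can be returned there unchanged.
Index : {n : ℕ} (H K : Vecℤ n → Set) → ℕ → Set
Index {n} H K = HasCard (Σ (Vecℤ n) H) (Quot H K)

quot-sym : {d : ℕ} {H K : Vecℤ d → Set} → Sub K → ∀ {x y} → Quot H K x y → Quot H K y x
quot-sym sK {x} {y} = swap∈ sK (proj₁ x) (proj₁ y)

quot-trans : {d : ℕ} {H K : Vecℤ d → Set} → Sub K → ∀ {x y z} → Quot H K x y → Quot H K y z → Quot H K x z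
quot-trans sK {x} {y} {z} = trans∈ sK (proj₁ x) (proj₁ y) (proj₁ z)

_⊆_ : {n : ℕ} (H K : Vecℤ n → Set) → Set
H ⊆ K = ∀ {x} → H x → K x

index-unique : {d : ℕ} {H K : Vecℤ d → Set} → Sub K → {m n : ℕ} → Index H K m → Index H K n → m ≡ n
index-unique {H = H} {K} sK = card-unique {_≈_ = Quot H K} (λ {x} {y} → quot-sym {H = H} {K} sK {x} {y})
  (λ {x} {y} {z} → quot-trans {H = H} {K} sK {x} {y} {z})

module _ {d : ℕ} {H J K : Vecℤ d → Set} (sH : Sub H) (sJ : Sub J) (sK : Sub K) (K⊆J : K ⊆ J) (J⊆H : J ⊆ H) where

  -- A class of H/K amounts to its class in H/J together with the class in J/K of the difference
  -- from the chosen representative.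
  index-mult : {a b : ℕ} → Index H J a → Index J K b → Index H K (a ℕ.* b)
  index-mult {a} {b} h h' = record
    { to = λ q → sumOf (remQuot b q)
    ; from = λ x → combine (from h x) (from h' (rem x))
    ; from-resp = λ {x} {y} p → cong₂ combine (same p) (from-resp h' (≗∈ sK
        (λ i → trans (shuffle (proj₁ x i) (proj₁ y i) (proj₁ (to h (from h x)) i))
          (cong (λ k → (proj₁ x i ℤ.- proj₁ (to h (from h x)) i) ℤ.- (proj₁ y i ℤ.- proj₁ (to h k) i)) (same p))) p))
    ; from-to = λ q → trans (cong₂ combine (first (remQuot b q)) (second (remQuot b q))) (Finₚ.combine-remQuot {a} b q)
    ; to-from = λ x → subst (λ ij → K (proj₁ (sumOf ij) -ℤ proj₁ x))
        (sym (Finₚ.remQuot-combine (from h x) (from h' (rem x))))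
        (≗∈ sK (λ i → regroup (proj₁ (to h (from h x)) i) (proj₁ (to h' (from h' (rem x))) i) (proj₁ x i)) (to-from h' (rem x))) }
    where
    rem : Σ (Vecℤ d) H → Σ (Vecℤ d) J
    rem x = (proj₁ x -ℤ proj₁ (to h (from h x))) , swap∈ sJ (proj₁ (to h (from h x))) (proj₁ x) (to-from h x)
    sumOf : Fin a × Fin b → Σ (Vecℤ d) H
    sumOf (i , j) = (proj₁ (to h i) +ℤ proj₁ (to h' j)) , +∈ sH (proj₂ (to h i)) (J⊆H (proj₂ (to h' j)))
    same : ∀ {x y} → K (proj₁ x -ℤ proj₁ y) → from h x ≡ from h y
    same p = from-resp h (K⊆J p)
    shuffle : ∀ x y t → x ℤ.- y ≡ (x ℤ.- t) ℤ.- (y ℤ.- t)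
    shuffle = solve-∀
    regroup : ∀ s t x → t ℤ.- (x ℤ.- s) ≡ (s ℤ.+ t) ℤ.- x
    regroup = solve-∀
    minus : ∀ s t → t ≡ (s ℤ.+ t) ℤ.- s
    minus = solve-∀
    first : ∀ ij → from h (sumOf ij) ≡ proj₁ ij
    first (i , j) = trans (from-resp h (≗∈ sJ (λ k → minus (proj₁ (to h i) k) (proj₁ (to h' j) k)) (proj₂ (to h' j)))) (from-to h i)
    second : ∀ ij → from h' (rem (sumOf ij)) ≡ proj₂ ij
    second (i , j) = trans (from-resp h' (refl∈ sK (proj₁ (rem (sumOf (i , j)))) (proj₁ (to h' j)) (λ k → trans (cong (λ l → (proj₁ (to h i) k ℤ.+ proj₁ (to h' j) k) ℤ.- proj₁ (to h l) k)
      (first (i , j))) (sym (minus (proj₁ (to h i) k) (proj₁ (to h' j) k)))))) (from-to h' j)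

  -- Among the finitely many representatives of H/K, the group H/J is a decidable quotient and J/K
  -- is the decidable subset of those lying in J.
  index-split : (∀ x → Dec (J x)) → {n : ℕ} → Index H K n → ∃[ a ] ∃[ b ] (Index H J a × Index J K b × n ≡ a ℕ.* b)
  index-split J? {n} h = proj₁ q , proj₁ s , hJ , jK , index-unique {H = H} sK h (index-mult hJ jK)
    where
    q = quotient-Fin n (λ i j → J (proj₁ (to h i) -ℤ proj₁ (to h j))) (λ i j → J? _) (λ i → refl∈ sJ (proj₁ (to h i)) (proj₁ (to h i)) (λ _ → refl)) 
      (λ {i} {j} → swap∈ sJ (proj₁ (to h i)) (proj₁ (to h j)))
      (λ {i} {j} {k} → trans∈ sJ (proj₁ (to h i)) (proj₁ (to h j)) (proj₁ (to h k)))
    s = subset-Fin n (λ i → J (proj₁ (to h i))) (λ i → J? _)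
    hJ : Index H J (proj₁ q)
    hJ = card-→ (record { fun = to h ; resp = id ; inj = id ; surj = λ x → from h x , K⊆J (to-from h x)
                        ; ≋-sym = λ {x} {y} → quot-sym {H = H} sJ {x} {y} ; ≋-trans = λ {x} {y} {z} → quot-trans {H = H} sJ {x} {y} {z} }) (proj₂ q)
    jK : Index J K (proj₁ s)
    jK = card-→ (record
      { fun = λ (i , p) → proj₁ (to h i) , p
      ; resp = λ {x} {y} eq → refl∈ sK (proj₁ (to h (proj₁ x))) (proj₁ (to h (proj₁ y))) (λ k → cong (λ i → proj₁ (to h i) k) eq)
      ; inj = λ {x} {y} p → trans (sym (from-to h (proj₁ x))) (trans (from-resp h p) (from-to h (proj₁ y)))
      ; surj = λ x → (from h (proj₁ x , J⊆H (proj₂ x)) , back∈ sJ (proj₁ (to h (from h (proj₁ x , J⊆H (proj₂ x))))) (proj₁ x) (K⊆J (to-from h (proj₁ x , J⊆H (proj₂ x)))) (proj₂ x))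
                   , to-from h (proj₁ x , J⊆H (proj₂ x))
      ; ≋-sym = λ {x} {y} → quot-sym {H = J} sK {x} {y} ; ≋-trans = λ {x} {y} {z} → quot-trans {H = J} sK {x} {y} {z} }) (proj₂ s)

index-positive : {d : ℕ} {H K : Vecℤ d → Set} → Sub H → {n : ℕ} → Index H K n → n ≢ 0
index-positive sH h refl with from h (0v , 0∈ sH)
... | ()

linBij : {m n : ℕ} {H K : Vecℤ n → Set} {H' K' : Vecℤ m → Set} (f : Lin n m) → Sub H → Sub K' →
         (∀ {x} → H x → H' (fn f x)) → (∀ {x} → H x → K x → K' (fn f x)) → (∀ {x} → H x → K' (fn f x) → K x) →
         (∀ y → H' y → ∃[ x ] (H x × K' (fn f x -ℤ y))) → Bij (Quot H K) (Quot H' K')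
linBij {H' = H'} f sH sK' H⇒ K⇒ K⇐ sj = record
  { fun = λ (x , p) → fn f x , H⇒ p
  ; resp = λ {x} {y} p → ≗∈ sK' (fsub f (proj₁ x) (proj₁ y)) (K⇒ (-∈ sH (proj₂ x) (proj₂ y)) p)
  ; inj = λ {x} {y} p → K⇐ (-∈ sH (proj₂ x) (proj₂ y)) (≗∈ sK' (≗-sym (fsub f (proj₁ x) (proj₁ y))) p)
  ; surj = λ (y , p) → (proj₁ (sj y p) , proj₁ (proj₂ (sj y p))) , proj₂ (proj₂ (sj y p))
  ; ≋-sym = λ {x} {y} → quot-sym {H = H'} sK' {x} {y}
  ; ≋-trans = λ {x} {y} {z} → quot-trans {H = H'} sK' {x} {y} {z} }

-- The index of M ℤⁿ in ℤⁿ is the absolute value of det M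

All : {n : ℕ} → Vecℤ n → Set
All _ = ⊤

All-sub : {n : ℕ} → Sub (All {n})
All-sub = record { ≗∈ = λ _ _ → tt ; 0∈ = tt ; -∈ = λ _ _ → tt }

Im-sub : {l m : ℕ} (G : Lin l m) → Sub (Im G)
Im-sub G = record
  { ≗∈ = λ p (x , q) → x , (≗-sym p ⨾ q)
  ; 0∈ = 0v , ≗-sym (f0 G (λ _ → refl))
  ; -∈ = λ (x , p) (y , q) → (x -ℤ y) , (-ℤ-cong p q ⨾ ≗-sym (fsub G x y)) }

multiple<⇒0 : ∀ {m} k → k ℕ.< m → m ℕD.∣ k → k ≡ 0
multiple<⇒0 zero    k<m d = refl
multiple<⇒0 (suc k) k<m d = ⊥-elim (ℕₚ.<⇒≱ k<m (ℕD.∣⇒≤ d))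

residue-unique : ∀ m {r r'} → r ℕ.< m → r' ℕ.< m → + m Signed.∣ (+ r ℤ.- + r') → r ≡ r'
residue-unique m {r} {r'} r<m r'<m p with ℕₚ.≤-total r r'
... | inj₁ le = ℕₚ.≤-antisym le (ℕₚ.m∸n≡0⇒m≤n (multiple<⇒0 _ (ℕₚ.≤-<-trans (ℕₚ.m∸n≤m r' r) r'<m)
      (subst (m ℕD.∣_) (trans (cong ∣_∣ (ℤₚ.m-n≡m⊖n r r')) (ℤₚ.∣⊖∣-≤ le)) (Signed.∣⇒∣ᵤ p))))
... | inj₂ le = ℕₚ.≤-antisym (ℕₚ.m∸n≡0⇒m≤n (multiple<⇒0 _ (ℕₚ.≤-<-trans (ℕₚ.m∸n≤m r r') r<m)
      (subst (m ℕD.∣_) (cong ∣_∣ (trans (ℤₚ.m-n≡m⊖n r r') (ℤₚ.⊖-≥ le))) (Signed.∣⇒∣ᵤ p)))) le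

residue-cong : ∀ a m .{{_ : ℕ.NonZero m}} → + m Signed.∣ (+ (a ℤDM.%ℕ m) ℤ.- a)
residue-cong a m = Signed.divides (ℤ.- (a ℤDM./ℕ m))
  (trans (cong (λ t → + (a ℤDM.%ℕ m) ℤ.- t) (ℤDM.a≡a%ℕn+[a/ℕn]*n a m)) (h (+ (a ℤDM.%ℕ m)) (a ℤDM./ℕ m) (+ m)))
  where
  h : ∀ r q m → r ℤ.- (r ℤ.+ q ℤ.* m) ≡ (ℤ.- q) ℤ.* m
  h = solve-∀

∣-diff : ∀ {m} a b a' b' → m Signed.∣ (a ℤ.- b) → m Signed.∣ (a' ℤ.- a) → m Signed.∣ (b' ℤ.- b) → m Signed.∣ (a' ℤ.- b')
∣-diff {m} a b a' b' p q r = subst (m Signed.∣_) (h a b a' b') (Signed.∣m∣n⇒∣m-n (Signed.∣m∣n⇒∣m+n p q) r)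
  where
  h : ∀ a b a' b' → ((a ℤ.- b) ℤ.+ (a' ℤ.- a)) ℤ.- (b' ℤ.- b) ≡ a' ℤ.- b'
  h = solve-∀

resid : ℤ → ∀ m .{{_ : ℕ.NonZero m}} → Fin m
resid a m = fromℕ< (ℤDM.n%ℕd<d a m)

resid-cong : ∀ a m .{{_ : ℕ.NonZero m}} → + m Signed.∣ (+ (toℕ (resid a m)) ℤ.- a)
resid-cong a m = subst (λ r → + m Signed.∣ (+ r ℤ.- a)) (sym (Finₚ.toℕ-fromℕ< (ℤDM.n%ℕd<d a m))) (residue-cong a m)

resid-resp : ∀ m .{{_ : ℕ.NonZero m}} a b → + m Signed.∣ (a ℤ.- b) → resid a m ≡ resid b m
resid-resp m a b p = Finₚ.toℕ-injective (residue-unique m (Finₚ.toℕ<n (resid a m)) (Finₚ.toℕ<n (resid b m))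
  (∣-diff a b (+ toℕ (resid a m)) (+ toℕ (resid b m)) p (resid-cong a m) (resid-cong b m)))

resid-to : ∀ m .{{_ : ℕ.NonZero m}} (i : Fin m) → resid (+ toℕ i) m ≡ i
resid-to m i = Finₚ.toℕ-injective (residue-unique m (Finₚ.toℕ<n (resid (+ toℕ i) m)) (Finₚ.toℕ<n i) (resid-cong (+ toℕ i) m))

det-sparse : {n : ℕ} (M : Mat (suc n)) → (∀ k → M zero (suc k) ≡ + 0) → detℤ M ≡ M zero zero ℤ.* detℤ (minor M zero)
det-sparse {n} M p = trans (+-congˡ (+ 1 ℤ.* (M zero zero ℤ.* detℤ (minor M zero))) (sum-zero n (λ k →
    trans (cong (λ a → altSign intOps (suc k) ℤ.* (a ℤ.* detℤ (minor M (suc k)))) (p k))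
      (trans (cong (altSign intOps (suc k) ℤ.*_) (ℤₚ.*-zeroˡ (detℤ (minor M (suc k))))) (ℤₚ.*-zeroʳ (altSign intOps (suc k)))))))
  (trans (ℤₚ.+-identityʳ _) (ℤₚ.*-identityˡ (M zero zero ℤ.* detℤ (minor M zero))))

-- The induction step shared by the statements on determinants: column operations bring row 0 to (γ,
-- 0, ..., 0), and `N` is the remaining block.
module FirstRow {n : ℕ} (M : Mat (suc n)) where
  r = reduce (M zero)
  u = opsUni (proj₁ r)
  M′ : Mat (suc n)
  M′ i = fn (row u) (M i)
  γ = M′ zero zero
  N = minor M′ zero

  det-M : detℤ M ≡ γ ℤ.* detℤ N
  det-M = trans (sym (det-ops (proj₁ r) M)) (det-sparse M′ (proj₂ r))

  M′-act : ∀ x → matVec M′ x ≗ℤ matVec M (fn (act u) x)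
  M′-act x i = adj u (M i) x

  M′-0 : ∀ z → matVec M′ z zero ≡ γ ℤ.* z zero
  M′-0 z = trans (+-congˡ (γ ℤ.* z zero) (dot-0ˡ (z ∘ suc) (proj₂ r))) (ℤₚ.+-identityʳ _)

  M′-cons : ∀ x → matVec M′ (+ 0 ◂ x) ≗ℤ (+ 0 ◂ matVec N x)
  M′-cons x zero    = trans (M′-0 (+ 0 ◂ x)) (ℤₚ.*-zeroʳ γ)
  M′-cons x (suc i) = trans (cong (ℤ._+ dot (N i) x) (ℤₚ.*-zeroʳ (M′ (suc i) zero))) (ℤₚ.+-identityˡ (dot (N i) x))

  zero-head : ∀ (z : Vecℤ (suc n)) → z zero ≡ + 0 → z ≗ℤ (+ 0 ◂ (z ∘ suc))
  zero-head z p zero    = p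
  zero-head z p (suc i) = refl

  factors≢0 : detℤ M ≢ + 0 → γ ≢ + 0 × detℤ N ≢ + 0
  factors≢0 d = (λ p → d (trans det-M (trans (cong (ℤ._* detℤ N) p) (ℤₚ.*-zeroˡ (detℤ N)))))
              , (λ p → d (trans det-M (trans (cong (γ ℤ.*_) p) (ℤₚ.*-zeroʳ γ))))

Injective : {l m : ℕ} → Lin l m → Set
Injective G = ∀ x → fn G x ≗ℤ 0v → x ≗ℤ 0v

det≢0⇒injective : ∀ n (M : Mat n) → detℤ M ≢ + 0 → Injective (matLin M)
det≢0⇒injective zero    M d x p ()
det≢0⇒injective (suc n) M d x p = ≗-sym (act-act⁻ u x) ⨾ f0 (act u) y≡0
  where
  open FirstRow M
  y = fn (act⁻ u) x
  M′y : matVec M′ y ≗ℤ 0v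
  M′y = M′-act y ⨾ fcong (matLin M) (act-act⁻ u x) ⨾ p
  y0 : y zero ≡ + 0
  y0 with ℤₚ.i*j≡0⇒i≡0∨j≡0 γ (trans (sym (M′-0 y)) (M′y zero))
  ... | inj₁ z = ⊥-elim (proj₁ (factors≢0 d) z)
  ... | inj₂ z = z
  tail0 : (y ∘ suc) ≗ℤ 0v
  tail0 = det≢0⇒injective n N (proj₂ (factors≢0 d)) (y ∘ suc)
    (λ i → trans (sym (M′-cons (y ∘ suc) (suc i))) (trans (fcong (matLin M′) {+ 0 ◂ (y ∘ suc)} {y} (≗-sym (zero-head y y0)) (suc i)) (M′y (suc i))))
  y≡0 : y ≗ℤ 0v
  y≡0 zero    = y0
  y≡0 (suc i) = tail0 i

injective⇒det≢0 : ∀ n (M : Mat n) → Injective (matLin M) → detℤ M ≢ + 0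
injective⇒det≢0 zero    M ij ()
injective⇒det≢0 (suc n) M ij d with ℤₚ.i*j≡0⇒i≡0∨j≡0 (FirstRow.γ M) (trans (sym (FirstRow.det-M M)) d)
... | inj₂ z = injective⇒det≢0 n N (λ x p i → trans (sym (act⁻-act u (+ 0 ◂ x) (suc i))) (f0 (act⁻ u) (ij _
        (≗-sym (M′-act (+ 0 ◂ x)) ⨾ M′-cons x ⨾ λ { zero → refl ; (suc k) → p k })) (suc i))) z
  where open FirstRow M
-- Row 0 of `M′` vanishes entirely, and the other `n` rows in `n + 1` unknowns have a nonzero common
-- zero.
... | inj₁ γ≡0 = y≢0 (≗-sym (act⁻-act u y) ⨾ f0 (act⁻ u) (ij _ (≗-sym (M′-act y) ⨾ λ
        { zero → trans (M′-0 y) (trans (cong (ℤ._* y zero) γ≡0) (ℤₚ.*-zeroˡ (y zero))) ; (suc i) → M′y i })))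
  where
  open FirstRow M
  dep = dependent {n} (tailL ∘L matLin M′)
  y = proj₁ dep
  y≢0 = proj₁ (proj₂ dep)
  M′y = proj₂ (proj₂ dep)

-- Column operations do not change the image. It lies in the group `J` of vectors with head
-- divisible by `γ`, of index `∣ γ ∣`. Subtracting a multiple of column 0 of `M′` makes the head 0,
-- so J modulo the image is ℤⁿ modulo the image of `N`.
det-index : ∀ n (M : Mat n) → detℤ M ≢ + 0 → Index All (Im (matLin M)) ∣ detℤ M ∣
det-index zero M d = record
  { to = λ _ → 0v , tt ; from = λ _ → zero ; from-resp = λ _ → refl ; from-to = λ { zero → refl } ; to-from = λ x → 0v , λ () }
det-index (suc n) M d = subst (Index All (Im (matLin M))) (sym (trans (cong ∣_∣ det-M) (ℤₚ.abs-* γ (detℤ N))))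
  (card-→ same (index-mult All-sub J-sub (Im-sub (matLin M′)) ImM′⊆J (λ _ → tt) headIndex tailIndex))
  where
  open FirstRow M
  m = ∣ γ ∣
  γ≢0 = proj₁ (factors≢0 d)
  instance
    nz : ℕ.NonZero m
    nz = ℕ.≢-nonZero (γ≢0 ∘ ℤₚ.∣i∣≡0⇒i≡0)
  J : Vecℤ (suc n) → Set
  J x = + m Signed.∣ x zero
  J-sub : Sub J
  J-sub = record { ≗∈ = λ p → subst (+ m Signed.∣_) (p zero) ; 0∈ = Signed.divides (+ 0) refl ; -∈ = Signed.∣m∣n⇒∣m-n }
  ImM′⊆J : Im (matLin M′) ⊆ J
  ImM′⊆J (z , p) = subst (+ m Signed.∣_) (sym (trans (p zero) (M′-0 z))) (Signed.∣m⇒∣m*n (z zero) (Signed.∣m∣∣m {γ}))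
  same : Bij (Quot All (Im (matLin M′))) (Quot All (Im (matLin M)))
  same = linBij {H = All} {K = Im (matLin M′)} {H' = All} {K' = Im (matLin M)} idLin All-sub (Im-sub (matLin M)) (λ _ → tt)
    (λ _ (z , p) → fn (act u) z , (p ⨾ M′-act z))
    (λ _ (z , p) → fn (act⁻ u) z , (p ⨾ ≗-sym (M′-act (fn (act⁻ u) z) ⨾ fcong (matLin M) (act-act⁻ u z))))
    (λ y _ → y , tt , refl∈ (Im-sub (matLin M)) y y (λ _ → refl))
  headIndex : Index All J m
  headIndex = record
    { to = λ i → (+ toℕ i ◂ 0v) , tt
    ; from = λ x → resid (proj₁ x zero) m
    ; from-resp = λ {x} {y} → resid-resp m (proj₁ x zero) (proj₁ y zero)
    ; from-to = resid-to m
    ; to-from = λ x → resid-cong (proj₁ x zero) m }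
  tailIndex : Index J (Im (matLin M′)) ∣ detℤ N ∣
  tailIndex = card-→ (linBij {H = All} {K = Im (matLin N)} {H' = J} {K' = Im (matLin M′)} consˡ All-sub (Im-sub (matLin M′))
      (λ _ → Signed.divides (+ 0) refl)
      (λ _ (z , p) → (+ 0 ◂ z) , ((λ { zero → refl ; (suc i) → p i }) ⨾ ≗-sym (M′-cons z)))
      (λ {x} _ (z , p) → (z ∘ suc) , λ i → trans (p (suc i)) (trans (fcong (matLin M′) {z} {+ 0 ◂ (z ∘ suc)} (zero-head z (z0 z (p zero))) (suc i)) (M′-cons (z ∘ suc) (suc i))))
      lift)
    (det-index n N (proj₂ (factors≢0 d)))
    where
    z0 : ∀ z → + 0 ≡ matVec M′ z zero → z zero ≡ + 0
    z0 z p with ℤₚ.i*j≡0⇒i≡0∨j≡0 γ (trans (sym (M′-0 z)) (sym p))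
    ... | inj₁ q = ⊥-elim (γ≢0 q)
    ... | inj₂ q = q
    lift : ∀ y → J y → ∃[ x ] (⊤ × Im (matLin M′) ((+ 0 ◂ x) -ℤ y))
    lift y p = (λ i → y (suc i) ℤ.- M′ (suc i) zero ℤ.* t) , tt , (ℤ.- t ◂ 0v) , λ
      { zero → trans (trans (cong (λ a → + 0 ℤ.- a) (Signed._∣_.equality q)) (h₀ t γ)) (sym (M′-0 (ℤ.- t ◂ 0v)))
      ; (suc i) → trans (h₁ (y (suc i)) (M′ (suc i) zero) t)
          (sym (+-congˡ (M′ (suc i) zero ℤ.* (ℤ.- t)) (dot-0ʳ (M′ (suc i) ∘ suc) (λ _ → refl)))) }
      where
      q : γ Signed.∣ y zero
      q = Signed.∣-trans (Signed.m∣∣m∣ {γ}) p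
      t = Signed.quotient q
      h₀ : ∀ t g → + 0 ℤ.- t ℤ.* g ≡ g ℤ.* (ℤ.- t)
      h₀ = solve-∀
      h₁ : ∀ y m t → (y ℤ.- m ℤ.* t) ℤ.- y ≡ m ℤ.* (ℤ.- t) ℤ.+ + 0
      h₁ = solve-∀

-- An endomorphism with ker A = ker A² has, up to a scalar, an inverse P on its image that is a polynomial in A

module Horner {d : ℕ} (A : Lin d d) where

  -- The value at `A` of the polynomial of degree below `n` with coefficients `c`, lowest first.
  horner : (n : ℕ) → Vecℤ n → Lin d d
  horner zero    c = zeroL
  horner (suc n) c = (c zero ·L idLin) +L (A ∘L horner n (c ∘ suc))

  horner-cong : ∀ n {c c'} → c ≗ℤ c' → ∀ x → fn (horner n c) x ≗ℤ fn (horner n c') x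
  horner-cong zero    p x i = refl
  horner-cong (suc n) p x i = cong₂ ℤ._+_ (cong (ℤ._* x i) (p zero)) (fcong A (horner-cong n (p ∘ suc) x) i)

  horner-add : ∀ n c c' x → fn (horner n (c +ℤ c')) x ≗ℤ (fn (horner n c) x +ℤ fn (horner n c') x)
  horner-add zero    c c' x i = refl
  horner-add (suc n) c c' x i = trans
    (+-congˡ ((c zero ℤ.+ c' zero) ℤ.* x i) (trans (fcong A (horner-add n (c ∘ suc) (c' ∘ suc) x) i) (fadd A _ _ i)))
    (h (c zero) (c' zero) (x i) (fn A (fn (horner n (c ∘ suc)) x) i) (fn A (fn (horner n (c' ∘ suc)) x) i))
    where
    h : ∀ a b x u v → (a ℤ.+ b) ℤ.* x ℤ.+ (u ℤ.+ v) ≡ (a ℤ.* x ℤ.+ u) ℤ.+ (b ℤ.* x ℤ.+ v)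
    h = solve-∀

  horner-scale : ∀ n k c x → fn (horner n (k ·ℤ c)) x ≗ℤ (k ·ℤ fn (horner n c) x)
  horner-scale zero    k c x i = sym (ℤₚ.*-zeroʳ k)
  horner-scale (suc n) k c x i = trans
    (+-congˡ ((k ℤ.* c zero) ℤ.* x i) (trans (fcong A (horner-scale n k (c ∘ suc) x) i) (fscale A k _ i)))
    (h k (c zero) (x i) (fn A (fn (horner n (c ∘ suc)) x) i))
    where
    h : ∀ k a x u → (k ℤ.* a) ℤ.* x ℤ.+ k ℤ.* u ≡ k ℤ.* (a ℤ.* x ℤ.+ u)
    h = solve-∀

  horner-comm : ∀ n c x → fn A (fn (horner n c) x) ≗ℤ fn (horner n c) (fn A x)
  horner-comm zero    c x = f0 A (λ _ → refl)
  horner-comm (suc n) c x = fadd A _ _ ⨾ +ℤ-cong (fscale A (c zero) x) (fcong A (horner-comm n (c ∘ suc) x))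

  -- Linear dependence of 1, A, …, A^(d²) among the d × d matrices.
  annihilator : ∃[ n ] ∃[ c ] (¬ (c ≗ℤ 0v) × (∀ x → fn (horner n c) x ≗ℤ 0v))
  annihilator = suc N , c , proj₁ (proj₂ dep) , λ x i → trans (sym (matVec-mat (horner (suc N) c) x i))
      (dot-0ˡ x (λ j → trans (cong (λ (i , j) → fn (horner (suc N) c) (e j) i) (sym (Finₚ.remQuot-combine i j))) (proj₂ (proj₂ dep) (combine i j))))
    where
    N = d ℕ.* d
    G : Lin (suc N) N
    G .fn c q = (λ (i , j) → fn (horner (suc N) c) (e j) i) (remQuot d q)
    G .fcong p q = horner-cong (suc N) p _ _
    G .fadd c c' q = horner-add (suc N) c c' _ _
    G .fscale k c q = horner-scale (suc N) k c _ _
    dep = dependent G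
    c = proj₁ dep

  module _ (ker : ∀ x → fn A (fn A x) ≗ℤ 0v → fn A x ≗ℤ 0v) where

    -- As long as the constant coefficient is 0 the relation contains a factor A² and `ker` cancels
    -- one A. The lowest nonzero coefficient becomes `D`.
    strip : ∀ n c → ¬ (c ≗ℤ 0v) → (∀ x → fn A (fn (horner n c) x) ≗ℤ 0v) →
            ∃[ D ] (D ≢ + 0 × ∃[ n' ] ∃[ c' ] (∀ x → ((D ·ℤ fn A x) +ℤ fn A (fn A (fn (horner n' c') x))) ≗ℤ 0v))
    strip zero    c c≢0 p = ⊥-elim (c≢0 (λ ()))
    strip (suc n) c c≢0 p with c zero ℤ.≟ + 0
    ... | no c0≢0  = c zero , c0≢0 , n , (c ∘ suc) , λ x →
          ≗-sym (fadd A _ _ ⨾ +ℤ-cong (fscale A (c zero) x) (λ _ → refl)) ⨾ p x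
    ... | yes c0≡0 = strip n (c ∘ suc) (λ q → c≢0 (λ { zero → c0≡0 ; (suc i) → q i })) (λ x → ker _
          (fcong A (λ i → sym (trans (cong (ℤ._+ fn A (fn (horner n (c ∘ suc)) x) i)
            (trans (cong (ℤ._* x i) c0≡0) (ℤₚ.*-zeroˡ (x i)))) (ℤₚ.+-identityˡ _))) ⨾ p x))

record GroupInverse {d : ℕ} (A : Lin d d) : Set where
  field
    P : Lin d d
    D : ℤ
    D≢0 : D ≢ + 0
    AAP : ∀ x → fn A (fn A (fn P x)) ≗ℤ (D ·ℤ fn A x)
    comm : ∀ x → fn A (fn P x) ≗ℤ fn P (fn A x)

groupInverse : {d : ℕ} (A : Lin d d) → (∀ x → fn A (fn A x) ≗ℤ 0v → fn A x ≗ℤ 0v) → GroupInverse A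
groupInverse A ker with Horner.annihilator A
... | n , c , c≢0 , p with Horner.strip A ker n c c≢0 (λ x → f0 A (p x))
... | D , D≢0 , n' , c' , q = record
  { P = -[1+ 0 ] ·L horner n' c'
  ; D = D
  ; D≢0 = D≢0
  ; AAP = λ x → fscale (A ∘L A) -[1+ 0 ] (fn (horner n' c') x) ⨾ λ i → h (D ℤ.* fn A x i) (fn A (fn A (fn (horner n' c') x)) i) (q x i)
  ; comm = λ x → fscale A -[1+ 0 ] (fn (horner n' c') x) ⨾ ·ℤ-cong -[1+ 0 ] (horner-comm n' c' x) }
  where
  open Horner A
  h′ : ∀ a b → -[1+ 0 ] ℤ.* b ≡ a ℤ.- (a ℤ.+ b)
  h′ = solve-∀
  h : ∀ a b → a ℤ.+ b ≡ + 0 → -[1+ 0 ] ℤ.* b ≡ a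
  h a b p = trans (h′ a b) (trans (cong (λ t → a ℤ.- t) p) (ℤₚ.+-identityʳ a))

-- Evaluating the characteristic polynomial

eval-pAdd : ∀ p q t → eval (pAdd p q) t ≡ eval p t ℤ.+ eval q t
eval-pAdd []      q       t = sym (ℤₚ.+-identityˡ (eval q t))
eval-pAdd (a ∷ p) []      t = sym (ℤₚ.+-identityʳ _)
eval-pAdd (a ∷ p) (b ∷ q) t = trans (cong (λ z → (a ℤ.+ b) ℤ.+ t ℤ.* z) (eval-pAdd p q t)) (h a b t (eval p t) (eval q t))
  where
  h : ∀ a b t u v → (a ℤ.+ b) ℤ.+ t ℤ.* (u ℤ.+ v) ≡ (a ℤ.+ t ℤ.* u) ℤ.+ (b ℤ.+ t ℤ.* v)
  h = solve-∀

eval-pScale : ∀ c p t → eval (pScale c p) t ≡ c ℤ.* eval p t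
eval-pScale c []      t = sym (ℤₚ.*-zeroʳ c)
eval-pScale c (a ∷ p) t = trans (cong (λ z → c ℤ.* a ℤ.+ t ℤ.* z) (eval-pScale c p t)) (h c a t (eval p t))
  where
  h : ∀ c a t u → c ℤ.* a ℤ.+ t ℤ.* (c ℤ.* u) ≡ c ℤ.* (a ℤ.+ t ℤ.* u)
  h = solve-∀

eval-pNeg : ∀ p t → eval (pNeg p) t ≡ ℤ.- eval p t
eval-pNeg p t = trans (eval-pScale (ℤ.- (+ 1)) p t) (ℤₚ.-1*i≡-i (eval p t))

eval-pMul : ∀ p q t → eval (pMul p q) t ≡ eval p t ℤ.* eval q t
eval-pMul []      q t = sym (ℤₚ.*-zeroˡ (eval q t))
eval-pMul (a ∷ p) q t = trans (eval-pAdd (pScale a q) (+ 0 ∷ pMul p q) t) (trans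
  (cong₂ (λ u v → u ℤ.+ (+ 0 ℤ.+ t ℤ.* v)) (eval-pScale a q t) (eval-pMul p q t)) (h a (eval q t) t (eval p t)))
  where
  h : ∀ a u t v → a ℤ.* u ℤ.+ (+ 0 ℤ.+ t ℤ.* (v ℤ.* u)) ≡ (a ℤ.+ t ℤ.* v) ℤ.* u
  h = solve-∀

eval-≐[] : ∀ p t → p ≐ [] → eval p t ≡ + 0
eval-≐[] []      t eq = refl
eval-≐[] (a ∷ p) t eq = trans (cong₂ (λ u v → u ℤ.+ t ℤ.* v) (eq 0) (eval-≐[] p t (eq ∘ suc)))
  (trans (ℤₚ.+-identityˡ _) (ℤₚ.*-zeroʳ t))

eval-≐ : ∀ p q t → p ≐ q → eval p t ≡ eval q t
eval-≐ p       []      t eq = eval-≐[] p t eq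
eval-≐ []      (b ∷ q) t eq = sym (eval-≐[] (b ∷ q) t (λ k → sym (eq k)))
eval-≐ (a ∷ p) (b ∷ q) t eq = cong₂ (λ u v → u ℤ.+ t ℤ.* v) (eq 0) (eval-≐ p q t (eq ∘ suc))

eval-altSign : ∀ {n} (j : Fin n) t → eval (altSign polyOps j) t ≡ altSign intOps j
eval-altSign zero    t = trans (+-congˡ (+ 1) (ℤₚ.*-zeroʳ t)) refl
eval-altSign (suc j) t = trans (eval-pNeg (altSign polyOps j) t) (cong ℤ.-_ (eval-altSign j t))

eval-∑ : ∀ n (f : Fin n → Poly) t → eval (∑ [] pAdd n f) t ≡ sum n (λ i → eval (f i) t)
eval-∑ zero    f t = refl
eval-∑ (suc n) f t = trans (eval-pAdd (f zero) (∑ [] pAdd n (f ∘ suc)) t) (+-congˡ (eval (f zero) t) (eval-∑ n (f ∘ suc) t))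

eval-det : ∀ n (M : Fin n → Fin n → Poly) t → eval (det polyOps n M) t ≡ detℤ (λ i j → eval (M i j) t)
eval-det zero    M t = trans (+-congˡ (+ 1) (ℤₚ.*-zeroʳ t)) refl
eval-det (suc n) M t = trans (eval-∑ (suc n) term t) (sum-cong (suc n) (λ j → trans (eval-pMul (altSign polyOps j) (pMul (M zero j) (sub j)) t)
    (cong₂ ℤ._*_ (eval-altSign j t) (trans (eval-pMul (M zero j) (sub j) t)
      (cong (eval (M zero j) t ℤ.*_) (eval-det n (λ i k → M (suc i) (punchIn j k)) t))))))
  where
  sub term : Fin (suc n) → Poly
  sub j = det polyOps n (λ i k → M (suc i) (punchIn j k))
  term j = pMul (altSign polyOps j) (pMul (M zero j) (sub j))

e-diag : ∀ {n} (i j : Fin n) → e j i ≡ (if ⌊ i Fin.≟ j ⌋ then + 1 else + 0)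
e-diag zero    zero    = refl
e-diag zero    (suc j) = refl
e-diag (suc i) zero    = refl
e-diag (suc i) (suc j) = trans (e-diag i j) (lemma (i Fin.≟ j))
  where
  lemma : ∀ {i j : Fin _} (d : Dec (i ≡ j)) → (if ⌊ d ⌋ then + 1 else + 0) ≡ (if ⌊ map′ (cong suc) Finₚ.suc-injective d ⌋ then + 1 else + 0)
  lemma (yes p) = refl
  lemma (no p)  = refl

frob : {d : ℕ} → Mat d → Lin d d
frob F = matLin F -L idLin

shiftL : {d : ℕ} → Lin d d → ℤ → Lin d d
shiftL A s = (s ·L idLin) -L A

-- At t = 1 + s the matrix t - F is s - (F - 1).
charPoly-eval : {d : ℕ} (F : Mat d) (s : ℤ) → eval (charPoly F) (+ 1 ℤ.+ s) ≡ detℤ (mat (shiftL (frob F) s))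
charPoly-eval {d} F s = trans (eval-det d entries t) (detℤ-cong (λ i j → trans (entry i j)
    (sym (cong (λ z → s ℤ.* e j i ℤ.- (z ℤ.- e j i)) (dot-e (F i) j)))))
  where
  t = + 1 ℤ.+ s
  entries : Fin d → Fin d → Poly
  entries i j = pAdd (if ⌊ i Fin.≟ j ⌋ then pX else []) (pNeg (pConst (F i j)))
  h : ∀ s d f → (+ 1 ℤ.+ s) ℤ.* d ℤ.- f ≡ s ℤ.* d ℤ.- (f ℤ.- d)
  h = solve-∀
  diag : ∀ {i j : Fin d} (dc : Dec (i ≡ j)) → eval (if ⌊ dc ⌋ then pX else []) t ≡ t ℤ.* (if ⌊ dc ⌋ then + 1 else + 0)
  diag (yes p) = h′ t
    where
    h′ : ∀ t → + 0 ℤ.+ t ℤ.* (+ 1 ℤ.+ t ℤ.* + 0) ≡ t ℤ.* + 1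
    h′ = solve-∀
  diag (no p)  = sym (ℤₚ.*-zeroʳ t)
  konst : ∀ a → eval (pNeg (pConst a)) t ≡ ℤ.- a
  konst a = trans (eval-pNeg (pConst a) t) (cong ℤ.-_ (trans (+-congˡ a (ℤₚ.*-zeroʳ t)) (ℤₚ.+-identityʳ a)))
  entry : ∀ i j → eval (pAdd (if ⌊ i Fin.≟ j ⌋ then pX else []) (pNeg (pConst (F i j)))) t ≡ s ℤ.* e j i ℤ.- (F i j ℤ.- e j i)
  entry i j = trans (eval-pAdd (if ⌊ i Fin.≟ j ⌋ then pX else []) (pNeg (pConst (F i j))) t) (trans
    (cong₂ ℤ._+_ (trans (diag (i Fin.≟ j)) (cong (t ℤ.*_) (sym (e-diag i j)))) (konst (F i j))) (h s (e j i) (F i j)))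

eval-power : ∀ r s → eval (pPow (pAdd pX (pConst -[1+ 0 ])) r) (+ 1 ℤ.+ s) ≡ s ℤ.^ r
eval-power zero    s = h s
  where
  h : ∀ s → + 1 ℤ.+ (+ 1 ℤ.+ s) ℤ.* + 0 ≡ + 1
  h = solve-∀
eval-power (suc r) s = trans (eval-pMul (pAdd pX (pConst -[1+ 0 ])) (pPow (pAdd pX (pConst -[1+ 0 ])) r) (+ 1 ℤ.+ s))
  (cong₂ ℤ._*_ (h s) (eval-power r s))
  where
  h : ∀ s → -[1+ 0 ] ℤ.+ (+ 1 ℤ.+ s) ℤ.* (+ 1 ℤ.+ (+ 1 ℤ.+ s) ℤ.* + 0) ≡ s
  h = solve-∀

abs-^ : ∀ s r → ∣ (+ s) ℤ.^ r ∣ ≡ s ^ r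
abs-^ s zero    = refl
abs-^ s (suc r) = trans (ℤₚ.abs-* (+ s) ((+ s) ℤ.^ r)) (cong (s ℕ.*_) (abs-^ s r))

charPoly-abs : {d : ℕ} (F : Mat d) (r : ℕ) (p : Poly) →
  (charPoly F ≐ pMul (pPow (pAdd pX (pConst -[1+ 0 ])) r) p ⊎ charPoly F ≐ pNeg (pMul (pPow (pAdd pX (pConst -[1+ 0 ])) r) p)) →
  ∀ s → ∣ detℤ (mat (shiftL (frob F) (+ s))) ∣ ≡ s ^ r ℕ.* ∣ eval p (+ 1 ℤ.+ + s) ∣
charPoly-abs F r p eq s = trans (cong ∣_∣ (sym (charPoly-eval F (+ s)))) (trans (sides eq) (trans
    (cong ∣_∣ (trans (eval-pMul (pPow (pAdd pX (pConst -[1+ 0 ])) r) p t) (cong (ℤ._* eval p t) (eval-power r (+ s)))))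
    (trans (ℤₚ.abs-* ((+ s) ℤ.^ r) (eval p t)) (cong (ℕ._* ∣ eval p t ∣) (abs-^ s r)))))
  where
  t = + 1 ℤ.+ + s
  q = pMul (pPow (pAdd pX (pConst -[1+ 0 ])) r) p
  sides : charPoly F ≐ q ⊎ charPoly F ≐ pNeg q → ∣ eval (charPoly F) t ∣ ≡ ∣ eval q t ∣
  sides (inj₁ e) = cong ∣_∣ (eval-≐ (charPoly F) q t e)
  sides (inj₂ e) = trans (cong ∣_∣ (trans (eval-≐ (charPoly F) (pNeg q) t e) (eval-pNeg q t))) (ℤₚ.∣-i∣≡∣i∣ (eval q t))

-- Congruences modulo s

∣-*-cong : ∀ {s} a b c d → s Signed.∣ (a ℤ.- b) → s Signed.∣ (c ℤ.- d) → s Signed.∣ (a ℤ.* c ℤ.- b ℤ.* d)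
∣-*-cong {s} a b c d p q = subst (s Signed.∣_) (h a b c d) (Signed.∣m∣n⇒∣m+n (Signed.∣m⇒∣m*n c p) (Signed.∣n⇒∣m*n b q))
  where
  h : ∀ a b c d → (a ℤ.- b) ℤ.* c ℤ.+ b ℤ.* (c ℤ.- d) ≡ a ℤ.* c ℤ.- b ℤ.* d
  h = solve-∀

∣-+-cong : ∀ {s} a b c d → s Signed.∣ (a ℤ.- b) → s Signed.∣ (c ℤ.- d) → s Signed.∣ ((a ℤ.+ c) ℤ.- (b ℤ.+ d))
∣-+-cong {s} a b c d p q = subst (s Signed.∣_) (h a b c d) (Signed.∣m∣n⇒∣m+n p q)
  where
  h : ∀ a b c d → (a ℤ.- b) ℤ.+ (c ℤ.- d) ≡ (a ℤ.+ c) ℤ.- (b ℤ.+ d)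
  h = solve-∀

∣-refl-cong : ∀ {s} a → s Signed.∣ (a ℤ.- a)
∣-refl-cong a = Signed.divides (+ 0) (ℤₚ.+-inverseʳ a)

eval-mod : ∀ p s → s Signed.∣ (eval p (+ 1 ℤ.+ s) ℤ.- eval p (+ 1))
eval-mod []      s = ∣-refl-cong (+ 0)
eval-mod (a ∷ p) s = ∣-+-cong a a ((+ 1 ℤ.+ s) ℤ.* eval p (+ 1 ℤ.+ s)) (+ 1 ℤ.* eval p (+ 1)) (∣-refl-cong a)
  (∣-*-cong (+ 1 ℤ.+ s) (+ 1) (eval p (+ 1 ℤ.+ s)) (eval p (+ 1)) (Signed.divides (+ 1) (h s)) (eval-mod p s))
  where
  h : ∀ s → (+ 1 ℤ.+ s) ℤ.- + 1 ≡ + 1 ℤ.* s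
  h = solve-∀

sum-mod : ∀ n {s} (f g : Fin n → ℤ) → (∀ i → s Signed.∣ (f i ℤ.- g i)) → s Signed.∣ (sum n f ℤ.- sum n g)
sum-mod zero    f g p = ∣-refl-cong (+ 0)
sum-mod (suc n) f g p = ∣-+-cong (f zero) (g zero) (sum n (f ∘ suc)) (sum n (g ∘ suc)) (p zero) (sum-mod n (f ∘ suc) (g ∘ suc) (p ∘ suc))

det-mod : ∀ n {s} (M N : Mat n) → (∀ i j → s Signed.∣ (M i j ℤ.- N i j)) → s Signed.∣ (detℤ M ℤ.- detℤ N)
det-mod zero    M N p = ∣-refl-cong (+ 1)
det-mod (suc n) M N p = sum-mod (suc n) (term M) (term N) (λ j →
    ∣-*-cong (altSign intOps j) (altSign intOps j) (M zero j ℤ.* detℤ (minor M j)) (N zero j ℤ.* detℤ (minor N j)) (∣-refl-cong (altSign intOps j))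
      (∣-*-cong (M zero j) (N zero j) (detℤ (minor M j)) (detℤ (minor N j)) (p zero j)
        (det-mod n (minor M j) (minor N j) (λ i k → p (suc i) (punchIn j k)))))
  where
  term : Mat (suc n) → Fin (suc n) → ℤ
  term M j = altSign intOps j ℤ.* (M zero j ℤ.* detℤ (minor M j))

∣-small : ∀ {s} a → s Signed.∣ a → ∣ a ∣ ℕ.< ∣ s ∣ → a ≡ + 0
∣-small a p lt = ℤₚ.∣i∣≡0⇒i≡0 (multiple<⇒0 ∣ a ∣ lt (Signed.∣⇒∣ᵤ p))

abs-≡ : ∀ i j → ∣ i ∣ ≡ ∣ j ∣ → i ≡ j ⊎ i ≡ ℤ.- j
abs-≡ (+ m)    (+ n)    p = inj₁ (cong +_ p)
abs-≡ (+ m)    -[1+ n ] p = inj₂ (cong +_ p)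
abs-≡ -[1+ m ] (+ n)    p = inj₂ (cong (λ k → ℤ.- (+ k)) p)
abs-≡ -[1+ m ] -[1+ n ] p = inj₁ (cong (λ k → ℤ.- (+ k)) p)

module Comparison (f g a b : ℤ) (a≢0 : a ≢ + 0) (b≢0 : b ≢ + 0)
    (s₀ : ℕ) (large : ∣ a ∣ ℕ.+ ∣ b ∣ ℕ.< s₀) (f≡a : + s₀ Signed.∣ (f ℤ.- a)) (g≡b : + s₀ Signed.∣ (g ℤ.- b)) where

  instance
    s₀-nonZero : ℕ.NonZero s₀
    s₀-nonZero = ℕ.>-nonZero (ℕₚ.≤-<-trans z≤n large)

  residue∤ : ∀ x y k → y ≢ + 0 → ∣ y ∣ ℕ.< s₀ → + s₀ Signed.∣ (x ℤ.- y) → ∣ x ∣ ≢ s₀ ℕ.* k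
  residue∤ x y k y≢0 lt p eq = y≢0 (∣-small y (subst (+ s₀ Signed.∣_) (h x y) (Signed.∣m∣n⇒∣m-n
      (Signed.∣ᵤ⇒∣ {+ s₀} {x} (subst (s₀ ℕD.∣_) (sym eq) (ℕD.m∣m*n k))) p)) lt)
    where
    h : ∀ x y → x ℤ.- (x ℤ.- y) ≡ y
    h = solve-∀

  a<s₀ : ∣ a ∣ ℕ.< s₀
  a<s₀ = ℕₚ.≤-<-trans (ℕₚ.m≤m+n ∣ a ∣ ∣ b ∣) large
  b<s₀ : ∣ b ∣ ℕ.< s₀
  b<s₀ = ℕₚ.≤-<-trans (ℕₚ.m≤n+m ∣ b ∣ ∣ a ∣) large

  cancelPower : ∀ m k {x y} → s₀ ^ m ℕ.* x ≡ s₀ ^ (m ℕ.+ k) ℕ.* y → x ≡ s₀ ^ k ℕ.* y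
  cancelPower m k {x} {y} eq = ℕₚ.*-cancelˡ-≡ x (s₀ ^ k ℕ.* y) (s₀ ^ m) {{ℕₚ.m^n≢0 s₀ m}}
    (trans eq (trans (cong (ℕ._* y) (ℕₚ.^-distribˡ-+-* s₀ m k)) (ℕₚ.*-assoc (s₀ ^ m) (s₀ ^ k) y)))

  -- Neither `f` nor `g` is divisible by `s₀`, being congruent to nonzero numbers of smaller
  -- absolute value; this forces r = r′. Then f = ±g, so `s₀` divides a - b or a + b, which is too
  -- small not to be 0.
  compare-powers : ∀ r r' → (s₀ ^ r ℕ.* ∣ f ∣ ≡ s₀ ^ r' ℕ.* ∣ g ∣) → r ≡ r' × ∣ a ∣ ≡ ∣ b ∣
  compare-powers r r' eq with ℕₚ.<-cmp r r'
  ... | tri< lt _ _ = ⊥-elim (residue∤ f a (s₀ ^ k ℕ.* ∣ g ∣) a≢0 a<s₀ f≡a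
          (trans (cancelPower r (suc k) (trans eq (cong (λ z → s₀ ^ z ℕ.* ∣ g ∣) (sym kk)))) (ℕₚ.*-assoc s₀ (s₀ ^ k) ∣ g ∣)))
    where
    k = r' ℕ.∸ suc r
    kk : r ℕ.+ suc k ≡ r'
    kk = trans (ℕₚ.+-suc r k) (ℕₚ.m+[n∸m]≡n lt)
  ... | tri> _ _ gt = ⊥-elim (residue∤ g b (s₀ ^ k ℕ.* ∣ f ∣) b≢0 b<s₀ g≡b
          (trans (cancelPower r' (suc k) (trans (sym eq) (cong (λ z → s₀ ^ z ℕ.* ∣ f ∣) (sym kk)))) (ℕₚ.*-assoc s₀ (s₀ ^ k) ∣ f ∣)))
    where
    k = r ℕ.∸ suc r'
    kk : r' ℕ.+ suc k ≡ r
    kk = trans (ℕₚ.+-suc r' k) (ℕₚ.m+[n∸m]≡n gt)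
  ... | tri≈ _ refl _ = refl , same (abs-≡ f g (ℕₚ.*-cancelˡ-≡ ∣ f ∣ ∣ g ∣ (s₀ ^ r) {{ℕₚ.m^n≢0 s₀ r}} eq))
    where
    same : f ≡ g ⊎ f ≡ ℤ.- g → ∣ a ∣ ≡ ∣ b ∣
    same (inj₁ q) = cong ∣_∣ (ℤₚ.i-j≡0⇒i≡j a b (∣-small {+ s₀} (a ℤ.- b) (subst (+ s₀ Signed.∣_)
        (trans (cong (λ z → (g ℤ.- b) ℤ.- (z ℤ.- a)) q) (h g a b)) (Signed.∣m∣n⇒∣m-n g≡b f≡a))
        (ℕₚ.≤-<-trans (ℤₚ.∣i-j∣≤∣i∣+∣j∣ a b) large)))
      where
      h : ∀ x a b → (x ℤ.- b) ℤ.- (x ℤ.- a) ≡ a ℤ.- b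
      h = solve-∀
    same (inj₂ q) = trans (cong ∣_∣ (h₂ a b (∣-small {+ s₀} (a ℤ.+ b) (subst (+ s₀ Signed.∣_)
        (trans (cong (λ z → ℤ.- ((g ℤ.- b) ℤ.+ (z ℤ.- a))) q) (h g a b)) (Signed.∣m⇒∣-m (Signed.∣m∣n⇒∣m+n g≡b f≡a)))
        (ℕₚ.≤-<-trans (ℤₚ.∣i+j∣≤∣i∣+∣j∣ a b) large)))) (ℤₚ.∣-i∣≡∣i∣ b)
      where
      h : ∀ x a b → ℤ.- ((x ℤ.- b) ℤ.+ (ℤ.- x ℤ.- a)) ≡ a ℤ.+ b
      h = solve-∀
      h₁ : ∀ a b → a ≡ (a ℤ.+ b) ℤ.+ ℤ.- b
      h₁ = solve-∀
      h₂ : ∀ a b → a ℤ.+ b ≡ + 0 → a ≡ ℤ.- b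
      h₂ a b p = trans (h₁ a b) (trans (cong (ℤ._+ ℤ.- b) p) (ℤₚ.+-identityˡ (ℤ.- b)))

-- Lattice bases and the index of an endomorphism

record Basis {d : ℕ} (H : Vecℤ d → Set) : Set where
  field
    rk   : ℕ
    φ    : Lin rk d
    φ∈   : ∀ y → H (fn φ y)
    φinj : Injective φ
    span : ∀ x → H x → ∃[ y ] (x ≗ℤ fn φ y)

  φ-≗ : ∀ {y z} → fn φ y ≗ℤ fn φ z → y ≗ℤ z
  φ-≗ {y} {z} p i = ℤₚ.i-j≡0⇒i≡j (y i) (z i) (φinj (y -ℤ z) (fsub φ y z ⨾ λ j → ℤₚ.i≡j⇒i-j≡0 (p j)) i)

Image : {d : ℕ} → Lin d d → (Vecℤ d → Set) → Vecℤ d → Set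
Image T H x = ∃[ w ] (H w × x ≗ℤ fn T w)

Image-sub : {d : ℕ} (T : Lin d d) {H : Vecℤ d → Set} → Sub H → Sub (Image T H)
Image-sub T sH = record
  { ≗∈ = λ p (w , h , q) → w , h , (≗-sym p ⨾ q)
  ; 0∈ = 0v , 0∈ sH , ≗-sym (f0 T (λ _ → refl))
  ; -∈ = λ (w , h , p) (w' , h' , p') → (w -ℤ w') , -∈ sH h h' , (-ℤ-cong p p' ⨾ ≗-sym (fsub T w w')) }

×-sub : {d : ℕ} {H K : Vecℤ d → Set} → Sub H → Sub K → Sub (λ x → H x × K x)
×-sub sH sK = record
  { ≗∈ = λ p (h , k) → ≗∈ sH p h , ≗∈ sK p k
  ; 0∈ = 0∈ sH , 0∈ sK
  ; -∈ = λ (h , k) (h' , k') → -∈ sH h h' , -∈ sK k k' }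

preimage-sub : {d m : ℕ} (T : Lin d m) {H : Vecℤ m → Set} → Sub H → Sub (λ x → H (fn T x))
preimage-sub T sH = record
  { ≗∈ = λ p → ≗∈ sH (fcong T p)
  ; 0∈ = ≗∈ sH (≗-sym (f0 T (λ _ → refl))) (0∈ sH)
  ; -∈ = λ {x} {y} h h' → ≗∈ sH (≗-sym (fsub T x y)) (-∈ sH h h') }

_⊞_ : {d : ℕ} (H K : Vecℤ d → Set) → Vecℤ d → Set
(H ⊞ K) x = ∃[ a ] ∃[ b ] (H a × K b × x ≗ℤ (a +ℤ b))

⊞-sub : {d : ℕ} {H K : Vecℤ d → Set} → Sub H → Sub K → Sub (H ⊞ K)
⊞-sub sH sK = record
  { ≗∈ = λ p (a , b , h , k , q) → a , b , h , k , (≗-sym p ⨾ q)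
  ; 0∈ = 0v , 0v , 0∈ sH , 0∈ sK , λ _ → refl
  ; -∈ = λ (a , b , h , k , q) (a' , b' , h' , k' , q') → (a -ℤ a') , (b -ℤ b') , -∈ sH h h' , -∈ sK k k' ,
      λ i → trans (cong₂ ℤ._-_ (q i) (q' i)) (rearrange (a i) (b i) (a' i) (b' i)) }
  where
  rearrange : ∀ a b a' b' → (a ℤ.+ b) ℤ.- (a' ℤ.+ b') ≡ (a ℤ.- a') ℤ.+ (b ℤ.- b')
  rearrange = solve-∀

+-0v : {d : ℕ} (x : Vecℤ d) → x ≗ℤ (x +ℤ 0v)
+-0v x i = sym (ℤₚ.+-identityʳ (x i))

0v-+ : {d : ℕ} (x : Vecℤ d) → x ≗ℤ (0v +ℤ x)
0v-+ x i = sym (ℤₚ.+-identityˡ (x i))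

kernelBasis : {l m : ℕ} (G : Lin l m) → Basis (λ x → fn G x ≗ℤ 0v)
kernelBasis G = record
  { rk = k′ ; φ = U ; φ∈ = GU
  ; φinj = λ y p → ≗-sym (VU y) ⨾ f0 V p
  ; span = λ x p → fn V x , kernel x p }
  where open Rank (rank G)

module _ {d : ℕ} {H : Vecℤ d → Set} (sH : Sub H) (bs : Basis H) where
  open Basis bs

  module _ (T : Lin d d) (T∈ : ∀ {x} → H x → H (fn T x)) where

    -- The endomorphism T in the coordinates of the basis. The coordinates are chosen by `span`;
    -- they depend linearly on the vector because `φ` is injective.
    induced : Lin rk rk
    induced-spec : ∀ y → fn T (fn φ y) ≗ℤ fn φ (proj₁ (span (fn T (fn φ y)) (T∈ (φ∈ y))))
    induced-spec y = proj₂ (span (fn T (fn φ y)) (T∈ (φ∈ y)))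
    induced .fn y = proj₁ (span (fn T (fn φ y)) (T∈ (φ∈ y)))
    induced .fcong {x} {y} p = φ-≗ (≗-sym (induced-spec x) ⨾ fcong (T ∘L φ) p ⨾ induced-spec y)
    induced .fadd x y = φ-≗ (≗-sym (induced-spec (x +ℤ y)) ⨾ fadd (T ∘L φ) x y ⨾ +ℤ-cong (induced-spec x) (induced-spec y) ⨾ ≗-sym (fadd φ _ _))
    induced .fscale c x = φ-≗ (≗-sym (induced-spec (c ·ℤ x)) ⨾ fscale (T ∘L φ) c x ⨾ ·ℤ-cong c (induced-spec x) ⨾ ≗-sym (fscale φ c _))

    module _ (T-inj : ∀ x → H x → fn T x ≗ℤ 0v → x ≗ℤ 0v) where

      induced-injective : Injective (matLin (mat induced))
      induced-injective y p = φinj y (T-inj (fn φ y) (φ∈ y) (induced-spec y ⨾ f0 φ (≗-sym (matVec-mat induced y) ⨾ p)))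

      induced-det≢0 : detℤ (mat induced) ≢ + 0
      induced-det≢0 = injective⇒det≢0 rk (mat induced) induced-injective

      endo-index : Index H (Image T H) ∣ detℤ (mat induced) ∣
      endo-index = card-→ (linBij {H = All} {K = Im (matLin (mat induced))} {H' = H} {K' = Image T H} φ All-sub (Image-sub T sH)
          (λ _ → φ∈ _)
          (λ _ (z , p) → fn φ z , φ∈ z , (fcong φ (p ⨾ matVec-mat induced z) ⨾ ≗-sym (induced-spec z)))
          (λ {x} _ (w , h , p) → proj₁ (span w h) , φ-≗ (p ⨾ fcong T (proj₂ (span w h)) ⨾ induced-spec (proj₁ (span w h)) ⨾
             fcong φ (≗-sym (matVec-mat induced (proj₁ (span w h))))))
          (λ y h → proj₁ (span y h) , tt , refl∈ (Image-sub T sH) _ y (≗-sym (proj₂ (span y h)))))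
        (det-index rk (mat induced) induced-det≢0)

det-scalar : ∀ n s → detℤ {n} (λ i j → s ℤ.* e j i) ≡ s ℤ.^ n
det-scalar zero    s = refl
det-scalar (suc n) s = trans (det-sparse {n} (λ i j → s ℤ.* e j i) (λ k → ℤₚ.*-zeroʳ s))
  (cong₂ ℤ._*_ (ℤₚ.*-identityʳ s) (det-scalar n s))

scalar-index : {d : ℕ} {H : Vecℤ d → Set} (sH : Sub H) (bs : Basis H) (T : Lin d d) (s : ℕ) → s ≢ 0 →
               (∀ {x} → H x → fn T x ≗ℤ ((+ s) ·ℤ x)) → Index H (Image T H) (s ^ Basis.rk bs)
scalar-index {H = H} sH bs T s s≢0 T≡s = subst (Index H (Image T H))
    (trans (cong ∣_∣ (trans (detℤ-cong (λ i j → φ-≗ (≗-sym (induced-spec sH bs T T∈ (e j)) ⨾ T≡s (φ∈ (e j)) ⨾ ≗-sym (fscale φ (+ s) (e j))) i))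
      (det-scalar rk (+ s)))) (abs-^ s rk))
    (endo-index sH bs T T∈ (λ x h p → ·ℤ-cancel (λ q → s≢0 (ℤₚ.+-injective q)) (≗-sym (T≡s h) ⨾ p ⨾ λ i → sym (ℤₚ.*-zeroʳ (+ s)))))
  where
  open Basis bs
  T∈ : ∀ {x} → H x → H (fn T x)
  T∈ h = ≗∈ sH (≗-sym (T≡s h)) (·∈ sH (+ s) h)

index-same : {d : ℕ} {H K H' K' : Vecℤ d → Set} → Sub H → Sub K' → H ⊆ H' → H' ⊆ H → K ⊆ K' → K' ⊆ K →
             {n : ℕ} → Index H K n → Index H' K' n
index-same {H = H} {K} {H'} {K'} sH sK' a b c e = card-→ (linBij {H = H} {K} {H'} {K'} idLin sH sK' a (λ _ → c) (λ _ → e)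
  (λ y h → y , b h , refl∈ sK' y y (λ _ → refl)))

-- The indices attached to F and Λ′ = B ℤᵈ, where A = F − 1

record Setup {d : ℕ} (F B : Mat d) : Set where
  field
    ker : ∀ x → (mvℤ F (mvℤ F x -ℤ x) -ℤ (mvℤ F x -ℤ x)) ≗ℤ (λ _ → + 0) → (mvℤ F x -ℤ x) ≗ℤ (λ _ → + 0)
    det≢0 : ¬ (detℤ B ≡ + 0)
    F-stable : ∀ c → ∃[ c' ] (mvℤ F (mvℤ B c) ≗ℤ mvℤ B c')

module Integral {d : ℕ} (F B : Mat d) (setup : Setup F B) where

  open Setup setup

  A BL : Lin d d
  A = frob F
  BL = matLin B

  open GroupInverse (groupInverse A ker) public

  -- On V the endomorphism E is D times the projection onto W along V^F.
  E : Lin d d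
  E = A ∘L P

  -- `InW` describes Λ ∩ W by an integral equation: `E` is `D` on W and 0 on V^F. Membership is
  -- thereby decidable and closed under division by nonzero integers.
  L Fx InW MF MW : Vecℤ d → Set
  L = Im BL
  Fx x = mvℤ F x ≗ℤ x
  InW x = fn E x ≗ℤ (D ·ℤ x)
  MF x = L x × Fx x
  MW x = L x × InW x

  B-inj : Injective BL
  B-inj = det≢0⇒injective d B det≢0

  fixed⇒A0 : ∀ {x} → Fx x → fn A x ≗ℤ 0v
  fixed⇒A0 p i = ℤₚ.i≡j⇒i-j≡0 (p i)

  A0⇒fixed : ∀ {x} → fn A x ≗ℤ 0v → Fx x
  A0⇒fixed {x} p i = ℤₚ.i-j≡0⇒i≡j (mvℤ F x i) (x i) (p i)

  E-fixed : ∀ {x} → Fx x → fn E x ≗ℤ 0v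
  E-fixed {x} p = comm x ⨾ f0 P (fixed⇒A0 {x} p)

  E-A : ∀ x → fn E (fn A x) ≗ℤ (D ·ℤ fn A x)
  E-A x = fcong A (≗-sym (comm x)) ⨾ AAP x

  InW-A : ∀ {y x} → y ≗ℤ fn A x → InW y
  InW-A {y} {x} p = fcong E p ⨾ E-A x ⨾ ·ℤ-cong D (≗-sym p)

  E0⇒fixed : ∀ {x} → fn E x ≗ℤ 0v → Fx x
  E0⇒fixed {x} p = A0⇒fixed {x} (·ℤ-cancel D≢0 (≗-sym (AAP x) ⨾ f0 A p ⨾ λ i → sym (ℤₚ.*-zeroʳ D)))

  fixed∩W : ∀ {x} → Fx x → InW x → x ≗ℤ 0v
  fixed∩W {x} p q = ·ℤ-cancel D≢0 (≗-sym q ⨾ E-fixed {x} p ⨾ λ i → sym (ℤₚ.*-zeroʳ D))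

  E-InW : ∀ x → InW (fn E x)
  E-InW x = InW-A {fn E x} {fn P x} (λ _ → refl)

  -- The projection of an element of Λ to V^F, scaled by D.
  coE : Lin d d
  coE = (D ·L idLin) -L E

  A-coE : ∀ x → fn A (fn coE x) ≗ℤ 0v
  A-coE x = fsub A (D ·ℤ x) (fn E x) ⨾ λ i → ℤₚ.i≡j⇒i-j≡0 (trans (fscale A D x i) (sym (AAP x i)))

  A-MF⊥ : ∀ {x} → fn coE x ≗ℤ 0v → InW x
  A-MF⊥ {x} p i = sym (ℤₚ.i-j≡0⇒i≡j (D ℤ.* x i) (fn E x i) (p i))

  sL : Sub L
  sL = Im-sub BL

  A-stable : ∀ {x} → L x → L (fn A x)
  A-stable {x} (c , p) = (proj₁ (F-stable c) -ℤ c) ,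
    (fcong A p ⨾ -ℤ-cong (proj₂ (F-stable c)) (λ _ → refl) ⨾ ≗-sym (fsub BL (proj₁ (F-stable c)) c))

  sFx : Sub Fx
  sFx = record
    { ≗∈ = λ p q → fcong (matLin F) (≗-sym p) ⨾ q ⨾ p
    ; 0∈ = f0 (matLin F) (λ _ → refl)
    ; -∈ = λ {x} {y} p q → fsub (matLin F) x y ⨾ -ℤ-cong p q }

  sInW : Sub InW
  sInW = record
    { ≗∈ = λ p q → fcong E (≗-sym p) ⨾ q ⨾ ·ℤ-cong D p
    ; 0∈ = f0 E (λ _ → refl) ⨾ λ i → sym (ℤₚ.*-zeroʳ D)
    ; -∈ = λ {x} {y} p q → fsub E x y ⨾ -ℤ-cong p q ⨾ λ i → dist D (x i) (y i) }
    where
    dist : ∀ c a b → c ℤ.* a ℤ.- c ℤ.* b ≡ c ℤ.* (a ℤ.- b)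
    dist = solve-∀

  sMF : Sub MF
  sMF = ×-sub sL sFx

  sMW : Sub MW
  sMW = ×-sub sL sInW

  -- Λ′ ∩ ker G is the image under the injective `BL` of ker (G B), which has a basis by
  -- `kernelBasis`.
  pushBasis : (G : Lin d d) {H : Vecℤ d → Set} → (∀ x → fn G x ≗ℤ 0v → H x) → (∀ x → H x → fn G x ≗ℤ 0v) → Basis (λ x → L x × H x)
  pushBasis G to′ from′ = record
    { rk = rk
    ; φ = BL ∘L φ
    ; φ∈ = λ y → (fn φ y , λ _ → refl) , to′ _ (φ∈ y)
    ; φinj = λ y p → φinj y (B-inj (fn φ y) p)
    ; span = λ x ((c , p) , h) → let (y , q) = span c (fcong G (≗-sym p) ⨾ from′ x h) in y , (p ⨾ fcong BL q) }
    where open Basis (kernelBasis (G ∘L BL))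

  basisF : Basis MF
  basisF = pushBasis A (λ x → A0⇒fixed {x}) (λ x → fixed⇒A0 {x})

  basisW : Basis MW
  basisW = pushBasis coE (λ x → A-MF⊥ {x}) (λ x p i → ℤₚ.i≡j⇒i-j≡0 (sym (p i)))

  shift∈W : ∀ s {x} → MW x → MW (fn (shiftL A s) x)
  shift∈W s {x} (l , w) = -∈ sL (·∈ sL s l) (A-stable l) , -∈ sInW (·∈ sInW s w) (InW-A {fn A x} {x} (λ _ → refl))

  L? : ∀ x → Dec (L x)
  L? = im? BL

  InW? : ∀ x → Dec (InW x)
  InW? x = fn E x ≗? (D ·ℤ x)

  -- `LF` is Λ′ + Λ^F, expressed by a decidable condition on A x; `HQ` is the preimage of (Λ/Λ′)^F
  -- in Λ.
  AΛ AΛ′ AMW N₁ LF HQ : Vecℤ d → Set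
  AΛ = Im A
  AΛ′ = Im (A ∘L BL)
  AMW = Image A MW
  N₁ x = L x × AΛ x
  LF x = AΛ′ (fn A x)
  HQ x = L (fn A x)

  sAΛ′ : Sub AΛ′
  sAΛ′ = Im-sub (A ∘L BL)

  sAMW : Sub AMW
  sAMW = Image-sub A sMW

  sN₁ : Sub N₁
  sN₁ = ×-sub sL (Im-sub A)

  N₁⊆MW : N₁ ⊆ MW
  N₁⊆MW {x} (l , u , p) = l , InW-A {x} {u} p

  AΛ′⊆N₁ : AΛ′ ⊆ N₁
  AΛ′⊆N₁ {x} (c , p) = ≗∈ sL (≗-sym p) (A-stable (c , λ _ → refl)) , fn BL c , p

  AMW⊆AΛ′ : AMW ⊆ AΛ′
  AMW⊆AΛ′ (w , ((c , p) , _) , q) = c , (q ⨾ fcong A p)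

  A-index : (T : Lin d d) → (∀ x → MW x → fn T x ≗ℤ 0v → x ≗ℤ 0v) → (T∈ : ∀ {x} → MW x → MW (fn T x)) →
            Index MW (Image T MW) ∣ detℤ (mat (induced sMW basisW T T∈)) ∣
  A-index T ij T∈ = endo-index sMW basisW T T∈ ij

  -- This is -A on Λ′ ∩ W, taken as the member s = 0 of the family s - A so that its matrix is
  -- visibly congruent to the one at s.
  W₀ : Lin (Basis.rk basisW) (Basis.rk basisW)
  W₀ = induced sMW basisW (shiftL A (+ 0)) (shift∈W (+ 0))

  shift0 : ∀ x → fn (shiftL A (+ 0)) x ≗ℤ (0v -ℤ fn A x)
  shift0 x i = cong (ℤ._- fn A x i) (ℤₚ.*-zeroˡ (x i))

  A-inj-W : ∀ x → MW x → fn (shiftL A (+ 0)) x ≗ℤ 0v → x ≗ℤ 0v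
  A-inj-W x (_ , w) p = fixed∩W {x} (A0⇒fixed {x} (λ i → trans (neg (fn A x i)) (cong (λ z → + 0 ℤ.- z) (trans (sym (shift0 x i)) (p i))))) w
    where
    neg : ∀ a → a ≡ + 0 ℤ.- (+ 0 ℤ.- a)
    neg = solve-∀

  n₀ : ℕ
  n₀ = ∣ detℤ (mat W₀) ∣

  det-W₀≢0 : detℤ (mat W₀) ≢ + 0
  det-W₀≢0 = induced-det≢0 sMW basisW (shiftL A (+ 0)) (shift∈W (+ 0)) A-inj-W

  index-MW-AMW : Index MW AMW n₀
  index-MW-AMW = index-same {H = MW} {Image (shiftL A (+ 0)) MW} {MW} {AMW} sMW sAMW id id
    (λ (w , h , p) → (0v -ℤ w) , neg∈ sMW h , (p ⨾ shift0 w ⨾ ≗-sym (fsub A 0v w ⨾ -ℤ-cong (f0 A (λ _ → refl)) (λ _ → refl))))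
    (λ {x} (w , h , p) → (0v -ℤ w) , neg∈ sMW h , (p ⨾ ≗-sym (shift0 (0v -ℤ w) ⨾ -ℤ-cong {x = 0v} {0v} (λ _ → refl) (fsub A 0v w) ⨾
      λ i → trans (cong (λ z → + 0 ℤ.- (z ℤ.- fn A w i)) (f0 A (λ _ → refl) i)) (sym (neg (fn A w i))))))
    (A-index (shiftL A (+ 0)) A-inj-W (shift∈W (+ 0)))
    where
    neg : ∀ a → a ≡ + 0 ℤ.- (+ 0 ℤ.- a)
    neg = solve-∀

  split₁ : ∃[ x ] ∃[ t ] (Index MW AΛ′ x × Index AΛ′ AMW t × n₀ ≡ x ℕ.* t)
  split₁ = index-split sMW sAΛ′ sAMW AMW⊆AΛ′ (λ p → N₁⊆MW (AΛ′⊆N₁ p)) (im? (A ∘L BL)) index-MW-AMW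

  N₁? : ∀ x → Dec (N₁ x)
  N₁? x = L? x ×-dec im? A x

  split₂ : ∃[ b ] ∃[ y ] (Index MW N₁ b × Index N₁ AΛ′ y × proj₁ split₁ ≡ b ℕ.* y)
  split₂ = index-split sMW sN₁ sAΛ′ AΛ′⊆N₁ N₁⊆MW N₁? (proj₁ (proj₂ (proj₂ split₁)))

  -- The orders of 𝒯′, of 𝔅, and of (Λ/Λ′)^F modulo the image of Λ^F, each obtained as a factor of
  -- the single index `n₀`.
  nT nB ny : ℕ
  nT = proj₁ (proj₂ split₁)
  nB = proj₁ split₂
  ny = proj₁ (proj₂ split₂)

  index-AΛ′-AMW : Index AΛ′ AMW nT
  index-AΛ′-AMW = proj₁ (proj₂ (proj₂ (proj₂ split₁)))

  index-MW-N₁ : Index MW N₁ nB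
  index-MW-N₁ = proj₁ (proj₂ (proj₂ split₂))

  index-N₁-AΛ′ : Index N₁ AΛ′ ny
  index-N₁-AΛ′ = proj₁ (proj₂ (proj₂ (proj₂ split₂)))

  n₀-factors : n₀ ≡ (nB ℕ.* ny) ℕ.* nT
  n₀-factors = trans (proj₂ (proj₂ (proj₂ (proj₂ split₁)))) (cong (ℕ._* nT) (proj₂ (proj₂ (proj₂ (proj₂ split₂)))))

  sLF : Sub LF
  sLF = preimage-sub A sAΛ′

  L⊆LF : L ⊆ LF
  L⊆LF (c , p) = c , fcong A p

  index-Λ-L : Index All L ∣ detℤ B ∣
  index-Λ-L = det-index d B det≢0

  -- Λ^F/Λ′^F is (Λ′ + Λ^F)/Λ′, so its finiteness is inherited from Λ/Λ′.
  split₃ : ∃[ a ] ∃[ f ] (Index All LF a × Index LF L f × ∣ detℤ B ∣ ≡ a ℕ.* f)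
  split₃ = index-split All-sub sLF sL L⊆LF (λ _ → tt) (λ x → im? (A ∘L BL) (fn A x)) index-Λ-L

  nFix : ℕ
  nFix = proj₁ (proj₂ split₃)

  -- Λ^F / (L ∩ Λ^F) for a sublattice L = G ℤᵈ, seen inside (L + Λ^F) / L
  fixBij : (G : Lin d d) → Bij (Quot Fx (λ x → Im G x × Fx x)) (Quot (λ x → Im (A ∘L G) (fn A x)) (Im G))
  fixBij G = linBij {H = Fx} {λ x → Im G x × Fx x} {λ x → Im (A ∘L G) (fn A x)} {Im G} idLin sFx (Im-sub G)
    (λ {x} p → 0∈′ (≗-sym (fixed⇒A0 {x} p)))
    (λ _ (l , _) → l)
    (λ p l → l , p)
    (λ y (c , p) → (y -ℤ fn G c) , A0⇒fixed {y -ℤ fn G c} (fsub A y (fn G c) ⨾ λ i → ℤₚ.i≡j⇒i-j≡0 (p i)) ,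
      (0v -ℤ c) , λ i → trans (cancel (y i) (fn G c i)) (sym (trans (fsub G 0v c i) (cong (ℤ._- fn G c i) (f0 G (λ _ → refl) i)))))
    where
    0∈′ : ∀ {x} → 0v ≗ℤ x → Im (A ∘L G) x
    0∈′ p = ≗∈ (Im-sub (A ∘L G)) p (0∈ (Im-sub (A ∘L G)))
    cancel : ∀ a b → (a ℤ.- b) ℤ.- a ≡ + 0 ℤ.- b
    cancel = solve-∀

  -- (Λ/L)^F modulo the image of Λ^F, transported by A
  quotBij : (G : Lin d d) → Bij (Quot (λ x → Im G (fn A x)) (λ x → Im (A ∘L G) (fn A x))) (Quot (λ x → Im G x × AΛ x) (Im (A ∘L G)))
  quotBij G = linBij {H = λ x → Im G (fn A x)} {λ x → Im (A ∘L G) (fn A x)} {λ x → Im G x × AΛ x} {Im (A ∘L G)} A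
    (preimage-sub A (Im-sub G)) (Im-sub (A ∘L G))
    (λ {x} l → l , x , λ _ → refl) (λ _ k → k) (λ _ k → k)
    (λ y (l , x , p) → x , ≗∈ (Im-sub G) p l , refl∈ (Im-sub (A ∘L G)) (fn A x) y (≗-sym p))

  index-Fx-MF : Index Fx MF nFix
  index-Fx-MF = card-← (fixBij BL) (proj₁ (proj₂ (proj₂ (proj₂ split₃))))

  -- The chain G ℤᵈ ⊆ G ℤᵈ + Λ^F ⊆ {x : A x ∈ G ℤᵈ}, with the upper step moved by A. It is used for
  -- Λ′ and again for its multiples kΛ′.
  L⊆HQ-gen : (G : Lin d d) → (∀ {x} → Im G x → Im G (fn A x)) → {a f : ℕ} →
             Index (λ x → Im G x × AΛ x) (Im (A ∘L G)) a → Index Fx (λ x → Im G x × Fx x) f → Index (λ x → Im G (fn A x)) (Im G) (a ℕ.* f)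
  L⊆HQ-gen G st ia if = index-mult {J = λ x → Im (A ∘L G) (fn A x)} (preimage-sub A (Im-sub G)) (preimage-sub A (Im-sub (A ∘L G))) (Im-sub G)
    (λ (c , p) → c , fcong A p) (λ (c , p) → ≗∈ (Im-sub G) (≗-sym p) (st (c , λ _ → refl)))
    (card-← (quotBij G) ia) (card-→ (fixBij G) if)

  index-HQ-L : Index HQ L (ny ℕ.* nFix)
  index-HQ-L = L⊆HQ-gen BL A-stable index-N₁-AΛ′ index-Fx-MF

  M : Vecℤ d → Set
  M = MF ⊞ MW

  sM : Sub M
  sM = ⊞-sub sMF sMW

  -- A kills V^F, so it maps M into A(Λ′ ∩ W). Conversely, if A x = A w with w in Λ′ ∩ W, then x - w
  -- is fixed and x = (x - w) + w lies in M.
  LM-Bij : Bij (Quot L M) (Quot AΛ′ AMW)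
  LM-Bij = linBij {H = L} {M} {AΛ′} {AMW} A sL sAMW
    (λ (c , p) → c , fcong A p)
    (λ {x} _ (a , b , (_ , fa) , mb , p) → b , mb , (fcong A p ⨾ fadd A a b ⨾
       λ i → trans (cong (ℤ._+ fn A b i) (fixed⇒A0 {a} fa i)) (ℤₚ.+-identityˡ _)))
    (λ {x} l (w , mw , p) → (x -ℤ w) , w , (-∈ sL l (proj₁ mw) , A0⇒fixed {x -ℤ w} (fsub A x w ⨾ λ i → ℤₚ.i≡j⇒i-j≡0 (p i))) , mw ,
       λ i → cancel (x i) (w i))
    (λ y (c , p) → fn BL c , (c , λ _ → refl) , refl∈ sAMW (fn A (fn BL c)) y (≗-sym p))
    where
    cancel : ∀ a b → a ≡ (a ℤ.- b) ℤ.+ b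
    cancel = solve-∀

  index-L-M : Index L M nT
  index-L-M = card-← LM-Bij index-AΛ′-AMW

  M⊆L : M ⊆ L
  M⊆L (a , b , (la , _) , (lb , _) , p) = ≗∈ sL (≗-sym p) (+∈ sL la lb)

  index-Λ-M : Index All M (∣ detℤ B ∣ ℕ.* nT)
  index-Λ-M = index-mult All-sub sL sM M⊆L (λ _ → tt) index-Λ-L index-L-M

-- p(1) as an index: for large s compare [Λ : (s − A)Λ] with [M : (s − A)M], where M = Λ′^F ⊕ (Λ′ ∩ W)

module CharIndex {d : ℕ} (F B : Mat d) (setup : Setup F B)
    (r : ℕ) (p : Poly)
    (factor : charPoly F ≐ pMul (pPow (pAdd pX (pConst -[1+ 0 ])) r) p
      ⊎ charPoly F ≐ pNeg (pMul (pPow (pAdd pX (pConst -[1+ 0 ])) r) p))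
    (p₁≢0 : eval p (+ 1) ≢ + 0) where

  open Integral F B setup

  r′ : ℕ
  r′ = Basis.rk basisF

  module AtScale (s : ℕ) (large : ∣ eval p (+ 1) ∣ ℕ.+ n₀ ℕ.< s) where

    T : Lin d d
    T = shiftL A (+ s)

    f : ℤ
    f = eval p (+ 1 ℤ.+ + s)

    s≢0 : s ≢ 0
    s≢0 q = ℕₚ.n≮0 (subst (∣ eval p (+ 1) ∣ ℕ.+ n₀ ℕ.<_) q large)

    f≢0 : f ≢ + 0
    f≢0 f≡0 = p₁≢0 (∣-small {+ s} (eval p (+ 1)) (subst (+ s Signed.∣_) (neg (eval p (+ 1)))
        (Signed.∣m⇒∣-m (subst (λ z → + s Signed.∣ (z ℤ.- eval p (+ 1))) f≡0 (eval-mod p (+ s)))))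
        (ℕₚ.≤-<-trans (ℕₚ.m≤m+n ∣ eval p (+ 1) ∣ n₀) large))
      where
      neg : ∀ a → ℤ.- (+ 0 ℤ.- a) ≡ a
      neg = solve-∀

    detT : ∣ detℤ (mat T) ∣ ≡ s ^ r ℕ.* ∣ f ∣
    detT = charPoly-abs F r p factor s

    detT≢0 : detℤ (mat T) ≢ + 0
    detT≢0 q with ℕₚ.m*n≡0⇒m≡0∨n≡0 (s ^ r) (trans (sym detT) (cong ∣_∣ q))
    ... | inj₁ z = s≢0 (ℕₚ.m^n≡0⇒m≡0 s r z)
    ... | inj₂ z = f≢0 (ℤₚ.∣i∣≡0⇒i≡0 z)

    T-inj : Injective T
    T-inj x q = det≢0⇒injective d (mat T) detT≢0 x (matVec-mat T x ⨾ q)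

    T-≗ : ∀ {x y} → fn T x ≗ℤ fn T y → x ≗ℤ y
    T-≗ {x} {y} q i = ℤₚ.i-j≡0⇒i≡j (x i) (y i) (T-inj (x -ℤ y) (fsub T x y ⨾ λ j → ℤₚ.i≡j⇒i-j≡0 (q j)) i)

    index-Λ-TΛ : Index All (Im T) (s ^ r ℕ.* ∣ f ∣)
    index-Λ-TΛ = subst (Index All (Im T)) detT (index-same {H = All} {Im (matLin (mat T))} {All} {Im T} All-sub (Im-sub T) id id
      (λ (x , q) → x , (q ⨾ matVec-mat T x)) (λ (x , q) → x , (q ⨾ ≗-sym (matVec-mat T x))) (det-index d (mat T) detT≢0))

    T-fixed : ∀ {x} → Fx x → fn T x ≗ℤ ((+ s) ·ℤ x)
    T-fixed {x} q i = trans (cong (λ z → + s ℤ.* x i ℤ.- z) (fixed⇒A0 {x} q i)) (ℤₚ.+-identityʳ _)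

    -- `J₂` lies between M and T M and changes only the fixed summand, so that the scalar s and the
    -- map on Λ′ ∩ W are measured separately.
    TMF TMW J₂ TM : Vecℤ d → Set
    TMF = Image T MF
    TMW = Image T MW
    J₂ = TMF ⊞ MW
    TM = Image T M

    T∈MF : ∀ {x} → MF x → MF (fn T x)
    T∈MF {x} h = ≗∈ sMF (≗-sym (T-fixed {x} (proj₂ h))) (·∈ sMF (+ s) h)

    sJ₂ : Sub J₂
    sJ₂ = ⊞-sub (Image-sub T sMF) sMW

    sTM : Sub TM
    sTM = Image-sub T sM

    TMF⊆MF : TMF ⊆ MF
    TMF⊆MF (w , h , q) = ≗∈ sMF (≗-sym q) (T∈MF h)

    -- M_F ∩ M_W = 0
    cancelF : ∀ {x y b} → MF x → MF y → MW b → x ≗ℤ (y +ℤ b) → x ≗ℤ y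
    cancelF {x} {y} {b} mx my mb q i = trans (q i) (trans (+-congˡ (y i) (b≡0 i)) (ℤₚ.+-identityʳ (y i)))
      where
      minus : ∀ y b → (y ℤ.+ b) ℤ.- y ≡ b
      minus = solve-∀
      b≡0 : b ≗ℤ 0v
      b≡0 = fixed∩W {b} (≗∈ sFx (λ i → trans (cong (ℤ._- y i) (q i)) (minus (y i) (b i))) (-∈ sFx (proj₂ mx) (proj₂ my))) (proj₂ mb)

    index-M-J₂ : Index M J₂ (s ^ r′)
    index-M-J₂ = card-→ (linBij {H = MF} {TMF} {M} {J₂} idLin sMF sJ₂
        (λ {x} h → x , 0v , h , 0∈ sMW , +-0v x)
        (λ {x} _ k → x , 0v , k , 0∈ sMW , +-0v x)
        (λ {x} h (a , b , ta , mb , q) → ≗∈ (Image-sub T sMF) (≗-sym (cancelF {x} {a} {b} h (TMF⊆MF ta) mb q)) ta)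
        (λ y (a , b , ma , mb , q) → a , ma , 0v , (0v -ℤ b) , 0∈ (Image-sub T sMF) , neg∈ sMW mb ,
           λ i → trans (cong (λ z → a i ℤ.- z) (q i)) (drop (a i) (b i))))
      (scalar-index sMF basisF T s s≢0 (λ {x} h → T-fixed {x} (proj₂ h)))
      where
      drop : ∀ a b → a ℤ.- (a ℤ.+ b) ≡ + 0 ℤ.+ (+ 0 ℤ.- b)
      drop = solve-∀

    Wₛ : Lin (Basis.rk basisW) (Basis.rk basisW)
    Wₛ = induced sMW basisW T (shift∈W (+ s))

    g : ℤ
    g = detℤ (mat Wₛ)

    index-J₂-TM : Index J₂ TM ∣ g ∣
    index-J₂-TM = card-→ (linBij {H = MW} {TMW} {J₂} {TM} idLin sMW sTM
        (λ {x} h → 0v , x , 0∈ (Image-sub T sMF) , h , 0v-+ x)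
        (λ {x} _ (w , h , q) → w , (0v , w , 0∈ sMF , h , 0v-+ w) , q)
        (λ {x} h (m , (a , b , ma , mb , q) , q') → b , mb , diff h ma mb (q' ⨾ fcong T q ⨾ fadd T a b))
        (λ y (a , b , (a' , ma' , qa) , mb , q) → b , mb , (0v -ℤ a') ,
           ((0v -ℤ a') , 0v , neg∈ sMF ma' , 0∈ sMW , +-0v _) ,
           λ i → trans (trans (cong (λ z → b i ℤ.- z) (q i)) (trans (drop (a i) (b i)) (cong (λ z → + 0 ℤ.- z) (qa i))))
                   (sym (trans (fsub T 0v a' i) (cong (ℤ._- fn T a' i) (f0 T (λ _ → refl) i))))))
      (endo-index sMW basisW T (shift∈W (+ s)) (λ x _ → T-inj x))
      where
      drop : ∀ a b → b ℤ.- (a ℤ.+ b) ≡ + 0 ℤ.- a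
      drop = solve-∀
      rearr : ∀ u v → (u ℤ.+ v) ℤ.- v ≡ u
      rearr = solve-∀
      diff : ∀ {x a b} → MW x → MF a → MW b → x ≗ℤ (fn T a +ℤ fn T b) → x ≗ℤ fn T b
      diff {x} {a} {b} mx ma mb q i = trans (q i) (trans (cong (ℤ._+ fn T b i) (Ta≡0 i)) (ℤₚ.+-identityˡ (fn T b i)))
        where
        Ta≡0 : fn T a ≗ℤ 0v
        Ta≡0 = fixed∩W {fn T a} (proj₂ (T∈MF ma)) (proj₂ (≗∈ sMW (λ i → trans (cong (ℤ._- fn T b i) (q i)) (rearr (fn T a i) (fn T b i)))
          (-∈ sMW mx (shift∈W (+ s) {b} mb))))

    T∈M : ∀ {x} → M x → M (fn T x)
    T∈M (a , b , ma , mb , q) = fn T a , fn T b , T∈MF ma , shift∈W (+ s) {b} mb , (fcong T q ⨾ fadd T a b)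

    TM⊆M : TM ⊆ M
    TM⊆M (w , h , q) = ≗∈ sM (≗-sym q) (T∈M h)

    TM⊆J₂ : TM ⊆ J₂
    TM⊆J₂ (w , (a , b , ma , mb , q) , q') = fn T a , fn T b , (a , ma , λ _ → refl) , shift∈W (+ s) {b} mb , (q' ⨾ fcong T q ⨾ fadd T a b)

    J₂⊆M : J₂ ⊆ M
    J₂⊆M (a , b , ta , mb , q) = a , b , TMF⊆MF ta , mb , q

    index-M-TM : Index M TM (s ^ r′ ℕ.* ∣ g ∣)
    index-M-TM = index-mult sM sJ₂ sTM TM⊆J₂ J₂⊆M index-M-J₂ index-J₂-TM

    c : ℕ
    c = ∣ detℤ B ∣ ℕ.* nT

    index-TΛ-TM : Index (Im T) TM c
    index-TΛ-TM = card-→ (linBij {H = All} {M} {Im T} {TM} T All-sub sTM (λ {x} _ → x , λ _ → refl)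
      (λ {x} _ m → x , m , λ _ → refl) (λ {x} _ (w , m , q) → ≗∈ sM (≗-sym (T-≗ q)) m)
      (λ y (x , q) → x , tt , refl∈ sTM (fn T x) y (≗-sym q))) index-Λ-M

    -- Both sides, multiplied by [Λ : M], are [Λ : T M], computed through T Λ and through M. Since T
    -- is injective, [T Λ : T M] = [Λ : M].
    powers : s ^ r ℕ.* ∣ f ∣ ≡ s ^ r′ ℕ.* ∣ g ∣
    powers = ℕₚ.*-cancelˡ-≡ (s ^ r ℕ.* ∣ f ∣) (s ^ r′ ℕ.* ∣ g ∣) c {{ℕ.≢-nonZero (index-positive {H = All} {M} All-sub index-Λ-M)}}
      (trans (ℕₚ.*-comm c (s ^ r ℕ.* ∣ f ∣)) (index-unique {H = All} {TM} sTM
        (index-mult {H = All} {Im T} {TM} All-sub (Im-sub T) sTM (λ (w , _ , q) → w , q) (λ _ → tt) index-Λ-TΛ index-TΛ-TM)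
        (index-mult {H = All} {M} {TM} All-sub sM sTM TM⊆M (λ _ → tt) index-Λ-M index-M-TM)))

    -- In the same basis the matrices of s - A and of -A differ by s times the identity.
    g≡g₀ : + s Signed.∣ (g ℤ.- detℤ (mat W₀))
    g≡g₀ = det-mod (Basis.rk basisW) (mat Wₛ) (mat W₀) (λ i j → Signed.divides (e j i) (trans (cong (ℤ._- mat W₀ i j) (split j i)) (h (+ s) (e j i) (mat W₀ i j))))
      where
      open Basis basisW
      h : ∀ s x w → (s ℤ.* x ℤ.+ w) ℤ.- w ≡ x ℤ.* s
      h = solve-∀
      h′ : ∀ s x a → s ℤ.* x ℤ.- a ≡ s ℤ.* x ℤ.+ (+ 0 ℤ.* x ℤ.- a)
      h′ = solve-∀
      split : ∀ j → fn Wₛ (e j) ≗ℤ (((+ s) ·ℤ e j) +ℤ fn W₀ (e j))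
      split j = φ-≗ (≗-sym (induced-spec sMW basisW T (shift∈W (+ s)) (e j)) ⨾
        (λ i → h′ (+ s) (fn φ (e j) i) (fn A (fn φ (e j)) i)) ⨾
        +ℤ-cong (≗-sym (fscale φ (+ s) (e j))) (induced-spec sMW basisW (shiftL A (+ 0)) (shift∈W (+ 0)) (e j)) ⨾ ≗-sym (fadd φ ((+ s) ·ℤ e j) (fn W₀ (e j))))

    conclusion : r ≡ r′ × ∣ eval p (+ 1) ∣ ≡ n₀
    conclusion = Comparison.compare-powers f g (eval p (+ 1)) (detℤ (mat W₀)) p₁≢0 det-W₀≢0 s large (eval-mod p (+ s)) g≡g₀ r r′ powers

  conclusion : r ≡ r′ × ∣ eval p (+ 1) ∣ ≡ n₀
  -- One admissible s suffices; this is the least.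
  conclusion = AtScale.conclusion (suc (∣ eval p (+ 1) ∣ ℕ.+ n₀)) ℕₚ.≤-refl

  -- Passing from Λ′ to kΛ′

  module Scaled (k : ℕ) (k≢0 : k ≢ 0) where

    Bₖ Kₗ : Lin d d
    Bₖ = (+ k) ·L BL
    Kₗ = (+ k) ·L idLin

    +k≢0 : + k ≢ + 0
    +k≢0 q = k≢0 (ℤₚ.+-injective q)

    -- `Rₖ` is the preimage of 𝔅[k] in Λ′ ∩ W, and `N₁ₖ` is what `N₁` becomes when Λ′ is replaced by
    -- kΛ′.
    Rₖ kN₁ N₁ₖ : Vecℤ d → Set
    Rₖ x = MW x × AΛ ((+ k) ·ℤ x)
    kN₁ = Image Kₗ N₁
    N₁ₖ x = Im Bₖ x × AΛ x

    sRₖ : Sub Rₖ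
    sRₖ = ×-sub sMW (preimage-sub Kₗ (Im-sub A))

    skN₁ : Sub kN₁
    skN₁ = Image-sub Kₗ sN₁

    AΛ-scale : ∀ {x} → AΛ x → AΛ ((+ k) ·ℤ x)
    AΛ-scale = ·∈ (Im-sub A) (+ k)

    N₁⊆Rₖ : N₁ ⊆ Rₖ
    N₁⊆Rₖ {x} h = N₁⊆MW h , AΛ-scale {x} (proj₂ h)

    split₄ : ∃[ a ] ∃[ b ] (Index MW Rₖ a × Index Rₖ N₁ b × nB ≡ a ℕ.* b)
    split₄ = index-split sMW sRₖ sN₁ N₁⊆Rₖ proj₁ (λ x → (L? x ×-dec InW? x) ×-dec im? A ((+ k) ·ℤ x)) index-MW-N₁

    nBₖ : ℕ
    nBₖ = proj₁ (proj₂ split₄)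

    index-Rₖ-N₁ : Index Rₖ N₁ nBₖ
    index-Rₖ-N₁ = proj₁ (proj₂ (proj₂ (proj₂ split₄)))

    unscale : ∀ {x y : Vecℤ d} → ((+ k) ·ℤ x) ≗ℤ ((+ k) ·ℤ y) → x ≗ℤ y
    unscale = ·ℤ-cancel +k≢0

    -- Multiplication by k carries `Rₖ` onto kΛ′ ∩ AΛ: for z in Λ′ with k z in AΛ, z lies in W
    -- because k z does. This is where 𝔅[k] enters the count.
    index-N₁ₖ-kN₁ : Index N₁ₖ kN₁ nBₖ
    index-N₁ₖ-kN₁ = card-→ (linBij {H = Rₖ} {N₁} {N₁ₖ} {kN₁} Kₗ sRₖ skN₁
        (λ (((c , q) , _) , a) → (c , ·ℤ-cong (+ k) q) , a)
        (λ {x} _ h → x , h , λ _ → refl)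
        (λ _ (w , h , q) → ≗∈ sN₁ (≗-sym (unscale q)) h)
        (λ y ((c , q) , (x , q')) → fn BL c , (((c , λ _ → refl) , unscale (≗-sym (fscale E (+ k) (fn BL c)) ⨾
             fcong E (≗-sym q) ⨾ InW-A {y} {x} q' ⨾ ·ℤ-cong D q ⨾ λ i → h D (+ k) (fn BL c i))) , x , (≗-sym q ⨾ q')) ,
           refl∈ skN₁ _ y (≗-sym q)))
      index-Rₖ-N₁
      where
      h : ∀ a b c → a ℤ.* (b ℤ.* c) ≡ b ℤ.* (a ℤ.* c)
      h = solve-∀

    index-kN₁ : Index kN₁ (Im (A ∘L Bₖ)) ny
    index-kN₁ = card-→ (linBij {H = N₁} {AΛ′} {kN₁} {Im (A ∘L Bₖ)} Kₗ sN₁ (Im-sub (A ∘L Bₖ))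
        (λ {x} h → x , h , λ _ → refl)
        (λ _ (c , q) → c , (·ℤ-cong (+ k) q ⨾ ≗-sym (fscale A (+ k) (fn BL c))))
        (λ _ (c , q) → c , unscale (q ⨾ fscale A (+ k) (fn BL c)))
        (λ y (w , h , q) → w , h , refl∈ (Im-sub (A ∘L Bₖ)) _ y (≗-sym q)))
      index-N₁-AΛ′

    index-N₁ₖ : Index N₁ₖ (Im (A ∘L Bₖ)) (nBₖ ℕ.* ny)
    index-N₁ₖ = index-mult (×-sub (Im-sub Bₖ) (Im-sub A)) skN₁ (Im-sub (A ∘L Bₖ))
      (λ (c , q) → fn A (fn BL c) , AΛ′⊆N₁ (c , λ _ → refl) , (q ⨾ fscale A (+ k) (fn BL c)))
      (λ (w , ((c , q) , (u , q')) , q'') → (c , (q'' ⨾ ·ℤ-cong (+ k) q)) , fn Kₗ u , (q'' ⨾ ·ℤ-cong (+ k) q' ⨾ ≗-sym (fscale A (+ k) u)))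
      index-N₁ₖ-kN₁ index-kN₁

    kMF : Vecℤ d → Set
    kMF x = Im Bₖ x × Fx x

    index-MF : Index MF kMF (k ^ r′)
    index-MF = index-same {H = MF} {Image Kₗ MF} {MF} {kMF} sMF (×-sub (Im-sub Bₖ) sFx) id id
      (λ (w , ((c , q) , f) , q') → (c , (q' ⨾ ·ℤ-cong (+ k) q)) , ≗∈ sFx (≗-sym q') (·∈ sFx (+ k) f))
      (λ {x} ((c , q) , f) → fn BL c , ((c , λ _ → refl) , unscale (≗-sym (fscale (matLin F) (+ k) (fn BL c)) ⨾
         fcong (matLin F) (≗-sym q) ⨾ f ⨾ q)) , q)
      (scalar-index sMF basisF Kₗ k k≢0 (λ _ _ → refl))

    kMF⊆MF : kMF ⊆ MF
    kMF⊆MF ((c , q) , f) = (fn Kₗ c , (q ⨾ ≗-sym (fscale BL (+ k) c))) , f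

    index-Fx : Index Fx kMF (nFix ℕ.* k ^ r′)
    index-Fx = index-mult sFx sMF (×-sub (Im-sub Bₖ) sFx) kMF⊆MF proj₂ index-Fx-MF index-MF

    index-HQₖ : Index (λ x → Im Bₖ (fn A x)) (Im Bₖ) ((nBₖ ℕ.* ny) ℕ.* (nFix ℕ.* k ^ r′))
    index-HQₖ = L⊆HQ-gen Bₖ (λ {x} (c , q) → let (c' , q') = A-stable (c , λ _ → refl) in
        c' , (fcong A q ⨾ fscale A (+ k) (fn BL c) ⨾ ·ℤ-cong (+ k) q')) index-N₁ₖ index-Fx

-- Rational vectors

ℚ-ring : AlmostCommutativeRing 0ℓ 0ℓ
ℚ-ring = fromCommutativeRing ℚₚ.+-*-commutativeRing isZero
  where
  isZero : ∀ x → _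
  isZero x with ℚ.0ℚ ℚₚ.≟ x
  ... | yes p = just p
  ... | no _  = nothing

abstract
  -- Sums in ℚ are normalised by a gcd; in the unnormalised rationals the identity is one between
  -- integers.
  ιℚ-+ : ∀ a b → ιℚ (a ℤ.+ b) ≡ ιℚ a ℚ.+ ιℚ b
  ιℚ-+ a b = ℚₚ.toℚᵘ-injective (ℚᵘₚ.≃-trans (ℚₚ.toℚᵘ-fromℚᵘ (ℚᵘ.mkℚᵘ (a ℤ.+ b) 0)) (ℚᵘₚ.≃-trans (ℚᵘ.*≡* (h a b))
    (ℚᵘₚ.≃-trans (ℚᵘₚ.+-cong (ℚᵘₚ.≃-sym (ℚₚ.toℚᵘ-fromℚᵘ (ℚᵘ.mkℚᵘ a 0))) (ℚᵘₚ.≃-sym (ℚₚ.toℚᵘ-fromℚᵘ (ℚᵘ.mkℚᵘ b 0))))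
      (ℚᵘₚ.≃-sym (ℚₚ.toℚᵘ-homo-+ (ιℚ a) (ιℚ b))))))
    where
    h : ∀ a b → (a ℤ.+ b) ℤ.* + 1 ≡ (a ℤ.* + 1 ℤ.+ b ℤ.* + 1) ℤ.* + 1
    h = solve-∀

  ιℚ-* : ∀ a b → ιℚ (a ℤ.* b) ≡ ιℚ a ℚ.* ιℚ b
  ιℚ-* a b = ℚₚ.toℚᵘ-injective (ℚᵘₚ.≃-trans (ℚₚ.toℚᵘ-fromℚᵘ (ℚᵘ.mkℚᵘ (a ℤ.* b) 0)) (ℚᵘₚ.≃-trans (ℚᵘ.*≡* refl)
    (ℚᵘₚ.≃-trans (ℚᵘₚ.*-cong (ℚᵘₚ.≃-sym (ℚₚ.toℚᵘ-fromℚᵘ (ℚᵘ.mkℚᵘ a 0))) (ℚᵘₚ.≃-sym (ℚₚ.toℚᵘ-fromℚᵘ (ℚᵘ.mkℚᵘ b 0))))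
      (ℚᵘₚ.≃-sym (ℚₚ.toℚᵘ-homo-* (ιℚ a) (ιℚ b))))))

  ιℚ-injective : ∀ {a b} → ιℚ a ≡ ιℚ b → a ≡ b
  ιℚ-injective {a} {b} p with ℚₚ.fromℚᵘ-injective {ℚᵘ.mkℚᵘ a 0} {ℚᵘ.mkℚᵘ b 0} p
  ... | ℚᵘ.*≡* q = trans (sym (ℤₚ.*-identityʳ a)) (trans q (ℤₚ.*-identityʳ b))

  denominator : ∀ q → ∃[ m ] (m ≢ + 0 × ∃[ z ] (ιℚ m ℚ.* q ≡ ιℚ z))
  denominator q@(ℚ.mkℚ n d-1 _) = + suc d-1 , (λ ()) , n , ℚₚ.toℚᵘ-injective (ℚᵘₚ.≃-trans (ℚₚ.toℚᵘ-homo-* (ιℚ (+ suc d-1)) q)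
    (ℚᵘₚ.≃-trans (ℚᵘₚ.*-cong (ℚₚ.toℚᵘ-fromℚᵘ (ℚᵘ.mkℚᵘ (+ suc d-1) 0)) ℚᵘₚ.≃-refl)
      (ℚᵘₚ.≃-trans (ℚᵘ.*≡* (trans (h (+ suc d-1) n) (cong (λ k → n ℤ.* + suc k) (sym (ℕₚ.+-identityʳ d-1))))) (ℚᵘₚ.≃-sym (ℚₚ.toℚᵘ-fromℚᵘ (ℚᵘ.mkℚᵘ n 0))))))
    where
    h : ∀ m n → (m ℤ.* n) ℤ.* + 1 ≡ n ℤ.* m
    h = solve-∀

ιℚ-neg : ∀ a → ιℚ (ℤ.- a) ≡ ℚ.- ιℚ a
ιℚ-neg a = trans (h (ιℚ (ℤ.- a)) (ιℚ a)) (trans (cong (ℚ._- ιℚ a) (trans (sym (ιℚ-+ (ℤ.- a) a)) (cong ιℚ (ℤₚ.+-inverseˡ a)))) (ℚₚ.+-identityˡ (ℚ.- ιℚ a)))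
  where
  h : ∀ x y → x ≡ (x ℚ.+ y) ℚ.- y
  h = ring-∀ ℚ-ring

ιℚ-- : ∀ a b → ιℚ (a ℤ.- b) ≡ ιℚ a ℚ.- ιℚ b
ιℚ-- a b = trans (ιℚ-+ a (ℤ.- b)) (cong (ιℚ a ℚ.+_) (ιℚ-neg b))

inverse : ∀ m → m ≢ + 0 → ∃[ κ ] (κ ℚ.* ιℚ m ≡ ℚ.1ℚ)
inverse m m≢0 = (ℚ.1/ ιℚ m) {{nz}} , ℚₚ.*-inverseˡ (ιℚ m) {{nz}}
  where
  nz : ℚ.NonZero (ιℚ m)
  nz = ℚ.≢-nonZero (λ p → m≢0 (ιℚ-injective p))

ℚ-cancel : ∀ {m} → m ≢ + 0 → ∀ {a b} → ιℚ m ℚ.* a ≡ ιℚ m ℚ.* b → a ≡ b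
ℚ-cancel {m} m≢0 {a} {b} p = trans (unit a) (trans (cong (κ ℚ.*_) p) (sym (unit b)))
  where
  κ = proj₁ (inverse m m≢0)
  unit : ∀ a → a ≡ κ ℚ.* (ιℚ m ℚ.* a)
  unit a = trans (sym (ℚₚ.*-identityˡ a)) (trans (cong (ℚ._* a) (sym (proj₂ (inverse m m≢0)))) (ℚₚ.*-assoc κ (ιℚ m) a))

infixr 30 _⨟_
_⨟_ : {n : ℕ} {u v w : Vecℚ n} → u ≗ℚ v → v ≗ℚ w → u ≗ℚ w
(p ⨟ q) i = trans (p i) (q i)

≗ℚ-sym : {n : ℕ} {u v : Vecℚ n} → u ≗ℚ v → v ≗ℚ u
≗ℚ-sym p i = sym (p i)

+ℚ-cong : {n : ℕ} {x x' y y' : Vecℚ n} → x ≗ℚ x' → y ≗ℚ y' → (x +ℚ y) ≗ℚ (x' +ℚ y')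
+ℚ-cong p q i = cong₂ ℚ._+_ (p i) (q i)

-ℚ-cong : {n : ℕ} {x x' y y' : Vecℚ n} → x ≗ℚ x' → y ≗ℚ y' → (x -ℚ y) ≗ℚ (x' -ℚ y')
-ℚ-cong p q i = cong₂ ℚ._-_ (p i) (q i)

·ℚ-cong : {n : ℕ} (c : ℚ) {x x' : Vecℚ n} → x ≗ℚ x' → (c ·ℚ x) ≗ℚ (c ·ℚ x')
·ℚ-cong c p i = cong (c ℚ.*_) (p i)

ι-cong : {n : ℕ} {x y : Vecℤ n} → x ≗ℤ y → ι x ≗ℚ ι y
ι-cong p i = cong ιℚ (p i)

ι-+ : {n : ℕ} (x y : Vecℤ n) → ι (x +ℤ y) ≗ℚ (ι x +ℚ ι y)
ι-+ x y i = ιℚ-+ (x i) (y i)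

ι-- : {n : ℕ} (x y : Vecℤ n) → ι (x -ℤ y) ≗ℚ (ι x -ℚ ι y)
ι-- x y i = ιℚ-- (x i) (y i)

ι-· : {n : ℕ} (c : ℤ) (x : Vecℤ n) → ι (c ·ℤ x) ≗ℚ (ιℚ c ·ℚ ι x)
ι-· c x i = ιℚ-* c (x i)

ι-inj : {n : ℕ} {x y : Vecℤ n} → ι x ≗ℚ ι y → x ≗ℤ y
ι-inj p i = ιℚ-injective (p i)

denominators : ∀ {n} (v : Vecℚ n) → ∃[ m ] (m ≢ + 0 × ∃[ y ] ((ιℚ m ·ℚ v) ≗ℚ ι y))
denominators {zero}  v = + 1 , (λ ()) , (λ ()) , λ ()
denominators {suc n} v with denominator (v zero) | denominators (v ∘ suc)
... | m , m≢0 , z , p | m' , m'≢0 , y , q = m ℤ.* m' , nz , (m' ℤ.* z ◂ (m ·ℤ y)) , λ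
  { zero → trans (cong (ℚ._* v zero) (trans (ιℚ-* m m') (ℚₚ.*-comm (ιℚ m) (ιℚ m')))) (trans (ℚₚ.*-assoc (ιℚ m') (ιℚ m) (v zero)) (trans (cong (ιℚ m' ℚ.*_) p) (sym (ιℚ-* m' z))))
  ; (suc i) → trans (cong (ℚ._* v (suc i)) (ιℚ-* m m')) (trans (ℚₚ.*-assoc (ιℚ m) (ιℚ m') (v (suc i))) (trans (cong (ιℚ m ℚ.*_) (q i)) (sym (ιℚ-* m (y i))))) }
  where
  nz : m ℤ.* m' ≢ + 0
  nz eq with ℤₚ.i*j≡0⇒i≡0∨j≡0 m eq
  ... | inj₁ a = m≢0 a
  ... | inj₂ a = m'≢0 a

mvℚ-cong : {d : ℕ} (M : Mat d) {u v : Vecℚ d} → u ≗ℚ v → mvℚ M u ≗ℚ mvℚ M v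
mvℚ-cong {d} M p i = Sumℚ.sum-cong d (λ j → cong (ιℚ (M i j) ℚ.*_) (p j))

mvℚ-+ : {d : ℕ} (M : Mat d) (u v : Vecℚ d) → mvℚ M (u +ℚ v) ≗ℚ (mvℚ M u +ℚ mvℚ M v)
mvℚ-+ {d} M u v i = trans (Sumℚ.sum-cong d (λ j → ℚₚ.*-distribˡ-+ (ιℚ (M i j)) (u j) (v j)))
  (Sumℚ.sum-+ d (λ j → ιℚ (M i j) ℚ.* u j) (λ j → ιℚ (M i j) ℚ.* v j))

mvℚ-· : {d : ℕ} (M : Mat d) (c : ℚ) (u : Vecℚ d) → mvℚ M (c ·ℚ u) ≗ℚ (c ·ℚ mvℚ M u)
mvℚ-· {d} M c u i = trans (Sumℚ.sum-cong d (λ j → h (ιℚ (M i j)) c (u j))) (Sumℚ.sum-*ˡ d c (λ j → ιℚ (M i j) ℚ.* u j))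
  where
  h : ∀ a b c → a ℚ.* (b ℚ.* c) ≡ b ℚ.* (a ℚ.* c)
  h = ring-∀ ℚ-ring

ιℚ-sum : ∀ n (f : Fin n → ℤ) → ιℚ (sum n f) ≡ Sumℚ.sum n (λ i → ιℚ (f i))
ιℚ-sum zero    f = refl
ιℚ-sum (suc n) f = trans (ιℚ-+ (f zero) (sum n (f ∘ suc))) (cong (ιℚ (f zero) ℚ.+_) (ιℚ-sum n (f ∘ suc)))

mvℚ-ι : {d : ℕ} (M : Mat d) (x : Vecℤ d) → mvℚ M (ι x) ≗ℚ ι (mvℤ M x)
mvℚ-ι {d} M x i = sym (trans (ιℚ-sum d (λ j → M i j ℤ.* x j)) (Sumℚ.sum-cong d (λ j → ιℚ-* (M i j) (x j))))

module Rational {d : ℕ} (F : Mat d) where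
  A : Lin d d
  A = frob F

  AQ : Vecℚ d → Vecℚ d
  AQ u = mvℚ F u -ℚ u

  AQ-cong : ∀ {u v} → u ≗ℚ v → AQ u ≗ℚ AQ v
  AQ-cong p = -ℚ-cong (mvℚ-cong F p) p

  AQ-+ : ∀ u v → AQ (u +ℚ v) ≗ℚ (AQ u +ℚ AQ v)
  AQ-+ u v i = trans (cong (ℚ._- (u i ℚ.+ v i)) (mvℚ-+ F u v i)) (h (mvℚ F u i) (mvℚ F v i) (u i) (v i))
    where
    h : ∀ a b c d → (a ℚ.+ b) ℚ.- (c ℚ.+ d) ≡ (a ℚ.- c) ℚ.+ (b ℚ.- d)
    h = ring-∀ ℚ-ring

  AQ-· : ∀ c u → AQ (c ·ℚ u) ≗ℚ (c ·ℚ AQ u)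
  AQ-· c u i = trans (cong (ℚ._- (c ℚ.* u i)) (mvℚ-· F c u i)) (h c (mvℚ F u i) (u i))
    where
    h : ∀ a b c → a ℚ.* b ℚ.- a ℚ.* c ≡ a ℚ.* (b ℚ.- c)
    h = ring-∀ ℚ-ring

  AQ-ι : ∀ x → AQ (ι x) ≗ℚ ι (fn A x)
  AQ-ι x = -ℚ-cong (mvℚ-ι F x) (λ _ → refl) ⨟ ≗ℚ-sym (ι-- (mvℤ F x) x)

  neg1 : ∀ a b → a ℚ.- b ≡ a ℚ.+ ιℚ -[1+ 0 ] ℚ.* b
  neg1 a b = cong (a ℚ.+_) (trans (sym (ℚₚ.*-identityˡ (ℚ.- b))) (h ℚ.1ℚ b))
    where
    h : ∀ a b → a ℚ.* (ℚ.- b) ≡ (ℚ.- a) ℚ.* b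
    h = ring-∀ ℚ-ring

  AQ-- : ∀ u v → AQ (u -ℚ v) ≗ℚ (AQ u -ℚ AQ v)
  AQ-- u v = AQ-cong {u -ℚ v} {u +ℚ (ιℚ -[1+ 0 ] ·ℚ v)} (λ i → neg1 (u i) (v i)) ⨟ AQ-+ u _ ⨟
    λ i → trans (cong (AQ u i ℚ.+_) (AQ-· (ιℚ -[1+ 0 ]) v i)) (sym (neg1 (AQ u i) (AQ v i)))

  fixed⇒AQ0 : ∀ {u} → mvℚ F u ≗ℚ u → AQ u ≗ℚ zeroℚ
  fixed⇒AQ0 {u} p i = trans (cong (ℚ._- u i) (p i)) (ℚₚ.+-inverseʳ (u i))

  AQ0⇒fixed : ∀ {u} → AQ u ≗ℚ zeroℚ → mvℚ F u ≗ℚ u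
  AQ0⇒fixed {u} p i = trans (h (mvℚ F u i) (u i)) (trans (cong (ℚ._+ u i) (p i)) (ℚₚ.+-identityˡ (u i)))
    where
    h : ∀ a b → a ≡ (a ℚ.- b) ℚ.+ b
    h = ring-∀ ℚ-ring

-- The groups 𝔅, 𝔅[e] and 𝒯′ as quotients of subgroups of ℤᵈ

module Quotients {d : ℕ} (F B : Mat d) (setup : Setup F B) where

  open Integral F B setup
  open Rational F hiding (A)
  open Setting F B

  -- A denominator m of u gives m w = A y with y integral, and m cancels from the equation defining
  -- `InW`.
  AQ⇒InW : ∀ w u → ι w ≗ℚ AQ u → InW w
  AQ⇒InW w u p = ·ℤ-cancel m≢0 (≗-sym (fscale E m w) ⨾ fcong E (≗-sym Ay) ⨾ E-A y ⨾ ·ℤ-cong D Ay ⨾ λ i → h D m (w i))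
    where
    m = proj₁ (denominators u)
    m≢0 = proj₁ (proj₂ (denominators u))
    y = proj₁ (proj₂ (proj₂ (denominators u)))
    Ay : fn A y ≗ℤ (m ·ℤ w)
    Ay = ι-inj (≗ℚ-sym (AQ-ι y) ⨟ AQ-cong (≗ℚ-sym (proj₂ (proj₂ (proj₂ (denominators u))))) ⨟ AQ-· (ιℚ m) u ⨟
      ·ℚ-cong (ιℚ m) (≗ℚ-sym p) ⨟ ≗ℚ-sym (ι-· m w))
    h : ∀ a b c → a ℤ.* (b ℤ.* c) ≡ b ℤ.* (a ℤ.* c)
    h = solve-∀

  κ : ℚ
  κ = proj₁ (inverse D D≢0)

  κD : ∀ a → κ ℚ.* (ιℚ D ℚ.* a) ≡ a
  κD a = trans (sym (ℚₚ.*-assoc κ (ιℚ D) a)) (trans (cong (ℚ._* a) (proj₂ (inverse D D≢0))) (ℚₚ.*-identityˡ a))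

  -- For w in W the vector P w / D is a preimage under F - 1, because A (P w) = E w = D w. It is
  -- linear in w.
  lift : Vecℤ d → Vecℚ d
  lift w = κ ·ℚ ι (fn P w)

  AQ-lift : ∀ w → InW w → AQ (lift w) ≗ℚ ι w
  AQ-lift w p = AQ-· κ (ι (fn P w)) ⨟ ·ℚ-cong κ (AQ-ι (fn P w) ⨟ ι-cong p ⨟ ι-· D w) ⨟ λ i → κD (ιℚ (w i))

  -- An element u of 𝔅 carries a decomposition u = x + v. Its class is determined by w = (F - 1)v
  -- modulo AΛ, and w lies in Λ′ ∩ W; this gives `B-Bij`.
  wOf : BCar → Vecℤ d
  wOf (_ , _ , _ , (c , _) , _) = mvℤ B c

  xOf : BCar → Vecℤ d
  xOf (_ , x , _) = x

  vOf : BCar → Vecℚ d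
  vOf (_ , _ , v , _) = v

  AQ-v : ∀ u → AQ (vOf u) ≗ℚ ι (wOf u)
  AQ-v (_ , _ , _ , (_ , p) , _) = p

  u≡x+v : ∀ (u : BCar) → proj₁ u ≗ℚ (ι (xOf u) +ℚ vOf u)
  u≡x+v (_ , _ , _ , _ , q) = q

  AQ-u : ∀ (u : BCar) → AQ (proj₁ u) ≗ℚ ι (fn A (xOf u) +ℤ wOf u)
  AQ-u u = AQ-cong (u≡x+v u) ⨟ AQ-+ (ι (xOf u)) (vOf u) ⨟ +ℚ-cong (AQ-ι (xOf u)) (AQ-v u) ⨟ ≗ℚ-sym (ι-+ (fn A (xOf u)) (wOf u))

  w∈MW : ∀ u → MW (wOf u)
  w∈MW u@(_ , _ , v , (c , p) , _) = (c , λ _ → refl) , AQ⇒InW (wOf u) v (≗ℚ-sym p)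

  mkB : ∀ w → MW w → BCar
  mkB w ((c , q) , p) = (ι 0v +ℚ lift w) , 0v , lift w , (c , (AQ-lift w p ⨟ ι-cong q)) , λ _ → refl

  -- Λ + V^F is the preimage of AΛ under F - 1: here u - t is fixed.
  to-Λ+VF : ∀ u t → AQ u ≗ℚ ι (fn A t) → inΛ+VF u
  to-Λ+VF u t p = t , (u -ℚ ι t) , AQ0⇒fixed (AQ-- u (ι t) ⨟ -ℚ-cong p (AQ-ι t) ⨟ λ i → ℚₚ.+-inverseʳ (ιℚ (fn A t i))) , λ i → h (ιℚ (t i)) (u i)
    where
    h : ∀ t u → u ≡ t ℚ.+ (u ℚ.- t)
    h = ring-∀ ℚ-ring

  from-Λ+VF : ∀ u → inΛ+VF u → ∃[ t ] (AQ u ≗ℚ ι (fn A t))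
  from-Λ+VF u (t , f , ff , p) = t , (AQ-cong p ⨟ AQ-+ (ι t) f ⨟ λ i →
    trans (cong₂ ℚ._+_ (AQ-ι t i) (fixed⇒AQ0 ff i)) (ℚₚ.+-identityʳ (ιℚ (fn A t i))))

  BRel⇒ : ∀ u u' → BRel u u' → N₁ (wOf u -ℤ wOf u')
  BRel⇒ u u' p = -∈ sL (proj₁ (w∈MW u)) (proj₁ (w∈MW u')) , (t -ℤ (xOf u -ℤ xOf u')) , λ i → trans
      (h (fn A (xOf u) i) (wOf u i) (fn A (xOf u') i) (wOf u' i))
      (trans (cong₂ ℤ._-_ (eq i) (sym (fsub A (xOf u) (xOf u') i))) (sym (fsub A t (xOf u -ℤ xOf u') i)))
    where
    t = proj₁ (from-Λ+VF (proj₁ u -ℚ proj₁ u') p)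
    eq : ((fn A (xOf u) +ℤ wOf u) -ℤ (fn A (xOf u') +ℤ wOf u')) ≗ℤ fn A t
    eq = ι-inj (ι-- (fn A (xOf u) +ℤ wOf u) (fn A (xOf u') +ℤ wOf u') ⨟ -ℚ-cong (≗ℚ-sym (AQ-u u)) (≗ℚ-sym (AQ-u u')) ⨟ ≗ℚ-sym (AQ-- (proj₁ u) (proj₁ u')) ⨟ proj₂ (from-Λ+VF (proj₁ u -ℚ proj₁ u') p))
    h : ∀ a w a' w' → w ℤ.- w' ≡ ((a ℤ.+ w) ℤ.- (a' ℤ.+ w')) ℤ.- (a ℤ.- a')
    h = solve-∀

  BRel⇐ : ∀ u u' → AΛ (wOf u -ℤ wOf u') → BRel u u'
  BRel⇐ u u' (t , p) = to-Λ+VF (proj₁ u -ℚ proj₁ u') (t +ℤ (xOf u -ℤ xOf u')) (AQ-- (proj₁ u) (proj₁ u') ⨟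
      -ℚ-cong (AQ-u u) (AQ-u u') ⨟ ≗ℚ-sym (ι-- (fn A (xOf u) +ℤ wOf u) (fn A (xOf u') +ℤ wOf u')) ⨟ ι-cong (λ i → trans (h (fn A (xOf u) i) (wOf u i) (fn A (xOf u') i) (wOf u' i))
        (trans (cong₂ ℤ._+_ (p i) (sym (fsub A (xOf u) (xOf u') i))) (sym (fadd A t (xOf u -ℤ xOf u') i)))))
    where
    h : ∀ a w a' w' → (a ℤ.+ w) ℤ.- (a' ℤ.+ w') ≡ (w ℤ.- w') ℤ.+ (a ℤ.- a')
    h = solve-∀

  B-Bij : Bij BRel (Quot MW N₁)
  B-Bij = record
    { fun = λ u → wOf u , w∈MW u
    ; resp = λ {u} {u'} → BRel⇒ u u'
    ; inj = λ {u} {u'} p → BRel⇐ u u' (proj₂ p)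
    ; surj = λ (w , m) → mkB w m , refl∈ sN₁ (wOf (mkB w m)) w (≗-sym (proj₂ (proj₁ m)))
    ; ≋-sym = λ {x} {y} → quot-sym {H = MW} {N₁} sN₁ {x} {y}
    ; ≋-trans = λ {x} {y} {z} → quot-trans {H = MW} {N₁} sN₁ {x} {y} {z} }

  card-B : HasCard BCar BRel nB
  card-B = card-← B-Bij index-MW-N₁

  torsion⇒ : ∀ k u → inΛ+VF (ιℚ (+ k) ·ℚ proj₁ u) → AΛ ((+ k) ·ℤ wOf u)
  torsion⇒ k u p = (t -ℤ ((+ k) ·ℤ xOf u)) , λ i → trans (h (+ k) (fn A (xOf u) i) (wOf u i))
      (trans (cong₂ ℤ._-_ (eq i) (sym (fscale A (+ k) (xOf u) i))) (sym (fsub A t ((+ k) ·ℤ xOf u) i)))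
    where
    t = proj₁ (from-Λ+VF (ιℚ (+ k) ·ℚ proj₁ u) p)
    eq : ((+ k) ·ℤ (fn A (xOf u) +ℤ wOf u)) ≗ℤ fn A t
    eq = ι-inj (ι-· (+ k) (fn A (xOf u) +ℤ wOf u) ⨟ ·ℚ-cong (ιℚ (+ k)) (≗ℚ-sym (AQ-u u)) ⨟ ≗ℚ-sym (AQ-· (ιℚ (+ k)) (proj₁ u)) ⨟ proj₂ (from-Λ+VF (ιℚ (+ k) ·ℚ proj₁ u) p))
    h : ∀ k a w → k ℤ.* w ≡ k ℤ.* (a ℤ.+ w) ℤ.- k ℤ.* a
    h = solve-∀

  torsion⇐ : ∀ k u → AΛ ((+ k) ·ℤ wOf u) → inΛ+VF (ιℚ (+ k) ·ℚ proj₁ u)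
  torsion⇐ k u (t , p) = to-Λ+VF (ιℚ (+ k) ·ℚ proj₁ u) (t +ℤ ((+ k) ·ℤ xOf u)) (AQ-· (ιℚ (+ k)) (proj₁ u) ⨟ ·ℚ-cong (ιℚ (+ k)) (AQ-u u) ⨟
      ≗ℚ-sym (ι-· (+ k) (fn A (xOf u) +ℤ wOf u)) ⨟ ι-cong (λ i → trans (h (+ k) (fn A (xOf u) i) (wOf u i))
        (trans (cong₂ ℤ._+_ (p i) (sym (fscale A (+ k) (xOf u) i))) (sym (fadd A t ((+ k) ·ℤ xOf u) i)))))
    where
    h : ∀ k a w → k ℤ.* (a ℤ.+ w) ≡ k ℤ.* w ℤ.+ k ℤ.* a
    h = solve-∀

  Torsion : ℕ → Vecℤ d → Set
  Torsion k x = MW x × AΛ ((+ k) ·ℤ x)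

  Be-Bij : ∀ k → Bij (BeRel k) (Quot (Torsion k) N₁)
  Be-Bij k = record
    { fun = λ (u , p) → wOf u , w∈MW u , torsion⇒ k u p
    ; resp = λ {u} {u'} → BRel⇒ (proj₁ u) (proj₁ u')
    ; inj = λ {u} {u'} p → BRel⇐ (proj₁ u) (proj₁ u') (proj₂ p)
    ; surj = λ (w , m , t) → (mkB w m , torsion⇐ k (mkB w m) (≗∈ (preimage-sub ((+ k) ·L idLin) (Im-sub A)) (proj₂ (proj₁ m)) t))
                           , refl∈ sN₁ (wOf (mkB w m)) w (≗-sym (proj₂ (proj₁ m)))
    ; ≋-sym = λ {x} {y} → quot-sym {H = Torsion k} {N₁} sN₁ {x} {y}
    ; ≋-trans = λ {x} {y} {z} → quot-trans {H = Torsion k} {N₁} sN₁ {x} {y} {z} }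

  FixedV-ι : ∀ a → Fx a → FixedV (ι a)
  FixedV-ι a p = mvℚ-ι F a ⨟ ι-cong p

  FixedV-ι⁻ : ∀ {u} a → u ≗ℚ ι a → FixedV u → Fx a
  FixedV-ι⁻ a q p = ι-inj (≗ℚ-sym (mvℚ-ι F a) ⨟ mvℚ-cong F (≗ℚ-sym q) ⨟ p ⨟ q)

  inW-ι : ∀ b → InW b → inW (ι b)
  inW-ι b p = lift b , ≗ℚ-sym (AQ-lift b p)

  inW-ι⁻ : ∀ {u} b → u ≗ℚ ι b → inW u → InW b
  inW-ι⁻ b q (u , p) = AQ⇒InW b u (≗ℚ-sym q ⨟ p)

  T-Bij : Bij (TRel inΛ'ℚ) (Quot L M)
  T-Bij = record
    { fun = λ (u , c , p) → mvℤ B c , c , λ _ → refl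
    ; resp = λ { {u , c , p} {u' , c' , p'} (a , b , (ca , pa) , fa , (cb , pb) , wb , q) →
        mvℤ B ca , mvℤ B cb , ((ca , λ _ → refl) , FixedV-ι⁻ (mvℤ B ca) pa fa) , ((cb , λ _ → refl) , inW-ι⁻ (mvℤ B cb) pb wb) ,
        ι-inj (ι-- (mvℤ B c) (mvℤ B c') ⨟ -ℚ-cong (≗ℚ-sym p) (≗ℚ-sym p') ⨟ q ⨟ +ℚ-cong pa pb ⨟ ≗ℚ-sym (ι-+ (mvℤ B ca) (mvℤ B cb))) }
    ; inj = λ { {u , c , p} {u' , c' , p'} (a , b , ((ca , pa) , fa) , ((cb , pb) , wb) , q) →
        ι a , ι b , (ca , ι-cong pa) , FixedV-ι a fa , (cb , ι-cong pb) , inW-ι b wb ,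
        (-ℚ-cong p p' ⨟ ≗ℚ-sym (ι-- (mvℤ B c) (mvℤ B c')) ⨟ ι-cong q ⨟ ι-+ a b) }
    ; surj = λ (x , c , p) → (ι (mvℤ B c) , c , λ _ → refl) , refl∈ sM (mvℤ B c) x (≗-sym p)
    ; ≋-sym = λ {x} {y} → quot-sym {H = L} {M} sM {x} {y}
    ; ≋-trans = λ {x} {y} {z} → quot-trans {H = L} {M} sM {x} {y} {z} }

  card-T : HasCard (TCar inΛ'ℚ) (TRel inΛ'ℚ) nT
  card-T = card-← T-Bij index-L-M

-- A square integer matrix is equivalent to its transpose

transpose : {n : ℕ} → Mat n → Mat n
transpose M i j = M j i

dot-transpose : {n : ℕ} (M : Mat n) (x y : Vecℤ n) → dot (matVec (transpose M) y) x ≡ dot y (matVec M x)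
dot-transpose {n} M x y = trans (sum-cong n (λ j → trans (ℤₚ.*-comm (matVec (transpose M) y j) (x j)) (sym (sum-*ˡ n (x j) (λ i → M i j ℤ.* y i)))))
  (trans (sum-swap n n (λ j i → x j ℤ.* (M i j ℤ.* y i)))
    (sum-cong n (λ i → trans (sum-cong n (λ j → h (x j) (M i j) (y i))) (sum-*ˡ n (y i) (λ j → M i j ℤ.* x j)))))
  where
  h : ∀ a b c → a ℤ.* (b ℤ.* c) ≡ c ℤ.* (b ℤ.* a)
  h = solve-∀

record Iso (n : ℕ) : Set where
  field
    fwd bwd : Lin n n
    fwd-bwd : ∀ x → fn fwd (fn bwd x) ≗ℤ x
    bwd-fwd : ∀ x → fn bwd (fn fwd x) ≗ℤ x

open Iso

Iso-inverse : {n : ℕ} → Iso n → Iso n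
Iso-inverse h = record { fwd = bwd h ; bwd = fwd h ; fwd-bwd = bwd-fwd h ; bwd-fwd = fwd-bwd h }

Iso-∘ : {n : ℕ} → Iso n → Iso n → Iso n
Iso-∘ h k = record
  { fwd = fwd h ∘L fwd k ; bwd = bwd k ∘L bwd h
  ; fwd-bwd = λ x → fcong (fwd h) (fwd-bwd k (fn (bwd h) x)) ⨾ fwd-bwd h x
  ; bwd-fwd = λ x → fcong (bwd k) (bwd-fwd h (fn (fwd k) x)) ⨾ bwd-fwd k x }

rowIso actIso : {n : ℕ} → Uni n → Iso n
rowIso u = record { fwd = row u ; bwd = row⁻ u ; fwd-bwd = row-row⁻ u ; bwd-fwd = row⁻-row u }
actIso u = record { fwd = act u ; bwd = act⁻ u ; fwd-bwd = act-act⁻ u ; bwd-fwd = act⁻-act u }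

Iso-suc : {n : ℕ} → Iso n → Iso (suc n)
Iso-suc h = record
  { fwd = pairL headL (fwd h ∘L tailL) ; bwd = pairL headL (bwd h ∘L tailL)
  ; fwd-bwd = λ { x zero → refl ; x (suc i) → fwd-bwd h (x ∘ suc) i }
  ; bwd-fwd = λ { x zero → refl ; x (suc i) → bwd-fwd h (x ∘ suc) i } }

-- The relation Mᵗ ψ = φ M with φ and ψ invertible over ℤ. It is carried back through each step of a
-- reduction that splits off 1 × 1 blocks.
record TransEq {n : ℕ} (M : Mat n) : Set where
  field
    φ ψ : Iso n
    intertwine : ∀ x → matVec (transpose M) (fn (fwd ψ) x) ≗ℤ fn (fwd φ) (matVec M x)

TransEq-transpose : {n : ℕ} (M : Mat n) → TransEq M → TransEq (transpose M)
TransEq-transpose M t = record { φ = Iso-inverse φ ; ψ = Iso-inverse ψ ; intertwine = λ x →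
    ≗-sym (bwd-fwd φ (matVec M (fn (bwd ψ) x))) ⨾ fcong (bwd φ) (≗-sym (intertwine (fn (bwd ψ) x)) ⨾ fcong (matLin (transpose M)) (fwd-bwd ψ x)) }
  where open TransEq t

colAct : {n : ℕ} → Uni n → Mat n → Mat n
colAct u M i = fn (row u) (M i)

colAct-transpose : {n : ℕ} (u : Uni n) (M : Mat n) (y : Vecℤ n) → matVec (transpose (colAct u M)) y ≗ℤ fn (row u) (matVec (transpose M) y)
colAct-transpose u M y j = trans (sym (dot-e (matVec (transpose (colAct u M)) y) j)) (trans (dot-transpose (colAct u M) (e j) y) (trans
  (dot-cong {g = y} (λ _ → refl) (λ i → adj u (M i) (e j))) (trans (sym (dot-transpose M (fn (act u) (e j)) y))
    (trans (sym (adj u (matVec (transpose M) y) (e j))) (dot-e (fn (row u) (matVec (transpose M) y)) j)))))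

-- With N = M U the transpose of N is Uᵗ Mᵗ, so Nᵗ ψ = φ N becomes Mᵗ (ψ U⁻¹) = (U⁻ᵗ φ) M.
TransEq-colAct : {n : ℕ} (u : Uni n) (M : Mat n) → TransEq (colAct u M) → TransEq M
TransEq-colAct u M t = record
  { φ = Iso-∘ (Iso-inverse (rowIso u)) φ
  ; ψ = Iso-∘ ψ (Iso-inverse (actIso u))
  ; intertwine = λ x → ≗-sym (row⁻-row u _) ⨾ fcong (row⁻ u) (≗-sym (colAct-transpose u M (fn (fwd ψ) (fn (act⁻ u) x))) ⨾ intertwine (fn (act⁻ u) x) ⨾
      fcong (fwd φ) ((λ i → adj u (M i) (fn (act⁻ u) x)) ⨾ fcong (matLin M) (act-act⁻ u x))) }
  where open TransEq t

TransEq-block : {n : ℕ} (M : Mat (suc n)) → (∀ k → M zero (suc k) ≡ + 0) → (∀ k → M (suc k) zero ≡ + 0) →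
                TransEq (λ i j → M (suc i) (suc j)) → TransEq M
TransEq-block {n} M r0 c0 t = record
  { φ = Iso-suc φ
  ; ψ = Iso-suc ψ
  ; intertwine = λ x → λ
      { zero → trans (head (transpose M) c0 (x zero) (fn (fwd ψ) (x ∘ suc))) (sym (head M r0 (x zero) (x ∘ suc)))
      ; (suc i) → trans (tail (transpose M) r0 (x zero) (fn (fwd ψ) (x ∘ suc)) i) (trans (intertwine (x ∘ suc) i)
          (fcong (fwd φ) (λ k → sym (tail M c0 (x zero) (x ∘ suc) k)) i)) } }
  where
  open TransEq t
  head : ∀ (N : Mat (suc n)) → (∀ k → N zero (suc k) ≡ + 0) → ∀ a y → N zero zero ℤ.* a ℤ.+ dot (N zero ∘ suc) y ≡ N zero zero ℤ.* a
  head N p a y = trans (+-congˡ (N zero zero ℤ.* a) (dot-0ˡ y p)) (ℤₚ.+-identityʳ (N zero zero ℤ.* a))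
  tail : ∀ (N : Mat (suc n)) → (∀ k → N (suc k) zero ≡ + 0) → ∀ a y i →
         N (suc i) zero ℤ.* a ℤ.+ dot (N (suc i) ∘ suc) y ≡ dot (N (suc i) ∘ suc) y
  tail N p a y i = trans (cong (λ z → z ℤ.* a ℤ.+ dot (N (suc i) ∘ suc) y) (p i))
    (trans (cong (ℤ._+ dot (N (suc i) ∘ suc) y) (ℤₚ.*-zeroˡ a)) (ℤₚ.+-identityˡ (dot (N (suc i) ∘ suc) y)))

-- Subtracts q k times column 0 from column 1 + k.
shear : {n : ℕ} → Vecℤ n → Uni (suc n)
shear {n} q = record
  { row = rw q ; row⁻ = rw (0v -ℤ q) ; act = ac q ; act⁻ = ac (0v -ℤ q)
  ; row-row⁻ = λ { x zero → refl ; x (suc i) → h₁ (x (suc i)) (q i) (x zero) }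
  ; row⁻-row = λ { x zero → refl ; x (suc i) → h₂ (x (suc i)) (q i) (x zero) }
  ; act-act⁻ = λ { x zero → trans (cong (λ z → (x zero ℤ.- z) ℤ.- dot q (x ∘ suc)) (negdot (x ∘ suc))) (h₃ (x zero) (dot q (x ∘ suc))) ; x (suc i) → refl }
  ; act⁻-act = λ { x zero → trans (cong (λ z → (x zero ℤ.- dot q (x ∘ suc)) ℤ.- z) (negdot (x ∘ suc))) (h₄ (x zero) (dot q (x ∘ suc))) ; x (suc i) → refl }
  ; adj = λ g x → trans (+-congˡ (g zero ℤ.* x zero) (trans (sum-cong n (λ k → h₅ (g (suc k)) (q k) (g zero) (x (suc k))))
      (trans (sum-+ n (λ k → g (suc k) ℤ.* x (suc k)) (λ k → (ℤ.- g zero) ℤ.* (q k ℤ.* x (suc k))))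
        (+-congˡ (dot (g ∘ suc) (x ∘ suc)) (sum-*ˡ n (ℤ.- g zero) (λ k → q k ℤ.* x (suc k)))))))
      (h₆ (g zero) (x zero) (dot (g ∘ suc) (x ∘ suc)) (dot q (x ∘ suc))) }
  where
  rw ac : Vecℤ n → Lin (suc n) (suc n)
  rw q = pairL headL (tailL -L matLin′)
    where
    matLin′ : Lin (suc n) n
    matLin′ .fn x i = q i ℤ.* x zero
    matLin′ .fcong p i = cong (q i ℤ.*_) (p zero)
    matLin′ .fadd x y i = ℤₚ.*-distribˡ-+ (q i) (x zero) (y zero)
    matLin′ .fscale c x i = comm3 (q i) c (x zero)
      where
      comm3 : ∀ a b c → a ℤ.* (b ℤ.* c) ≡ b ℤ.* (a ℤ.* c)
      comm3 = solve-∀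
  ac q = pairL (headL -L (matLin (λ _ → q) ∘L tailL)) tailL
  negdot : ∀ y → dot (0v -ℤ q) y ≡ ℤ.- dot q y
  negdot y = trans (dot-comm (0v -ℤ q) y) (trans (fsub (matLin {1} (λ _ → y)) 0v q zero) (trans
    (cong₂ ℤ._-_ (dot-0ʳ y (λ _ → refl)) (dot-comm y q)) (ℤₚ.+-identityˡ (ℤ.- dot q y))))
  h₁ : ∀ x q y → (x ℤ.- (+ 0 ℤ.- q) ℤ.* y) ℤ.- q ℤ.* y ≡ x
  h₁ = solve-∀
  h₂ : ∀ x q y → (x ℤ.- q ℤ.* y) ℤ.- (+ 0 ℤ.- q) ℤ.* y ≡ x
  h₂ = solve-∀
  h₃ : ∀ x d → (x ℤ.- (ℤ.- d)) ℤ.- d ≡ x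
  h₃ = solve-∀
  h₄ : ∀ x d → (x ℤ.- d) ℤ.- (ℤ.- d) ≡ x
  h₄ = solve-∀
  h₅ : ∀ g q g₀ x → (g ℤ.- q ℤ.* g₀) ℤ.* x ≡ g ℤ.* x ℤ.+ (ℤ.- g₀) ℤ.* (q ℤ.* x)
  h₅ = solve-∀
  h₆ : ∀ g x s d → g ℤ.* x ℤ.+ (s ℤ.+ (ℤ.- g) ℤ.* d) ≡ g ℤ.* (x ℤ.- d) ℤ.+ s
  h₆ = solve-∀

-- The bound forces t = ±1, which is its own inverse.
∣unit∣ : ∀ g g' t → g ≢ + 0 → g ≡ g' ℤ.* t → ¬ (∣ g' ∣ ℕ.< ∣ g ∣) → g' ≡ g ℤ.* t
∣unit∣ g g' t g≢0 eq nlt = trans (sym (ℤₚ.*-identityʳ g')) (trans (cong (g' ℤ.*_) (sym tt≡1)) (trans (sym (ℤₚ.*-assoc g' t t)) (cong (ℤ._* t) (sym eq))))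
  where
  g'≢0 : g' ≢ + 0
  g'≢0 z = g≢0 (trans eq (trans (cong (ℤ._* t) z) (ℤₚ.*-zeroˡ t)))
  t≤1 : ∣ t ∣ ≤ 1
  t≤1 = ℕₚ.*-cancelˡ-≤ ∣ g' ∣ {{ℕ.≢-nonZero (g'≢0 ∘ ℤₚ.∣i∣≡0⇒i≡0)}}
    (subst₂ _≤_ (trans (cong ∣_∣ eq) (ℤₚ.abs-* g' t)) (sym (ℕₚ.*-identityʳ ∣ g' ∣)) (ℕₚ.≮⇒≥ nlt))
  square : ∀ t → ∣ t ∣ ≤ 1 → t ≢ + 0 → t ℤ.* t ≡ + 1
  square (+ 0) _ z = ⊥-elim (z refl)
  square (+ 1) _ z = refl
  square (+ suc (suc n)) (s≤s ()) z
  square -[1+ 0 ] _ z = refl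
  square -[1+ suc n ] (s≤s ()) z
  tt≡1 : t ℤ.* t ≡ + 1
  tt≡1 = square t t≤1 (λ z → g≢0 (trans eq (trans (cong (g' ℤ.*_) z) (ℤₚ.*-zeroʳ g'))))

module _ {n : ℕ} (IH : ∀ (M : Mat n) → TransEq M) where

  module RowReduced (M : Mat (suc n)) where
    u = opsUni (proj₁ (reduce (M zero)))
    N = colAct u M
    γ = N zero zero
    row0 : ∀ k → N zero (suc k) ≡ + 0
    row0 = proj₂ (reduce (M zero))
    entries : ∀ i → M zero i ≡ γ ℤ.* fn (row⁻ u) (e zero) i
    entries i = trans (sym (row⁻-row u (M zero) i)) (trans (fcong (row⁻ u) N0 i) (fscale (row⁻ u) γ (e zero) i))
      where
      N0 : N zero ≗ℤ (γ ·ℤ e zero)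
      N0 zero    = sym (ℤₚ.*-identityʳ γ)
      N0 (suc k) = trans (row0 k) (sym (ℤₚ.*-zeroʳ γ))

  -- Row 0 of the transpose is column 0 of M, and γ is its gcd up to sign. If γ is smaller than the
  -- corner, the reduced transpose has the same shape with a smaller corner. Otherwise the corner
  -- divides its column, and a shear clears it without disturbing the zeros already present.
  diagonalise : (M : Mat (suc n)) → (∀ k → M zero (suc k) ≡ + 0) → M zero zero ≢ + 0 → Acc ℕ._<_ ∣ M zero zero ∣ → TransEq M
  diagonalise M r0 g≢0 (acc rec) = byCases (∣ γ ∣ ℕₚ.<? ∣ g₀ ∣)
    where
    g₀ = M zero zero
    Mᵗ : Mat (suc n)
    Mᵗ = transpose M
    open RowReduced Mᵗ
    t = fn (row⁻ u) (e zero) zero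
    γ≢0 : γ ≢ + 0
    γ≢0 z = g≢0 (trans (entries zero) (trans (cong (ℤ._* t) z) (ℤₚ.*-zeroˡ t)))
    byCases : Dec (∣ γ ∣ ℕ.< ∣ g₀ ∣) → TransEq M
    byCases (yes lt) = TransEq-transpose Mᵗ (TransEq-colAct u Mᵗ (diagonalise N row0 γ≢0 (rec lt)))
    byCases (no nlt) = TransEq-transpose Mᵗ (TransEq-colAct (shear q) Mᵗ (TransEq-block (colAct (shear q) Mᵗ) cleared still (IH _)))
      where
      w = fn (row⁻ u) (e zero)
      -- The entries to be cleared are γ w and γ = g₀ t, so these are their quotients by the corner.
      q : Vecℤ n
      q k = t ℤ.* w (suc k)
      h : ∀ a t w → (a ℤ.* t) ℤ.* w ℤ.- (t ℤ.* w) ℤ.* a ≡ + 0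
      h = solve-∀
      cleared : ∀ k → colAct (shear q) Mᵗ zero (suc k) ≡ + 0
      cleared k = trans (cong (λ z → z ℤ.- q k ℤ.* g₀) (trans (entries (suc k)) (cong (ℤ._* w (suc k)) (∣unit∣ g₀ γ t g≢0 (entries zero) nlt)))) (h g₀ t (w (suc k)))
      still : ∀ k → colAct (shear q) Mᵗ (suc k) zero ≡ + 0
      still k = r0 k

  transposeEq-step : (M : Mat (suc n)) → TransEq M
  transposeEq-step M = TransEq-colAct u M (first (γ ℤ.≟ + 0))
    where
    open RowReduced M
    module R₂ = RowReduced (transpose N)
    first : Dec (γ ≡ + 0) → TransEq N
    first (no γ≢0)  = diagonalise N row0 γ≢0 (<-wellFounded _)
    -- Row 0 of `N` vanishes. A nonzero column 0 provides the corner after transposition; if that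
    -- vanishes too, a zero block splits off.
    first (yes γ≡0) = second (R₂.γ ℤ.≟ + 0)
      where
      second : Dec (R₂.γ ≡ + 0) → TransEq N
      second (no γ′≢0) = TransEq-transpose (transpose N) (TransEq-colAct R₂.u (transpose N) (diagonalise R₂.N R₂.row0 γ′≢0 (<-wellFounded _)))
      second (yes z)   = TransEq-block N row0 (λ k → trans (R₂.entries (suc k)) (trans (cong (ℤ._* fn (row⁻ R₂.u) (e zero) (suc k)) z)
        (ℤₚ.*-zeroˡ (fn (row⁻ R₂.u) (e zero) (suc k))))) (IH _)

transposeEq-rec : ∀ {n} (M : Mat n) → TransEq M
transposeEq-rec {zero}  M = record { φ = triv ; ψ = triv ; intertwine = λ x () }
  where
  triv : Iso zero
  triv = record { fwd = idLin ; bwd = idLin ; fwd-bwd = λ x () ; bwd-fwd = λ x () }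
transposeEq-rec {suc n} M = transposeEq-step transposeEq-rec M

abstract
  transposeEq : ∀ {n} (M : Mat n) → TransEq M
  transposeEq = transposeEq-rec

-- Arithmetic: Bézout, squares, and integrality of rationals

-- A unimodular matrix takes the row (a, b) to (g, 0). Its first column contains the Bézout
-- coefficients, and its inverse the cofactors.
bezout : ∀ a b → ∃[ g ] ∃[ s ] ∃[ t ] ∃[ u ] ∃[ v ] (a ℤ.* s ℤ.+ b ℤ.* t ≡ g × a ≡ g ℤ.* u × b ≡ g ℤ.* v)
bezout a b = g , y zero , y (suc zero) , z zero , z (suc zero) ,
    trans (sym (+-congˡ (a ℤ.* y zero) (ℤₚ.+-identityʳ (b ℤ.* y (suc zero))))) (trans (dot-row v r (e zero)) (ℤₚ.*-identityʳ g)) ,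
    entries zero , entries (suc zero)
  where
  v : Vecℤ 2
  v = a ◂ (b ◂ λ ())
  r = reduce v
  u = opsUni (proj₁ r)
  g = fn (row u) v zero
  y = fn (act u) (e zero)
  z = fn (row⁻ u) (e zero)
  reduced : fn (row u) v ≗ℤ (g ·ℤ e zero)
  reduced zero    = sym (ℤₚ.*-identityʳ g)
  reduced (suc k) = trans (proj₂ r k) (sym (ℤₚ.*-zeroʳ g))
  entries : ∀ i → v i ≡ g ℤ.* z i
  entries i = trans (sym (row⁻-row u v i)) (trans (fcong (row⁻ u) reduced i) (fscale (row⁻ u) g (e zero) i))

unit-square : ∀ g → ∣ g ∣ ≡ 1 → g ℤ.* g ≡ + 1
unit-square (+ .1)       refl = refl
unit-square -[1+ .0 ]    refl = refl

inverse-mod-prime : ∀ {q} → Prime q → ∀ a → ¬ (+ q Signed.∣ a) → ∃[ s ] ∃[ t ] (a ℤ.* s ℤ.+ + q ℤ.* t ≡ + 1)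
inverse-mod-prime {q} pr a ∤a with bezout a (+ q)
... | g , s , t , u , v , eq , au , qv with prime⇒irreducible pr {∣ g ∣} (Signed.∣⇒∣ᵤ {g} {+ q} (Signed.divides v (trans qv (ℤₚ.*-comm g v))))
...   | inj₁ one = s ℤ.* g , t ℤ.* g , trans (h a s (+ q) t g) (trans (cong (ℤ._* g) eq) (unit-square g one))
  where
  h : ∀ a s q t g → a ℤ.* (s ℤ.* g) ℤ.+ q ℤ.* (t ℤ.* g) ≡ (a ℤ.* s ℤ.+ q ℤ.* t) ℤ.* g
  h = solve-∀
...   | inj₂ same = ⊥-elim (∤a (subst (Signed._∣ a) (cong +_ same) (Signed.∣-trans (Signed.∣m∣∣m {g}) (Signed.divides u (trans au (ℤₚ.*-comm g u))))))

square-quotient : ∀ s t k → t ≢ 0 → s ℕ.* s ≡ (t ℕ.* t) ℕ.* k → ∃[ u ] (k ≡ u ℕ.* u)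
square-quotient s t k t≢0 eq with bezout (+ s) (+ t)
... | g , α , β , u , v , gcd , su , tv = ∣ u ∣ , trans (cong ∣_∣ k≡u²) (ℤₚ.abs-* u u)
  where
  g≢0 : g ≢ + 0
  g≢0 z = t≢0 (ℤₚ.+-injective (trans tv (trans (cong (ℤ._* v) z) (ℤₚ.*-zeroˡ v))))
  instance
    g-nz : ℤ.NonZero g
    g-nz = ℤ.≢-nonZero g≢0
  coprime : u ℤ.* α ℤ.+ v ℤ.* β ≡ + 1
  coprime = ℤₚ.*-cancelˡ-≡ g (u ℤ.* α ℤ.+ v ℤ.* β) (+ 1) (trans (h g u α v β) (trans (cong₂ (λ x y → x ℤ.* α ℤ.+ y ℤ.* β) (sym su) (sym tv)) (trans gcd (sym (ℤₚ.*-identityʳ g)))))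
    where
    h : ∀ g u a v b → g ℤ.* (u ℤ.* a ℤ.+ v ℤ.* b) ≡ (g ℤ.* u) ℤ.* a ℤ.+ (g ℤ.* v) ℤ.* b
    h = solve-∀
  eqℤ : + s ℤ.* + s ≡ (+ t ℤ.* + t) ℤ.* + k
  eqℤ = trans (sym (ℤₚ.pos-* s s)) (trans (cong +_ eq) (trans (ℤₚ.pos-* (t ℕ.* t) k) (cong (ℤ._* + k) (ℤₚ.pos-* t t))))
  u²≡v²k : u ℤ.* u ≡ (v ℤ.* v) ℤ.* + k
  u²≡v²k = ℤₚ.*-cancelˡ-≡ g (u ℤ.* u) ((v ℤ.* v) ℤ.* + k) (ℤₚ.*-cancelˡ-≡ g (g ℤ.* (u ℤ.* u)) (g ℤ.* ((v ℤ.* v) ℤ.* + k))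
      (trans (h g u) (trans (cong₂ ℤ._*_ (sym su) (sym su)) (trans eqℤ (trans (cong (ℤ._* + k) (cong₂ ℤ._*_ tv tv)) (h′ g v (+ k)))))))
    where
    h : ∀ g u → g ℤ.* (g ℤ.* (u ℤ.* u)) ≡ (g ℤ.* u) ℤ.* (g ℤ.* u)
    h = solve-∀
    h′ : ∀ g v k → ((g ℤ.* v) ℤ.* (g ℤ.* v)) ℤ.* k ≡ g ℤ.* (g ℤ.* ((v ℤ.* v) ℤ.* k))
    h′ = solve-∀
  -- An inverse of v, from 1 = u² α² + (u α + 1)(1 - u α) with u² = v² k and 1 - u α = v β.
  w : ℤ
  w = v ℤ.* + k ℤ.* (α ℤ.* α) ℤ.+ (u ℤ.* α ℤ.+ + 1) ℤ.* β
  vw≡1 : v ℤ.* w ≡ + 1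
  vw≡1 = trans (h₁ v (+ k) α β u) (trans (cong (λ z → z ℤ.* (α ℤ.* α) ℤ.+ (u ℤ.* α ℤ.+ + 1) ℤ.* (v ℤ.* β)) (sym u²≡v²k))
      (trans (cong (λ z → (u ℤ.* u) ℤ.* (α ℤ.* α) ℤ.+ (u ℤ.* α ℤ.+ + 1) ℤ.* z) vβ) (h₂ u α)))
    where
    h₁ : ∀ v k a b u → v ℤ.* (v ℤ.* k ℤ.* (a ℤ.* a) ℤ.+ (u ℤ.* a ℤ.+ + 1) ℤ.* b) ≡ ((v ℤ.* v) ℤ.* k) ℤ.* (a ℤ.* a) ℤ.+ (u ℤ.* a ℤ.+ + 1) ℤ.* (v ℤ.* b)
    h₁ = solve-∀
    h₂ : ∀ u a → (u ℤ.* u) ℤ.* (a ℤ.* a) ℤ.+ (u ℤ.* a ℤ.+ + 1) ℤ.* (+ 1 ℤ.- u ℤ.* a) ≡ + 1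
    h₂ = solve-∀
    h₃ : ∀ x y → y ≡ (x ℤ.+ y) ℤ.- x
    h₃ = solve-∀
    vβ : v ℤ.* β ≡ + 1 ℤ.- u ℤ.* α
    vβ = trans (h₃ (u ℤ.* α) (v ℤ.* β)) (cong (ℤ._- u ℤ.* α) coprime)
  k≡u² : + k ≡ u ℤ.* u
  k≡u² = trans (sym (ℤₚ.*-identityˡ (+ k))) (trans (cong (ℤ._* + k) (sym (unit-square v
    (ℕₚ.m*n≡1⇒m≡1 ∣ v ∣ ∣ w ∣ (trans (sym (ℤₚ.abs-* v w)) (cong ∣_∣ vw≡1)))))) (sym u²≡v²k))

halve : ∀ u → (∃[ w ] u ≡ w ℕ.+ w) ⊎ (∃[ w ] u ≡ suc (w ℕ.+ w))
halve zero    = inj₁ (0 , refl)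
halve (suc u) with halve u
... | inj₁ (w , p) = inj₂ (w , cong suc p)
... | inj₂ (w , p) = inj₁ (suc w , trans (cong suc p) (cong suc (sym (ℕₚ.+-suc w w))))

odd≢even : ∀ a b → suc (a ℕ.+ a) ≢ b ℕ.+ b
odd≢even zero    (suc b) p with trans (ℕₚ.suc-injective p) (ℕₚ.+-suc b b)
... | ()
odd≢even (suc a) (suc b) p = odd≢even a b (ℕₚ.suc-injective (trans (sym (cong suc (ℕₚ.+-suc a a))) (trans (ℕₚ.suc-injective p) (ℕₚ.+-suc b b))))

half-square : ∀ k u → k ℕ.+ k ≡ u ℕ.* u → ∃[ w ] (k ≡ 2 ℕ.* (w ℕ.* w))
half-square k u eq with halve u
... | inj₁ (w , refl) = w , ℕₚ.*-cancelˡ-≡ k (2 ℕ.* (w ℕ.* w)) 2 (trans (h₀ k) (trans eq (h w)))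
  where
  h₀ : ∀ k → 2 ℕ.* k ≡ k ℕ.+ k
  h₀ = ℕ-solve-∀
  h : ∀ w → (w ℕ.+ w) ℕ.* (w ℕ.+ w) ≡ 2 ℕ.* (2 ℕ.* (w ℕ.* w))
  h = ℕ-solve-∀
... | inj₂ (w , refl) = ⊥-elim (odd≢even (2 ℕ.* (w ℕ.* w) ℕ.+ 2 ℕ.* w) k (trans (h w) (sym eq)))
  where
  h : ∀ w → 1 ℕ.+ ((2 ℕ.* (w ℕ.* w) ℕ.+ 2 ℕ.* w) ℕ.+ (2 ℕ.* (w ℕ.* w) ℕ.+ 2 ℕ.* w)) ≡ (1 ℕ.+ (w ℕ.+ w)) ℕ.* (1 ℕ.+ (w ℕ.+ w))
  h = ℕ-solve-∀

-- When exactly one of m k and m is given as a square, it is k + k that becomes a quotient of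
-- squares, hence a square, and then k is twice a square.
IsSqOr2Sq-quotient : ∀ m k → m ≢ 0 → IsSqOr2Sq (m ℕ.* k) → IsSqOr2Sq m → IsSqOr2Sq k
IsSqOr2Sq-quotient m k m≢0 (s , inj₁ p) (t , inj₁ refl) =
  let (u , q) = square-quotient s t k (λ { refl → m≢0 refl }) (sym p) in u , inj₁ q
IsSqOr2Sq-quotient m k m≢0 (s , inj₂ p) (t , inj₂ refl) =
  let (u , q) = square-quotient s t k (λ { refl → m≢0 refl }) (ℕₚ.*-cancelˡ-≡ (s ℕ.* s) ((t ℕ.* t) ℕ.* k) 2 (trans (sym p) (ℕₚ.*-assoc 2 (t ℕ.* t) k))) in u , inj₁ q
IsSqOr2Sq-quotient m k m≢0 (s , inj₂ p) (t , inj₁ refl) =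
  let (u , q) = square-quotient (2 ℕ.* s) t (k ℕ.+ k) (λ { refl → m≢0 refl }) (trans (h s) (trans (cong (2 ℕ.*_) (sym p)) (h′ t k)))
      (w , r) = half-square k u q in w , inj₂ r
  where
  h : ∀ s → (2 ℕ.* s) ℕ.* (2 ℕ.* s) ≡ 2 ℕ.* (2 ℕ.* (s ℕ.* s))
  h = ℕ-solve-∀
  h′ : ∀ t k → 2 ℕ.* ((t ℕ.* t) ℕ.* k) ≡ (t ℕ.* t) ℕ.* (k ℕ.+ k)
  h′ = ℕ-solve-∀
IsSqOr2Sq-quotient m k m≢0 (s , inj₁ p) (t , inj₂ refl) =
  let (u , q) = square-quotient s t (k ℕ.+ k) (λ { refl → m≢0 refl }) (trans (sym p) (h′ t k))
      (w , r) = half-square k u q in w , inj₂ r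
  where
  h′ : ∀ t k → 2 ℕ.* (t ℕ.* t) ℕ.* k ≡ (t ℕ.* t) ℕ.* (k ℕ.+ k)
  h′ = ℕ-solve-∀

int-≡ : ∀ {p q} → p ≡ q → IsInt p → IsInt q
int-≡ refl i = i

int-ι : ∀ a → IsInt (ιℚ a)
int-ι a = a , refl

int-+ : ∀ {p q} → IsInt p → IsInt q → IsInt (p ℚ.+ q)
int-+ (a , refl) (b , refl) = a ℤ.+ b , sym (ιℚ-+ a b)

int-- : ∀ {p q} → IsInt p → IsInt q → IsInt (p ℚ.- q)
int-- (a , refl) (b , refl) = a ℤ.- b , sym (ιℚ-- a b)

int-· : ∀ k {q} → IsInt q → IsInt (ιℚ k ℚ.* q)
int-· k (a , refl) = k ℤ.* a , sym (ιℚ-* k a)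

int? : ∀ q → Dec (IsInt q)
int? q with denominator q
... | m , m≢0 , z , p with m Signed.∣? z
...   | yes (Signed.divides w eq) = yes (w , ℚ-cancel m≢0 (trans p (trans (cong ιℚ (trans eq (ℤₚ.*-comm w m))) (ιℚ-* m w))))
...   | no m∤z = no λ (w , q≡w) → m∤z (Signed.divides w (ιℚ-injective (trans (sym p) (trans (cong (ιℚ m ℚ.*_) q≡w) (trans (sym (ιℚ-* m w)) (cong ιℚ (ℤₚ.*-comm m w)))))))

halveℤ : ∀ a → (∃[ w ] a ≡ w ℤ.+ w) ⊎ (∃[ w ] a ≡ + 1 ℤ.+ (w ℤ.+ w))
halveℤ (+ n) with halve n
... | inj₁ (w , p) = inj₁ (+ w , cong +_ p)
... | inj₂ (w , p) = inj₂ (+ w , cong +_ p)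
halveℤ -[1+ n ] with halve n
... | inj₁ (w , p) = inj₂ (-[1+ w ] , trans (cong -[1+_] p) (h (+ w)))
  where
  h : ∀ w → ℤ.- (+ 1 ℤ.+ (w ℤ.+ w)) ≡ + 1 ℤ.+ (ℤ.- (+ 1 ℤ.+ w) ℤ.+ ℤ.- (+ 1 ℤ.+ w))
  h = solve-∀
... | inj₂ (w , p) = inj₁ (-[1+ w ] , trans (cong -[1+_] p) (h (+ w)))
  where
  h : ∀ w → ℤ.- (+ 1 ℤ.+ (+ 1 ℤ.+ (w ℤ.+ w))) ≡ ℤ.- (+ 1 ℤ.+ w) ℤ.+ ℤ.- (+ 1 ℤ.+ w)
  h = solve-∀

double-cancel : ∀ {p q} → p ℚ.+ p ≡ q ℚ.+ q → p ≡ q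
double-cancel {p} {q} eq = ℚ-cancel {+ 2} (λ ()) (trans (h p) (trans eq (sym (h q))))
  where
  h : ∀ p → ιℚ (+ 2) ℚ.* p ≡ p ℚ.+ p
  h p = trans (cong (ℚ._* p) (ιℚ-+ (+ 1) (+ 1))) (trans (ℚₚ.*-distribʳ-+ p ℚ.1ℚ ℚ.1ℚ) (cong₂ ℚ._+_ (ℚₚ.*-identityˡ p) (ℚₚ.*-identityˡ p)))

half-odd : ∀ p → ¬ IsInt p → IsInt (p ℚ.+ p) → ∃[ a ] (p ℚ.+ p ≡ ιℚ (+ 1 ℤ.+ (a ℤ.+ a)))
half-odd p ¬int (a , eq) with halveℤ a
... | inj₁ (w , refl) = ⊥-elim (¬int (w , double-cancel (trans eq (ιℚ-+ w w))))
... | inj₂ (w , refl) = w , eq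

-- 2p and 2q are odd integers, so their sum is even.
half-odd-sum : ∀ p q → ¬ IsInt p → IsInt (p ℚ.+ p) → ¬ IsInt q → IsInt (q ℚ.+ q) → IsInt (p ℚ.+ q)
half-odd-sum p q ¬p 2p ¬q 2q with half-odd p ¬p 2p | half-odd q ¬q 2q
... | a , eqa | b , eqb = c , double-cancel (trans (swap p q) (trans (cong₂ ℚ._+_ eqa eqb)
    (trans (sym (ιℚ-+ (+ 1 ℤ.+ (a ℤ.+ a)) (+ 1 ℤ.+ (b ℤ.+ b)))) (trans (cong ιℚ (h a b)) (ιℚ-+ c c)))))
  where
  c = + 1 ℤ.+ (a ℤ.+ b)
  swap : ∀ p q → (p ℚ.+ q) ℚ.+ (p ℚ.+ q) ≡ (p ℚ.+ p) ℚ.+ (q ℚ.+ q)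
  swap = ring-∀ ℚ-ring
  h : ∀ a b → (+ 1 ℤ.+ (a ℤ.+ a)) ℤ.+ (+ 1 ℤ.+ (b ℤ.+ b)) ≡ (+ 1 ℤ.+ (a ℤ.+ b)) ℤ.+ (+ 1 ℤ.+ (a ℤ.+ b))
  h = solve-∀

-- A finite group with a nondegenerate antisymmetric ℚ/ℤ-valued pairing has order k² or 2k²

-- The values are kept in ℚ, where bilinearity holds exactly; only integrality statements pass to
-- ℚ/ℤ.
record Form (d : ℕ) : Set where
  field
    γ : Vecℤ d → Vecℤ d → ℚ
    γ-cong  : ∀ {x x' y y'} → x ≗ℤ x' → y ≗ℤ y' → γ x y ≡ γ x' y'
    γ-subˡ   : ∀ x x' y → γ (x -ℤ x') y ≡ γ x y ℚ.- γ x' y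
    γ-subʳ   : ∀ x y y' → γ x (y -ℤ y') ≡ γ x y ℚ.- γ x y'
    γ-scaleˡ : ∀ c x y → γ (c ·ℤ x) y ≡ ιℚ c ℚ.* γ x y
    γ-scaleʳ : ∀ c x y → γ x (c ·ℤ y) ≡ ιℚ c ℚ.* γ x y

-- The quotient H/R of a subgroup H by the radical R of the form restricted to H.
record Nondegenerate {d : ℕ} (Φ : Form d) (H R : Vecℤ d → Set) : Set where
  open Form Φ
  field
    sH : Sub H
    sR : Sub R
    R⊆H : R ⊆ H
    H? : ∀ x → Dec (H x)
    R? : ∀ x → Dec (R x)
    antisymmetric : ∀ {x y} → H x → H y → IsInt (γ x y ℚ.+ γ y x)
    radical⇒ : ∀ {x y} → R x → H y → IsInt (γ x y)
    radical⇐ : ∀ {x} → H x → (∀ {y} → H y → IsInt (γ x y)) → R x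

  radicalʳ : ∀ {x y} → H x → R y → IsInt (γ x y)
  radicalʳ {x} {y} hx ry = int-≡ (h (γ x y) (γ y x)) (int-- (antisymmetric hx (R⊆H ry)) (radical⇒ ry hx))
    where
    h : ∀ a b → (a ℚ.+ b) ℚ.- b ≡ a
    h = ring-∀ ℚ-ring

  int-class : ∀ {x y z} → H x → R (y -ℤ z) → IsInt (γ x z) → IsInt (γ x y)
  int-class {x} {y} {z} hx r i = int-≡ (trans (cong (ℚ._+ γ x z) (γ-subʳ x y z)) (h (γ x y) (γ x z))) (int-+ (radicalʳ hx r) i)
    where
    h : ∀ a b → (a ℚ.- b) ℚ.+ b ≡ a
    h = ring-∀ ℚ-ring

  int-classˡ : ∀ {x y z} → H x → R (y -ℤ z) → IsInt (γ z x) → IsInt (γ y x)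
  int-classˡ {x} {y} {z} hx r i = int-≡ (trans (cong (ℚ._+ γ z x) (γ-subˡ y z x)) (h (γ y x) (γ z x))) (int-+ (radical⇒ r hx) i)
    where
    h : ∀ a b → (a ℚ.- b) ℚ.+ b ≡ a
    h = ring-∀ ℚ-ring

module Isotropic {d : ℕ} {Φ : Form d} {H R : Vecℤ d → Set} (nd : Nondegenerate Φ H R) {n : ℕ} (idx : Index H R n)
    (q : ℕ) (pr : Prime q) (x : Vecℤ d) (Hx : H x) (¬Rx : ¬ R x) (Rqx : R ((+ q) ·ℤ x)) (iso : IsInt (Form.γ Φ x x)) where
  open Form Φ
  open Nondegenerate nd

  q≢0 : + q ≢ + 0
  q≢0 z = ℕ.≢-nonZero⁻¹ q {{prime⇒nonZero pr}} (ℤₚ.+-injective z)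

  instance
    q-nz : ℕ.NonZero q
    q-nz = prime⇒nonZero pr

  value : ∀ y → H y → IsInt (ιℚ (+ q) ℚ.* γ x y)
  value y hy = int-≡ (γ-scaleˡ (+ q) x y) (radical⇒ Rqx hy)

  -- The integer q γ(x, y): since q x is in the radical, γ(x, -) takes values in (1/q)ℤ, and y is
  -- orthogonal to x exactly if q divides this integer.
  val : ∀ y → H y → ℤ
  val y hy = proj₁ (value y hy)

  val-spec : ∀ y hy → ιℚ (+ q) ℚ.* γ x y ≡ ιℚ (val y hy)
  val-spec y hy = proj₂ (value y hy)

  val⇒int : ∀ y hy → + q Signed.∣ val y hy → IsInt (γ x y)
  val⇒int y hy (Signed.divides w eq) = w , ℚ-cancel q≢0 (trans (val-spec y hy) (trans (cong ιℚ (trans eq (ℤₚ.*-comm w (+ q)))) (ιℚ-* (+ q) w)))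

  int⇒val : ∀ y hy → IsInt (γ x y) → + q Signed.∣ val y hy
  int⇒val y hy (w , eq) = Signed.divides w (ιℚ-injective (trans (sym (val-spec y hy)) (trans (cong (ιℚ (+ q) ℚ.*_) eq)
    (trans (sym (ιℚ-* (+ q) w)) (cong ιℚ (ℤₚ.*-comm (+ q) w))))))

  val-sub : ∀ y z hy hz hyz → val (y -ℤ z) hyz ≡ val y hy ℤ.- val z hz
  val-sub y z hy hz hyz = ιℚ-injective (trans (sym (val-spec (y -ℤ z) hyz)) (trans (cong (ιℚ (+ q) ℚ.*_) (γ-subʳ x y z))
    (trans (h (ιℚ (+ q)) (γ x y) (γ x z)) (trans (cong₂ ℚ._-_ (val-spec y hy) (val-spec z hz)) (sym (ιℚ-- (val y hy) (val z hz)))))))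
    where
    h : ∀ a b c → a ℚ.* (b ℚ.- c) ≡ a ℚ.* b ℚ.- a ℚ.* c
    h = ring-∀ ℚ-ring

  val-scale : ∀ c y hy hcy → val (c ·ℤ y) hcy ≡ c ℤ.* val y hy
  val-scale c y hy hcy = ιℚ-injective (trans (sym (val-spec (c ·ℤ y) hcy)) (trans (cong (ιℚ (+ q) ℚ.*_) (γ-scaleʳ c x y))
    (trans (h (ιℚ (+ q)) (ιℚ c) (γ x y)) (trans (cong (ιℚ c ℚ.*_) (val-spec y hy)) (sym (ιℚ-* c (val y hy)))))))
    where
    h : ∀ a b c → a ℚ.* (b ℚ.* c) ≡ b ℚ.* (a ℚ.* c)
    h = ring-∀ ℚ-ring

  Partner : Set
  Partner = ∃[ y ] Σ (H y) λ hy → ∃[ z ] (val y hy ≡ + 1 ℤ.- + q ℤ.* z)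

  scaleTo1 : ∀ y hy → ∃[ s ] ∃[ t ] (val y hy ℤ.* s ℤ.+ + q ℤ.* t ≡ + 1) → Partner
  scaleTo1 y hy (s , t , eq) = (s ·ℤ y) , ·∈ sH s hy , t ,
      trans (val-scale s y hy (·∈ sH s hy)) (trans (h s (val y hy) (+ q) t) (cong (ℤ._- + q ℤ.* t) eq))
    where
    h : ∀ s v q t → s ℤ.* v ≡ (v ℤ.* s ℤ.+ q ℤ.* t) ℤ.- q ℤ.* t
    h = solve-∀

  rep : ∀ y → H y → Vecℤ d
  rep y hy = proj₁ (to idx (from idx (y , hy)))

  decideInt : ∀ i → Dec (IsInt (γ x (proj₁ (to idx i))))
  decideInt i = int? (γ x (proj₁ (to idx i)))

  -- As x is not in the radical, some representative y pairs with it non-integrally. Then `val` of y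
  -- is prime to q and a multiple of y has `val` congruent to 1. If no representative did so, x
  -- would be in the radical.
  search : Dec (∃[ i ] ¬ IsInt (γ x (proj₁ (to idx i)))) → Partner
  search (yes (i , ¬int)) = scaleTo1 y hy (inverse-mod-prime pr (val y hy) (λ d → ¬int (val⇒int y hy d)))
    where
    y = proj₁ (to idx i)
    hy = proj₂ (to idx i)
  search (no none) = ⊥-elim (¬Rx (radical⇐ Hx (λ {y} hy → int-class {x} {y} {rep y hy} Hx
      (swap∈ sR (rep y hy) y (to-from idx (y , hy))) (stable? (from idx (y , hy)) (decideInt (from idx (y , hy)))))))
    where
    stable? : ∀ i → Dec (IsInt (γ x (proj₁ (to idx i)))) → IsInt (γ x (proj₁ (to idx i)))
    stable? i (yes p) = p
    stable? i (no ¬p) = ⊥-elim (none (i , ¬p))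

  partner : Partner
  partner = search (Finₚ.any? (λ i → ¬? (decideInt i)))

  y₁ : Vecℤ d
  y₁ = proj₁ partner
  hy₁ : H y₁
  hy₁ = proj₁ (proj₂ partner)
  z₁ : ℤ
  z₁ = proj₁ (proj₂ (proj₂ partner))
  val-y₁ : val y₁ hy₁ ≡ + 1 ℤ.- + q ℤ.* z₁
  val-y₁ = proj₂ (proj₂ (proj₂ partner))

  H′ R′ : Vecℤ d → Set
  H′ y = H y × IsInt (γ x y)
  R′ y = H y × ∃[ m ] R (y -ℤ (m ·ℤ x))

  sH′ : Sub H′
  sH′ = record
    { ≗∈ = λ p (h , i) → ≗∈ sH p h , int-≡ (γ-cong {x = x} (λ _ → refl) p) i
    ; 0∈ = 0∈ sH , radicalʳ Hx (0∈ sR)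
    ; -∈ = λ {y} {z} (h , i) (h' , i') → -∈ sH h h' , int-≡ (sym (γ-subʳ x y z)) (int-- i i') }

  sR′ : Sub R′
  sR′ = record
    { ≗∈ = λ {y} {z} p (h , m , r) → ≗∈ sH p h , m , ≗∈ sR (-ℤ-cong p (λ _ → refl)) r
    ; 0∈ = 0∈ sH , + 0 , ≗∈ sR (λ i → h₀ (x i)) (0∈ sR)
    ; -∈ = λ {y} {z} (h , m , r) (h' , m' , r') → -∈ sH h h' , (m ℤ.- m') , ≗∈ sR (λ i → h₁ (y i) (z i) m m' (x i)) (-∈ sR r r') }
    where
    h₀ : ∀ x → + 0 ≡ + 0 ℤ.- + 0 ℤ.* x
    h₀ = solve-∀
    h₁ : ∀ y z m m' x → (y ℤ.- m ℤ.* x) ℤ.- (z ℤ.- m' ℤ.* x) ≡ (y ℤ.- z) ℤ.- (m ℤ.- m') ℤ.* x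
    h₁ = solve-∀

  R⊆R′ : R ⊆ R′
  R⊆R′ {y} r = R⊆H r , + 0 , ≗∈ sR (λ i → h (y i) (x i)) r
    where
    h : ∀ y x → y ≡ y ℤ.- + 0 ℤ.* x
    h = solve-∀

  γ-split : ∀ y m w → γ y w ≡ γ (y -ℤ (m ·ℤ x)) w ℚ.+ ιℚ m ℚ.* γ x w
  γ-split y m w = trans (h (γ y w) (ιℚ m ℚ.* γ x w)) (cong (ℚ._+ ιℚ m ℚ.* γ x w)
    (trans (cong (λ z → γ y w ℚ.- z) (sym (γ-scaleˡ m x w))) (sym (γ-subˡ y (m ·ℤ x) w))))
    where
    h : ∀ a b → a ≡ (a ℚ.- b) ℚ.+ b
    h = ring-∀ ℚ-ring

  R′⊆H′ : R′ ⊆ H′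
  R′⊆H′ {y} (h , m , r) = h , int-class {x} {y} {m ·ℤ x} Hx r (int-≡ (sym (γ-scaleʳ m x x)) (int-· m iso))

  R⊆H′ : R ⊆ H′
  R⊆H′ r = R′⊆H′ (R⊆R′ r)

  H′? : ∀ y → Dec (H′ y)
  H′? y = H? y ×-dec int? (γ x y)

  order : ∀ m → R (m ·ℤ x) → + q Signed.∣ m
  order m r with + q Signed.∣? m
  ... | yes p = p
  ... | no ¬p with inverse-mod-prime pr m ¬p
  ...   | s , t , eq = ⊥-elim (¬Rx (≗∈ sR (λ i → trans (h m s (+ q) t (x i)) (trans (cong (ℤ._* x i) eq) (ℤₚ.*-identityˡ (x i)))) (+∈ sR (·∈ sR s r) (·∈ sR t Rqx))))
    where
    h : ∀ m s q t x → s ℤ.* (m ℤ.* x) ℤ.+ t ℤ.* (q ℤ.* x) ≡ (m ℤ.* s ℤ.+ q ℤ.* t) ℤ.* x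
    h = solve-∀

  multiple∈R : ∀ m → + q Signed.∣ m → R (m ·ℤ x)
  multiple∈R m (Signed.divides w eq) = ≗∈ sR (λ i → trans (sym (ℤₚ.*-assoc w (+ q) (x i))) (cong (ℤ._* x i) (sym eq))) (·∈ sR w Rqx)

  R′? : ∀ y → Dec (R′ y)
  R′? y = map′ (λ (h , i , r) → h , + toℕ i , r) (λ (h , m , r) → h , resid m q ,
      ≗∈ sR (λ i → h₂ (y i) m (+ toℕ (resid m q)) (x i)) (-∈ sR r (multiple∈R (+ toℕ (resid m q) ℤ.- m) (resid-cong m q))))
      (H? y ×-dec Finₚ.any? (λ i → R? (y -ℤ ((+ toℕ i) ·ℤ x))))
    where
    h₂ : ∀ y m k x → (y ℤ.- m ℤ.* x) ℤ.- (k ℤ.- m) ℤ.* x ≡ y ℤ.- k ℤ.* x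
    h₂ = solve-∀

  index-H-H′ : Index H H′ q
  index-H-H′ = record
    { to = λ i → ((+ toℕ i) ·ℤ y₁) , ·∈ sH (+ toℕ i) hy₁
    ; from = λ (y , hy) → resid (val y hy) q
    ; from-resp = λ { {y , hy} {z , hz} (h , i) → resid-resp q (val y hy) (val z hz) (subst (+ q Signed.∣_) (val-sub y z hy hz h) (int⇒val (y -ℤ z) h i)) }
    ; from-to = λ i → trans (resid-resp q (val ((+ toℕ i) ·ℤ y₁) (·∈ sH (+ toℕ i) hy₁)) (+ toℕ i) (near (+ toℕ i) _)) (resid-to q i)
    ; to-from = λ (y , hy) → let k = + toℕ (resid (val y hy) q) ; hk = ·∈ sH k hy₁ ; hd = -∈ sH hk hy in
        hd , val⇒int ((k ·ℤ y₁) -ℤ y) hd (subst (+ q Signed.∣_) (sym (val-sub (k ·ℤ y₁) y hk hy hd))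
          (subst (+ q Signed.∣_) (h (val (k ·ℤ y₁) hk) k (val y hy)) (Signed.∣m∣n⇒∣m+n (near k hk) (resid-cong (val y hy) q)))) }
    where
    h : ∀ a k v → (a ℤ.- k) ℤ.+ (k ℤ.- v) ≡ a ℤ.- v
    h = solve-∀
    h′ : ∀ k q z → k ℤ.* (+ 1 ℤ.- q ℤ.* z) ℤ.- k ≡ (ℤ.- (k ℤ.* z)) ℤ.* q
    h′ = solve-∀
    near : ∀ k hk → + q Signed.∣ (val (k ·ℤ y₁) hk ℤ.- k)
    near k hk = Signed.divides (ℤ.- (k ℤ.* z₁)) (trans (cong (ℤ._- k) (trans (val-scale k y₁ hy₁ hk) (cong (k ℤ.*_) val-y₁))) (h′ k (+ q) z₁))

  index-R′-R : Index R′ R q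
  index-R′-R = record
    { to = λ i → ((+ toℕ i) ·ℤ x) , ·∈ sH (+ toℕ i) Hx , + toℕ i , refl∈ sR ((+ toℕ i) ·ℤ x) ((+ toℕ i) ·ℤ x) (λ _ → refl)
    ; from = λ (y , _ , m , _) → resid m q
    ; from-resp = λ { {y , _ , m , r} {z , _ , m' , r'} p → resid-resp q m m' (order (m ℤ.- m')
        (≗∈ sR (λ i → h₁ (y i) (z i) m m' (x i)) (-∈ sR p (-∈ sR r r')))) }
    ; from-to = resid-to q
    ; to-from = λ (y , _ , m , r) → ≗∈ sR (λ i → h₂ (y i) m (+ toℕ (resid m q)) (x i))
        (-∈ sR (multiple∈R (+ toℕ (resid m q) ℤ.- m) (resid-cong m q)) r) }
    where
    h₁ : ∀ y z m m' x → (y ℤ.- z) ℤ.- ((y ℤ.- m ℤ.* x) ℤ.- (z ℤ.- m' ℤ.* x)) ≡ (m ℤ.- m') ℤ.* x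
    h₁ = solve-∀
    h₂ : ∀ y m k x → (k ℤ.- m) ℤ.* x ℤ.- (y ℤ.- m ℤ.* x) ≡ k ℤ.* x ℤ.- y
    h₂ = solve-∀

  reduced : Nondegenerate Φ H′ R′
  reduced = record
    { sH = sH′ ; sR = sR′ ; R⊆H = R′⊆H′ ; H? = H′? ; R? = R′?
    ; antisymmetric = λ (h , _) (h' , _) → antisymmetric h h'
    ; radical⇒ = λ {y} {w} (h , m , r) (hw , i) → int-≡ (sym (γ-split y m w)) (int-+ (radical⇒ r hw) (int-· m i))
    ; radical⇐ = λ {y} hy ort → rad y hy ort }
    where
    -- The vector q y₁ lies in H′, so γ(y, y₁) = m/q for an integer m, which agrees with m γ(x, y₁)
    -- modulo ℤ. Hence y - m x is integral on H′ and on y₁; these generate H, so y - m x lies in R.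
    rad : ∀ y → H′ y → (∀ {w} → H′ w → IsInt (γ y w)) → R′ y
    rad y (hy , iy) ort = hy , m , radical⇐ (-∈ sH hy (·∈ sH m Hx)) (λ {w} hw → pairs w hw)
      where
      qy₁ : H′ ((+ q) ·ℤ y₁)
      qy₁ = ·∈ sH (+ q) hy₁ , int-≡ (sym (γ-scaleʳ (+ q) x y₁)) (value y₁ hy₁)
      multiple : IsInt (ιℚ (+ q) ℚ.* γ y y₁)
      multiple = int-≡ (γ-scaleʳ (+ q) y y₁) (ort qy₁)
      m = proj₁ multiple
      y″ = y -ℤ (m ·ℤ x)
      h₃ : ∀ a b c → a ≡ (b ℚ.+ c) → b ≡ a ℚ.- c
      h₃ a b c refl = h b c
        where
        h : ∀ b c → b ≡ (b ℚ.+ c) ℚ.- c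
        h = ring-∀ ℚ-ring
      γy″ : ∀ w → γ y″ w ≡ γ y w ℚ.- ιℚ m ℚ.* γ x w
      γy″ w = h₃ (γ y w) (γ y″ w) (ιℚ m ℚ.* γ x w) (γ-split y m w)
      onH′ : ∀ w → H′ w → IsInt (γ y″ w)
      onH′ w hw = int-≡ (sym (γy″ w)) (int-- (ort hw) (int-· m (proj₂ hw)))
      onY₁ : IsInt (γ y″ y₁)
      onY₁ = m ℤ.* z₁ , ℚ-cancel q≢0 (trans (cong (ιℚ (+ q) ℚ.*_) (γy″ y₁)) (trans (dist (ιℚ (+ q)) (γ y y₁) (ιℚ m) (γ x y₁))
          (trans (cong₂ (λ a b → a ℚ.- ιℚ m ℚ.* b) (proj₂ multiple) (trans (val-spec y₁ hy₁) (cong ιℚ val-y₁)))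
            (trans (cong (λ z → ιℚ m ℚ.- z) (sym (ιℚ-* m (+ 1 ℤ.- + q ℤ.* z₁)))) (trans (sym (ιℚ-- m (m ℤ.* (+ 1 ℤ.- + q ℤ.* z₁))))
              (trans (cong ιℚ (arith m (+ q) z₁)) (ιℚ-* (+ q) (m ℤ.* z₁))))))))
        where
        dist : ∀ q a m b → q ℚ.* (a ℚ.- m ℚ.* b) ≡ q ℚ.* a ℚ.- m ℚ.* (q ℚ.* b)
        dist = ring-∀ ℚ-ring
        arith : ∀ m q z → m ℤ.- m ℤ.* (+ 1 ℤ.- q ℤ.* z) ≡ q ℤ.* (m ℤ.* z)
        arith = solve-∀
      pairs : ∀ w → H w → IsInt (γ y″ w)
      pairs w hw = int-≡ (trans (cong₂ ℚ._+_ (γ-subʳ y″ w (k ·ℤ y₁)) (sym (γ-scaleʳ k y″ y₁))) (h (γ y″ w) (γ y″ (k ·ℤ y₁))))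
          (int-+ (onH′ (w -ℤ (k ·ℤ y₁)) w′∈) (int-· k onY₁))
        where
        k = val w hw
        hk = ·∈ sH k hy₁
        hd = -∈ sH hw hk
        h : ∀ a b → (a ℚ.- b) ℚ.+ b ≡ a
        h = ring-∀ ℚ-ring
        arith : ∀ k q z → k ℤ.- k ℤ.* (+ 1 ℤ.- q ℤ.* z) ≡ (k ℤ.* z) ℤ.* q
        arith = solve-∀
        w′∈ : H′ (w -ℤ (k ·ℤ y₁))
        w′∈ = hd , val⇒int (w -ℤ (k ·ℤ y₁)) hd (Signed.divides (k ℤ.* z₁) (trans (val-sub w (k ·ℤ y₁) hw hk hd)
          (trans (cong (λ z → k ℤ.- z) (trans (val-scale k y₁ hy₁ hk) (cong (k ℤ.*_) val-y₁))) (arith k (+ q) z₁))))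

  split-H′ : ∃[ a ] ∃[ b ] (Index H H′ a × Index H′ R b × n ≡ a ℕ.* b)
  split-H′ = index-split sH sH′ sR R⊆H′ proj₁ H′? idx

  split-R′ : ∃[ a ] ∃[ b ] (Index H′ R′ a × Index R′ R b × proj₁ (proj₂ split-H′) ≡ a ℕ.* b)
  split-R′ = index-split sH′ sR′ sR R⊆R′ R′⊆H′ R′? (proj₁ (proj₂ (proj₂ (proj₂ split-H′))))

  index-H′-R′ : ∃[ c ] (Index H′ R′ c × n ≡ q ℕ.* (c ℕ.* q))
  index-H′-R′ = proj₁ split-R′ , proj₁ (proj₂ (proj₂ split-R′)) , trans (proj₂ (proj₂ (proj₂ (proj₂ split-H′))))
    (cong₂ ℕ._*_ (index-unique {H = H} {H′} sH′ (proj₁ (proj₂ (proj₂ split-H′))) index-H-H′)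
      (trans (proj₂ (proj₂ (proj₂ (proj₂ split-R′)))) (cong (proj₁ split-R′ ℕ.*_)
        (index-unique {H = R′} {R} sR (proj₁ (proj₂ (proj₂ (proj₂ split-R′)))) index-R′-R))))

-- Prime factors are removed from N one at a time; at the first removal that leaves a multiple of x
-- outside R, this multiple has the removed prime as its order.
prime-order : {d : ℕ} {R : Vecℤ d → Set} → Sub R → (∀ x → Dec (R x)) → (x : Vecℤ d) → ¬ R x → (N : ℕ) → N ≢ 0 → R ((+ N) ·ℤ x) →
              ∃[ q ] (Prime q × ∃[ m ] (¬ R ((+ m) ·ℤ x) × R ((+ q) ·ℤ ((+ m) ·ℤ x))))
prime-order {R = R} sR R? x ¬Rx N N≢0 RN = go (factors fac) (factorsPrime fac) (subst (λ k → R ((+ k) ·ℤ x)) (isFactorisation fac) RN)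
  where
  open PrimeFactorisation
  fac = factorise N {{ℕ.≢-nonZero N≢0}}
  go : ∀ qs → ListAll.All Prime qs → R ((+ product qs) ·ℤ x) → _
  go []       []         r = ⊥-elim (¬Rx (≗∈ sR (λ i → ℤₚ.*-identityˡ (x i)) r))
  go (q ∷ qs) (pq ∷ pqs) r with R? ((+ product qs) ·ℤ x)
  ... | yes r' = go qs pqs r'
  ... | no ¬r' = q , pq , product qs , ¬r' , ≗∈ sR (λ i → trans (cong (ℤ._* x i) (ℤₚ.pos-* q (product qs))) (ℤₚ.*-assoc (+ q) (+ product qs) (x i))) r

-- Among the n + 1 multiples 0, x, ..., n x two agree modulo R; N is the difference of their
-- coefficients.
finite-order : {d : ℕ} {H R : Vecℤ d → Set} → Sub H → Sub R → {n : ℕ} → Index H R n → (x : Vecℤ d) → H x → ∃[ N ] (N ≢ 0 × R ((+ N) ·ℤ x))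
finite-order {R = R} sH sR {n} idx x hx with Finₚ.pigeonhole (ℕₚ.n<1+n n) (λ i → from idx (((+ toℕ i) ·ℤ x) , ·∈ sH (+ toℕ i) hx))
... | i , j , i<j , eq = toℕ j ℕ.∸ toℕ i , (λ z → ℕₚ.<⇒≱ i<j (ℕₚ.m∸n≡0⇒m≤n z)) ,
    ≗∈ sR (λ k → trans (h (+ toℕ j) (+ toℕ i) (x k)) (cong (ℤ._* x k) (trans (ℤₚ.m-n≡m⊖n (toℕ j) (toℕ i)) (ℤₚ.⊖-≥ (ℕₚ.<⇒≤ i<j)))))
      (trans∈ sR ((+ toℕ j) ·ℤ x) t ((+ toℕ i) ·ℤ x) (swap∈ sR t ((+ toℕ j) ·ℤ x)
        (subst (λ k → R (proj₁ (to idx k) -ℤ ((+ toℕ j) ·ℤ x))) (sym eq) (to-from idx (((+ toℕ j) ·ℤ x) , ·∈ sH (+ toℕ j) hx))))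
        (to-from idx (((+ toℕ i) ·ℤ x) , ·∈ sH (+ toℕ i) hx)))
  where
  t = proj₁ (to idx (from idx (((+ toℕ i) ·ℤ x) , ·∈ sH (+ toℕ i) hx)))
  h : ∀ a b x → a ℤ.* x ℤ.- b ℤ.* x ≡ (a ℤ.- b) ℤ.* x
  h = solve-∀

-- Antisymmetry makes 2γ(x, x) integral, so γ(x, x) is 1/2 modulo ℤ whenever x is outside R. For two
-- such x and y the value at x - y is then integral, so x and y lie in one class: at most one class
-- is nonzero.
anisotropic⇒small : {d : ℕ} {Φ : Form d} {H R : Vecℤ d → Set} → Nondegenerate Φ H R → (n : ℕ) → Index H R n →
                    (∀ x → H x → IsInt (Form.γ Φ x x) → R x) → IsSqOr2Sq n
anisotropic⇒small {Φ = Φ} {H} {R} nd n idx aniso = small n idx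
  where
  open Form Φ
  open Nondegenerate nd
  close : ∀ {x y} → H x → H y → ¬ R x → ¬ R y → R (x -ℤ y)
  close {x} {y} hx hy ¬rx ¬ry = aniso (x -ℤ y) (-∈ sH hx hy) (int-≡ (sym expand)
      (int-- (half-odd-sum (γ x x) (γ y y) (¬rx ∘ aniso x hx) (antisymmetric hx hx) (¬ry ∘ aniso y hy) (antisymmetric hy hy)) (antisymmetric hx hy)))
    where
    h : ∀ a b c d → (a ℚ.- b) ℚ.- (c ℚ.- d) ≡ (a ℚ.+ d) ℚ.- (b ℚ.+ c)
    h = ring-∀ ℚ-ring
    expand : γ (x -ℤ y) (x -ℤ y) ≡ (γ x x ℚ.+ γ y y) ℚ.- (γ x y ℚ.+ γ y x)
    expand = trans (γ-subˡ x y (x -ℤ y)) (trans (cong₂ ℚ._-_ (γ-subʳ x x y) (γ-subʳ y x y)) (h (γ x x) (γ x y) (γ y x) (γ y y)))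
  small : ∀ n → Index H R n → IsSqOr2Sq n
  small 0 _ = 0 , inj₁ refl
  small 1 _ = 1 , inj₁ refl
  small 2 _ = 1 , inj₂ refl
  small (suc (suc (suc n))) idx = ⊥-elim (three (R? (v zero)) (R? (v (suc zero))) (R? (v (suc (suc zero)))))
    where
    v : Fin (suc (suc (suc n))) → Vecℤ _
    v i = proj₁ (to idx i)
    apart : ∀ {i j} → i ≢ j → ¬ R (v i -ℤ v j)
    apart {i} {j} i≢j r = i≢j (trans (sym (from-to idx i)) (trans (from-resp idx r) (from-to idx j)))
    both : ∀ {i j} → i ≢ j → ¬ R (v i) → ¬ R (v j) → ⊥
    both {i} {j} i≢j a b = apart i≢j (close (proj₂ (to idx i)) (proj₂ (to idx j)) a b)
    three : Dec (R (v zero)) → Dec (R (v (suc zero))) → Dec (R (v (suc (suc zero)))) → ⊥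
    three (yes a) (yes b) _       = apart (λ ()) (-∈ sR a b)
    three (yes a) (no b)  (yes c) = apart (λ ()) (-∈ sR a c)
    three (yes a) (no b)  (no c)  = both (λ ()) b c
    three (no a)  (no b)  _       = both (λ ()) a b
    three (no a)  (yes b) (yes c) = apart (λ ()) (-∈ sR b c)
    three (no a)  (yes b) (no c)  = both (λ ()) a c

square-order : {d : ℕ} {Φ : Form d} {H R : Vecℤ d → Set} → Nondegenerate Φ H R → (n : ℕ) → Index H R n → Acc ℕ._<_ n → IsSqOr2Sq n
square-order {Φ = Φ} {H} {R} nd n idx (acc rec)
  = byCases (Finₚ.any? (λ i → ¬? (R? (proj₁ (to idx i))) ×-dec int? (γ (proj₁ (to idx i)) (proj₁ (to idx i)))))
  where
  open Form Φ
  open Nondegenerate nd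
  Witness : Set
  Witness = ∃[ i ] (¬ R (proj₁ (to idx i)) × IsInt (γ (proj₁ (to idx i)) (proj₁ (to idx i))))
  -- Integrality of γ(x, x) depends only on the class of x modulo R, so searching the
  -- representatives is exhaustive.
  decide : ¬ Witness → ∀ x → H x → IsInt (γ x x) → Dec (R x) → R x
  decide none x hx i (yes r) = r
  decide none x hx i (no ¬r) = ⊥-elim (none (from idx (x , hx) , (λ rw → ¬r (back∈ sR x w (swap∈ sR w x w-x) rw)) ,
      int-class {w} {w} {x} hw w-x (int-classˡ {x} {w} {x} hx w-x i)))
    where
    w = proj₁ (to idx (from idx (x , hx)))
    hw = proj₂ (to idx (from idx (x , hx)))
    w-x : R (w -ℤ x)
    w-x = to-from idx (x , hx)
  module Reduce (i : Fin n) (¬rx : ¬ R (proj₁ (to idx i))) (iso : IsInt (γ (proj₁ (to idx i)) (proj₁ (to idx i)))) where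
    x = proj₁ (to idx i)
    hx = proj₂ (to idx i)
    ord = finite-order sH sR idx x hx
    po = prime-order sR R? x ¬rx (proj₁ ord) (proj₁ (proj₂ ord)) (proj₂ (proj₂ ord))
    q = proj₁ po
    pr = proj₁ (proj₂ po)
    m = proj₁ (proj₂ (proj₂ po))
    -- The multiple of prime order stays isotropic: γ(m x, m x) = m² γ(x, x).
    x′ = (+ m) ·ℤ x
    red = Isotropic.index-H′-R′ nd idx q pr x′ (·∈ sH (+ m) hx) (proj₁ (proj₂ (proj₂ (proj₂ po)))) (proj₂ (proj₂ (proj₂ (proj₂ po))))
      (int-≡ (sym (trans (γ-scaleˡ (+ m) x x′) (cong (ιℚ (+ m) ℚ.*_) (γ-scaleʳ (+ m) x x)))) (int-· (+ m) (int-· (+ m) iso)))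
    nd′ = Isotropic.reduced nd idx q pr x′ (·∈ sH (+ m) hx) (proj₁ (proj₂ (proj₂ (proj₂ po)))) (proj₂ (proj₂ (proj₂ (proj₂ po))))
      (int-≡ (sym (trans (γ-scaleˡ (+ m) x x′) (cong (ιℚ (+ m) ℚ.*_) (γ-scaleʳ (+ m) x x)))) (int-· (+ m) (int-· (+ m) iso)))
    c = proj₁ red
    n≡ : n ≡ q ℕ.* (c ℕ.* q)
    n≡ = proj₂ (proj₂ red)
    c≢0 : c ≢ 0
    c≢0 z = index-positive {H = H} {R} sH idx (trans n≡ (trans (cong (λ k → q ℕ.* (k ℕ.* q)) z) (ℕₚ.*-zeroʳ q)))
    c<n : c ℕ.< n
    c<n = subst (c ℕ.<_) (sym n≡) (ℕₚ.<-≤-trans (ℕₚ.m<m*n c q {{ℕ.≢-nonZero c≢0}} (ℕ.nonTrivial⇒n>1 q {{prime⇒nonTrivial pr}}))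
      (ℕₚ.m≤n*m (c ℕ.* q) q {{prime⇒nonZero pr}}))
    enlarge : IsSqOr2Sq c → IsSqOr2Sq n
    enlarge (k , inj₁ p) = q ℕ.* k , inj₁ (trans n≡ (trans (cong (λ z → q ℕ.* (z ℕ.* q)) p) (h q k)))
      where
      h : ∀ q k → q ℕ.* ((k ℕ.* k) ℕ.* q) ≡ (q ℕ.* k) ℕ.* (q ℕ.* k)
      h = ℕ-solve-∀
    enlarge (k , inj₂ p) = q ℕ.* k , inj₂ (trans n≡ (trans (cong (λ z → q ℕ.* (z ℕ.* q)) p) (h q k)))
      where
      h : ∀ q k → q ℕ.* ((2 ℕ.* (k ℕ.* k)) ℕ.* q) ≡ 2 ℕ.* ((q ℕ.* k) ℕ.* (q ℕ.* k))
      h = ℕ-solve-∀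
    finish : IsSqOr2Sq n
    finish = enlarge (square-order nd′ c (proj₁ (proj₂ red)) (rec c<n))
  byCases : Dec Witness → IsSqOr2Sq n
  byCases (yes (i , ¬rx , iso)) = Reduce.finish i ¬rx iso
  byCases (no none) = anisotropic⇒small nd n idx (λ x hx i → decide none x hx i (R? x))

-- The self-dual case

-- The result mentions its argument only through finitely many rational values, so pointwise
-- equality of the arguments gives propositional equality of the resulting functions.
mvℚ-≡ : {d n : ℕ} (M : Fin d → Fin n → ℤ) {u v : Vecℚ n} → u ≗ℚ v →
        (λ i → Sumℚ.sum n (λ j → ιℚ (M i j) ℚ.* u j)) ≡ (λ i → Sumℚ.sum n (λ j → ιℚ (M i j) ℚ.* v j))
mvℚ-≡ {n = zero}  M p = refl
mvℚ-≡ {n = suc n} M p = cong₂ (λ c w i → ιℚ (M i zero) ℚ.* c ℚ.+ w i) (p zero) (mvℚ-≡ (λ i j → M i (suc j)) (p ∘ suc))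

expandℚ : {n : ℕ} (f : Vecℤ n → ℚ) → (∀ {x y} → x ≗ℤ y → f x ≡ f y) → (∀ x y → f (x +ℤ y) ≡ f x ℚ.+ f y) →
          (∀ c x → f (c ·ℤ x) ≡ ιℚ c ℚ.* f x) → ∀ x → f x ≡ Sumℚ.sum n (λ j → ιℚ (x j) ℚ.* f (e j))
expandℚ {zero}  f cg ad sc x = trans (cg {x} {(+ 0) ·ℤ x} (λ ())) (trans (sc (+ 0) x) (ℚₚ.*-zeroˡ (f x)))
expandℚ {suc n} f cg ad sc x = trans (cg split) (trans (ad (x zero ·ℤ e zero) (+ 0 ◂ (x ∘ suc))) (cong₂ ℚ._+_ (sc (x zero) (e zero))
  (trans (expandℚ (λ y → f (+ 0 ◂ y)) (λ p → cg (λ { zero → refl ; (suc i) → p i })) (λ y z → trans (cg (fadd consˡ y z)) (ad _ _))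
      (λ c y → trans (cg (fscale consˡ c y)) (sc c _)) (x ∘ suc))
    (Sumℚ.sum-cong n (λ j → cong (ιℚ (x (suc j)) ℚ.*_) (cg (λ { zero → refl ; (suc k) → refl })))))))
  where
  split : x ≗ℤ ((x zero ·ℤ e zero) +ℤ (+ 0 ◂ (x ∘ suc)))
  split zero    = sym (trans (ℤₚ.+-identityʳ _) (ℤₚ.*-identityʳ (x zero)))
  split (suc k) = sym (trans (cong (ℤ._+ x (suc k)) (ℤₚ.*-zeroʳ (x zero))) (ℤₚ.+-identityˡ (x (suc k))))

module Pairing {d : ℕ} (F B : Mat d) (setup : Setup F B)
    (b : Vecℚ d → Vecℚ d → ℚ) (good : Setting.GoodPairing F B b) (dual : Setting.IsDual F B b) where

  open Integral F B setup
  open Quotients F B setup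
  open Rational F hiding (A)
  open Setting F B
  open GoodPairing good

  -- No function extensionality: b respects pointwise equality because F u is determined by the values of u.
  b-congˡ : ∀ {u u'} v → u ≗ℚ u' → b u v ≡ b u' v
  b-congˡ {u} {u'} v p = trans (sym (Finv u v)) (trans (cong (λ z → b z (mvℚ F v)) (mvℚ-≡ F p)) (Finv u' v))

  b-congʳ : ∀ u {v v'} → v ≗ℚ v' → b u v ≡ b u v'
  b-congʳ u {v} {v'} p = trans (symm u v) (trans (b-congˡ u p) (symm v' u))

  b-addʳ : ∀ u v v' → b u (v +ℚ v') ≡ b u v ℚ.+ b u v'
  b-addʳ u v v' = trans (symm u (v +ℚ v')) (trans (addˡ v v' u) (cong₂ ℚ._+_ (symm v u) (symm v' u)))

  b-scaleʳ : ∀ c u v → b u (c ·ℚ v) ≡ c ℚ.* b u v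
  b-scaleʳ c u v = trans (symm u (c ·ℚ v)) (trans (scaleˡ c v u) (cong (c ℚ.*_) (symm v u)))

  b-subˡ : ∀ u u' v → b (u -ℚ u') v ≡ b u v ℚ.- b u' v
  b-subˡ u u' v = trans (b-congˡ {u -ℚ u'} {u +ℚ (ιℚ -[1+ 0 ] ·ℚ u')} v (λ i → neg1 (u i) (u' i)))
    (trans (addˡ u (ιℚ -[1+ 0 ] ·ℚ u') v) (trans (cong (b u v ℚ.+_) (scaleˡ (ιℚ -[1+ 0 ]) u' v)) (sym (neg1 (b u v) (b u' v)))))

  b-subʳ : ∀ u v v' → b u (v -ℚ v') ≡ b u v ℚ.- b u v'
  b-subʳ u v v' = trans (symm u (v -ℚ v')) (trans (b-subˡ v v' u) (cong₂ ℚ._-_ (symm v u) (symm v' u)))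

  B⟨_,_⟩ : Vecℤ d → Vecℤ d → ℚ
  B⟨ x , y ⟩ = b (ι x) (ι y)

  B-cong : ∀ {x x' y y'} → x ≗ℤ x' → y ≗ℤ y' → B⟨ x , y ⟩ ≡ B⟨ x' , y' ⟩
  B-cong {x} {x'} {y} {y'} p q = trans (b-congˡ (ι y) (ι-cong p)) (b-congʳ (ι x') (ι-cong q))

  B-scaleˡ : ∀ c x y → B⟨ c ·ℤ x , y ⟩ ≡ ιℚ c ℚ.* B⟨ x , y ⟩
  B-scaleˡ c x y = trans (b-congˡ (ι y) (ι-· c x)) (scaleˡ (ιℚ c) (ι x) (ι y))

  B-scaleʳ : ∀ c x y → B⟨ x , c ·ℤ y ⟩ ≡ ιℚ c ℚ.* B⟨ x , y ⟩
  B-scaleʳ c x y = trans (b-congʳ (ι x) (ι-· c y)) (b-scaleʳ (ιℚ c) (ι x) (ι y))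

  B-subˡ : ∀ x x' y → B⟨ x -ℤ x' , y ⟩ ≡ B⟨ x , y ⟩ ℚ.- B⟨ x' , y ⟩
  B-subˡ x x' y = trans (b-congˡ (ι y) (ι-- x x')) (b-subˡ (ι x) (ι x') (ι y))

  B-subʳ : ∀ x y y' → B⟨ x , y -ℤ y' ⟩ ≡ B⟨ x , y ⟩ ℚ.- B⟨ x , y' ⟩
  B-subʳ x y y' = trans (b-congʳ (ι x) (ι-- y y')) (b-subʳ (ι x) (ι y) (ι y'))

  L-int : ∀ {x} → L x → ∀ y → IsInt B⟨ x , y ⟩
  L-int {x} (c , p) y = proj₁ (dual (ι x)) (c , ι-cong p) y

  -- V^F is orthogonal to W = (F − 1)V
  orthogonal : ∀ {a} → FixedV a → ∀ u → b a (AQ u) ≡ ℚ.0ℚ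
  orthogonal {a} p u = trans (b-subʳ a (mvℚ F u) u) (trans (cong (ℚ._- b a u) (trans (b-congˡ (mvℚ F u) (≗ℚ-sym p)) (Finv a u))) (ℚₚ.+-inverseʳ (b a u)))

  orthogonalℤ : ∀ {a} → Fx a → ∀ y → B⟨ fn A y , a ⟩ ≡ ℚ.0ℚ
  orthogonalℤ {a} p y = trans (symm (ι (fn A y)) (ι a)) (trans (b-congʳ (ι a) (≗ℚ-sym (AQ-ι y))) (orthogonal (FixedV-ι a p) (ι y)))

  coE-fixed : ∀ y → Fx (fn coE y)
  coE-fixed y = A0⇒fixed {fn coE y} (A-coE y)

  E-coE : ∀ x y → B⟨ fn E x , fn coE y ⟩ ≡ ℚ.0ℚ
  E-coE x y = orthogonalℤ {fn coE y} (coE-fixed y) (fn P x)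

  -- D y - E y is fixed and E x lies in W, so they are orthogonal. The right-hand side is symmetric
  -- in x and y, whence the self-adjointness of `E`.
  E-E : ∀ x y → ιℚ D ℚ.* B⟨ fn E x , y ⟩ ≡ B⟨ fn E x , fn E y ⟩
  E-E x y = h (ιℚ D ℚ.* B⟨ fn E x , y ⟩) B⟨ fn E x , fn E y ⟩ (trans (cong (ℚ._- B⟨ fn E x , fn E y ⟩) (sym (B-scaleʳ D (fn E x) y)))
      (trans (sym (B-subʳ (fn E x) (D ·ℤ y) (fn E y))) (E-coE x y)))
    where
    h₀ : ∀ p q → p ≡ (p ℚ.- q) ℚ.+ q
    h₀ = ring-∀ ℚ-ring
    h : ∀ p q → p ℚ.- q ≡ ℚ.0ℚ → p ≡ q
    h p q z = trans (h₀ p q) (trans (cong (ℚ._+ q) z) (ℚₚ.+-identityˡ q))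

  E-selfadjoint : ∀ x y → B⟨ fn E x , y ⟩ ≡ B⟨ x , fn E y ⟩
  E-selfadjoint x y = ℚ-cancel D≢0 (trans (E-E x y) (trans (symm (ι (fn E x)) (ι (fn E y))) (trans (sym (E-E y x)) (cong (ιℚ D ℚ.*_) (symm (ι (fn E y)) (ι x))))))

  coE-selfadjoint : ∀ x y → B⟨ fn coE x , y ⟩ ≡ B⟨ x , fn coE y ⟩
  coE-selfadjoint x y = trans (B-subˡ (D ·ℤ x) (fn E x) y) (trans (cong₂ ℚ._-_ (trans (B-scaleˡ D x y) (sym (B-scaleʳ D x y))) (E-selfadjoint x y))
    (sym (B-subʳ x (D ·ℤ y) (fn E y))))

  B-zero : ∀ x → (∀ y → B⟨ x , y ⟩ ≡ ℚ.0ℚ) → x ≗ℤ 0v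
  B-zero x p = ι-inj {x = x} {0v} (nondegen (ι x) all)
    where
    all : ∀ v → b (ι x) v ≡ ℚ.0ℚ
    all v = ℚ-cancel m≢0 (trans (sym (b-scaleʳ (ιℚ m) (ι x) v)) (trans (b-congʳ (ι x) q) (trans (p y) (sym (ℚₚ.*-zeroʳ (ιℚ m))))))
      where
      m = proj₁ (denominators v)
      m≢0 = proj₁ (proj₂ (denominators v))
      y = proj₁ (proj₂ (proj₂ (denominators v)))
      q = proj₂ (proj₂ (proj₂ (denominators v)))

  B-unique : ∀ x x' → (∀ y → B⟨ x , y ⟩ ≡ B⟨ x' , y ⟩) → x ≗ℤ x'
  B-unique x x' p i = ℤₚ.i-j≡0⇒i≡j (x i) (x' i) (B-zero (x -ℤ x') (λ y → trans (B-subˡ x x' y) (trans (cong (ℚ._- B⟨ x' , y ⟩) (p y)) (ℚₚ.+-inverseʳ B⟨ x' , y ⟩))) i)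

  B-expand : ∀ x (c : Vecℤ d) → (∀ i → B⟨ x , e i ⟩ ≡ ιℚ (c i)) → ∀ y → B⟨ x , y ⟩ ≡ ιℚ (dot c y)
  B-expand x c p y = trans (expandℚ (λ y → B⟨ x , y ⟩) (λ q → B-cong {x} (λ _ → refl) q)
      (λ y z → trans (b-congʳ (ι x) (ι-+ y z)) (b-addʳ (ι x) (ι y) (ι z))) (λ k y → B-scaleʳ k x y) y)
    (trans (Sumℚ.sum-cong d (λ j → trans (cong (ιℚ (y j) ℚ.*_) (p j)) (trans (sym (ιℚ-* (y j) (c j))) (cong ιℚ (ℤₚ.*-comm (y j) (c j))))))
      (sym (ιℚ-sum d (λ j → c j ℤ.* y j))))

  abstract
    coords : ∀ x → L x → Vecℤ d
    coords x l i = proj₁ (L-int l (e i))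

    coords-spec : ∀ x l y → B⟨ x , y ⟩ ≡ ιℚ (dot (coords x l) y)
    coords-spec x l = B-expand x (coords x l) (λ i → proj₂ (L-int l (e i)))

    coords-at : ∀ x l i → B⟨ x , e i ⟩ ≡ ιℚ (coords x l i)
    coords-at x l i = proj₂ (L-int l (e i))

  dot-unique : ∀ (c c' : Vecℤ d) → (∀ y → dot c y ≡ dot c' y) → c ≗ℤ c'
  dot-unique c c' p i = trans (sym (dot-e c i)) (trans (p (e i)) (dot-e c' i))

  BL∈ : ∀ z → L (fn BL z)
  BL∈ z = z , λ _ → refl

  Hfun : Vecℤ d → Vecℤ d
  Hfun z = coords (fn BL z) (BL∈ z)

  Hspec : ∀ z y → B⟨ fn BL z , y ⟩ ≡ ιℚ (dot (Hfun z) y)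
  Hspec z = coords-spec (fn BL z) (BL∈ z)

  Hi : ∀ z i → ιℚ (Hfun z i) ≡ B⟨ fn BL z , e i ⟩
  Hi z i = sym (coords-at (fn BL z) (BL∈ z) i)

  -- The matrix of b with respect to the given basis of Λ′ and the standard basis of Λ.
  H : Lin d d
  H .fn = Hfun
  H .fcong {z} {z'} p i = ιℚ-injective (trans (Hi z i) (trans (B-cong {y = e i} (fcong BL p) (λ _ → refl)) (sym (Hi z' i))))
  H .fadd z z' i = ιℚ-injective (trans (Hi (z +ℤ z') i) (trans (b-congˡ (ι (e i)) (λ j → trans (cong ιℚ (fadd BL z z' j)) (ι-+ (fn BL z) (fn BL z') j)))
    (trans (addˡ (ι (fn BL z)) (ι (fn BL z')) (ι (e i))) (trans (cong₂ ℚ._+_ (sym (Hi z i)) (sym (Hi z' i))) (sym (ιℚ-+ (Hfun z i) (Hfun z' i)))))))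
  H .fscale c z i = ιℚ-injective (trans (Hi (c ·ℤ z) i) (trans (B-cong {y = e i} (fscale BL c z) (λ _ → refl))
    (trans (B-scaleˡ c (fn BL z) (e i)) (trans (cong (ιℚ c ℚ.*_) (sym (Hi z i))) (sym (ιℚ-* c (Hfun z i)))))))

  H-inj : Injective H
  H-inj z p = B-inj z (B-zero (fn BL z) (λ y → trans (Hspec z y) (cong ιℚ (dot-0ˡ y p))))

  module HI = GroupInverse (groupInverse H (λ x p → H-inj (fn H x) p))

  -- For an injective map the relation H² P = D H cancels to H P = D, so a group inverse solves H z
  -- = c over ℚ.
  HP : ∀ c → fn H (fn HI.P c) ≗ℤ (HI.D ·ℤ c)
  HP c i = ℤₚ.i-j≡0⇒i≡j (fn H (fn HI.P c) i) (HI.D ℤ.* c i) (H-inj (fn H (fn HI.P c) -ℤ (HI.D ·ℤ c)) (fsub H (fn H (fn HI.P c)) (HI.D ·ℤ c) ⨾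
    λ j → ℤₚ.i≡j⇒i-j≡0 (trans (HI.AAP c j) (sym (fscale H HI.D c j)))) i)

  κH : ℚ
  κH = proj₁ (inverse HI.D HI.D≢0)

  represent : Vecℤ d → Vecℚ d
  represent c = κH ·ℚ ι (fn BL (fn HI.P c))

  represent-spec : ∀ c y → b (represent c) (ι y) ≡ ιℚ (dot c y)
  represent-spec c y = trans (scaleˡ κH (ι (fn BL (fn HI.P c))) (ι y)) (trans (cong (κH ℚ.*_) (trans (Hspec (fn HI.P c) y)
    (trans (cong ιℚ (trans (dot-cong {x = y} (HP c) (λ _ → refl)) (trans (dot-comm (HI.D ·ℤ c) y) (trans (dot-·ʳ y HI.D c) (cong (HI.D ℤ.*_) (dot-comm y c))))))
      (ιℚ-* HI.D (dot c y))))) (trans (sym (ℚₚ.*-assoc κH (ιℚ HI.D) (ιℚ (dot c y))))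
        (trans (cong (ℚ._* ιℚ (dot c y)) (proj₂ (inverse HI.D HI.D≢0))) (ℚₚ.*-identityˡ (ιℚ (dot c y))))))

  represent∈ : ∀ c → inΛ'ℚ (represent c)
  represent∈ c = proj₂ (dual (represent c)) (λ y → dot c y , represent-spec c y)

  abstract
    θ : Vecℤ d → Vecℤ d
    θ c = fn BL (proj₁ (represent∈ c))

    θ∈ : ∀ c → L (θ c)
    θ∈ c = BL∈ (proj₁ (represent∈ c))

    θ-spec : ∀ c y → B⟨ θ c , y ⟩ ≡ ιℚ (dot c y)
    θ-spec c y = trans (b-congˡ (ι y) (≗ℚ-sym (proj₂ (represent∈ c)))) (represent-spec c y)

  -- Identifies ℤᵈ = Hom(Λ, ℤ) with Λ′.
  Θ : Lin d d
  Θ .fn = θ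
  Θ .fcong {c} {c'} p = B-unique (θ c) (θ c') (λ y → trans (θ-spec c y) (trans (cong ιℚ (dot-cong {x = y} p (λ _ → refl))) (sym (θ-spec c' y))))
  Θ .fadd c c' = B-unique (θ (c +ℤ c')) (θ c +ℤ θ c') (λ y → trans (θ-spec (c +ℤ c') y) (trans (cong ιℚ (trans (dot-comm (c +ℤ c') y) (trans (dot-+ʳ y c c')
    (cong₂ ℤ._+_ (dot-comm y c) (dot-comm y c'))))) (trans (ιℚ-+ (dot c y) (dot c' y)) (trans (cong₂ ℚ._+_ (sym (θ-spec c y)) (sym (θ-spec c' y)))
      (trans (sym (addˡ (ι (θ c)) (ι (θ c')) (ι y))) (b-congˡ (ι y) (≗ℚ-sym (ι-+ (θ c) (θ c')))))))))
  Θ .fscale k c = B-unique (θ (k ·ℤ c)) (k ·ℤ θ c) (λ y → trans (θ-spec (k ·ℤ c) y) (trans (cong ιℚ (trans (dot-comm (k ·ℤ c) y) (trans (dot-·ʳ y k c)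
    (cong (k ℤ.*_) (dot-comm y c))))) (trans (ιℚ-* k (dot c y)) (trans (cong (ιℚ k ℚ.*_) (sym (θ-spec c y))) (sym (B-scaleˡ k (θ c) y))))))

  θ-inj : ∀ c c' → θ c ≗ℤ θ c' → c ≗ℤ c'
  θ-inj c c' p = dot-unique c c' (λ y → ιℚ-injective (trans (sym (θ-spec c y)) (trans (B-cong {y = y} p (λ _ → refl)) (θ-spec c' y))))

  θ-coords : ∀ x l → θ (coords x l) ≗ℤ x
  θ-coords x l = B-unique (θ (coords x l)) x (λ y → trans (θ-spec (coords x l) y) (sym (coords-spec x l y)))

-- 𝒯(Λ) ≅ 𝒯(Λ′): both are cokernels modulo D, of E and of its transpose

module Separation {d : ℕ} (F B : Mat d) (setup : Setup F B)
    (b : Vecℚ d → Vecℚ d → ℚ) (good : Setting.GoodPairing F B b) (dual : Setting.IsDual F B b) where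

  open Integral F B setup
  open Quotients F B setup
  open Setting F B
  open Pairing F B setup b good dual

  -- The component of z in W is E z / D. Hence z splits inside the lattice K exactly if E z is `D`
  -- times a vector of K. Stated for a general K, to serve Λ and Λ′ alike.
  module Lattice (K : Vecℤ d → Set) (sK : Sub K) (Kℚ : Vecℚ d → Set)
      (toK : ∀ x → K x → Kℚ (ι x)) (fromK : ∀ v → Kℚ v → ∃[ x ] (K x × v ≗ℚ ι x)) where

    separated⇒ : ∀ u u' z → (u -ℚ u') ≗ℚ ι z → TRelV Kℚ u u' → ∃[ y ] (K y × fn E z ≗ℤ (D ·ℤ y))
    separated⇒ u u' z p (a , c , ka , fa , kc , wc , q) = y , proj₁ (proj₂ (fromK c kc)) ,
        (fcong E z≡ ⨾ fadd E x y ⨾ (λ i → trans (cong (ℤ._+ fn E y i) (E-fixed {x} (FixedV-ι⁻ x px fa) i)) (ℤₚ.+-identityˡ (fn E y i))) ⨾ inW-ι⁻ y py wc)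
      where
      x = proj₁ (fromK a ka)
      px = proj₂ (proj₂ (fromK a ka))
      y = proj₁ (fromK c kc)
      py = proj₂ (proj₂ (fromK c kc))
      z≡ : z ≗ℤ (x +ℤ y)
      z≡ = ι-inj (≗ℚ-sym p ⨟ q ⨟ +ℚ-cong px py ⨟ ≗ℚ-sym (ι-+ x y))

    separated⇐ : ∀ u u' z → (u -ℚ u') ≗ℚ ι z → K z → ∀ y → K y → fn E z ≗ℤ (D ·ℤ y) → TRelV Kℚ u u'
    separated⇐ u u' z p kz y ky q = ι (z -ℤ y) , ι y , toK (z -ℤ y) (-∈ sK kz ky) , FixedV-ι (z -ℤ y) fixed , toK y ky , inW-ι y wy ,
        (p ⨟ ι-cong (λ i → h (z i) (y i)) ⨟ ι-+ (z -ℤ y) y)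
      where
      h : ∀ z y → z ≡ (z ℤ.- y) ℤ.+ y
      h = solve-∀
      wy : InW y
      wy = ·ℤ-cancel D≢0 (≗-sym (fscale E D y) ⨾ fcong E (≗-sym q) ⨾ E-InW z ⨾ ·ℤ-cong D q)
      fixed : Fx (z -ℤ y)
      fixed = E0⇒fixed {z -ℤ y} (fsub E z y ⨾ λ i → ℤₚ.i≡j⇒i-j≡0 (trans (q i) (sym (wy i))))

  ι∈Λ : ∀ x → All x → inΛℚ (ι x)
  ι∈Λ x _ = x , λ _ → refl

  Λ∋ι : ∀ v → inΛℚ v → ∃[ x ] (All x × v ≗ℚ ι x)
  Λ∋ι v (x , p) = x , tt , p

  ι∈Λ′ : ∀ x → L x → inΛ'ℚ (ι x)
  ι∈Λ′ x (c , p) = c , ι-cong p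

  Λ′∋ι : ∀ v → inΛ'ℚ v → ∃[ x ] (L x × v ≗ℚ ι x)
  Λ′∋ι v (c , p) = mvℤ B c , BL∈ c , p

  module Λ-lattice = Lattice All All-sub inΛℚ ι∈Λ Λ∋ι
  module Λ′-lattice = Lattice L sL inΛ'ℚ ι∈Λ′ Λ′∋ι

  open TransEq (transposeEq (mat E))
  open Iso

  -- `ψ` takes Λ to Hom(Λ, ℤ) and matches E with its transpose up to `φ`; `Θ` then identifies the
  -- transpose with E on Λ′. Divisibility of E x by `D` is therefore preserved both ways.
  Ψ : Lin d d
  Ψ = Θ ∘L fwd ψ

  Et : Lin d d
  Et = matLin (transpose (mat E))

  E-θ : ∀ c → fn E (θ c) ≗ℤ θ (fn Et c)
  E-θ c = B-unique (fn E (θ c)) (θ (fn Et c)) (λ y → trans (E-selfadjoint (θ c) y) (trans (θ-spec c (fn E y)) (trans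
    (cong ιℚ (trans (dot-cong {g = c} (λ _ → refl) (≗-sym (matVec-mat E y))) (sym (dot-transpose (mat E) y c)))) (sym (θ-spec (fn Et c) y)))))

  Et-ψ : ∀ x → fn Et (fn (fwd ψ) x) ≗ℤ fn (fwd φ) (fn E x)
  Et-ψ x = intertwine x ⨾ fcong (fwd φ) (matVec-mat E x)

  divisible⇒ : ∀ x y → fn E x ≗ℤ (D ·ℤ y) → fn E (fn Ψ x) ≗ℤ (D ·ℤ θ (fn (fwd φ) y))
  divisible⇒ x y p = E-θ (fn (fwd ψ) x) ⨾ fcong Θ (Et-ψ x ⨾ fcong (fwd φ) p ⨾ fscale (fwd φ) D y) ⨾ fscale Θ D (fn (fwd φ) y)

  divisible⇐ : ∀ x y → L y → fn E (fn Ψ x) ≗ℤ (D ·ℤ y) → ∃[ z ] (fn E x ≗ℤ (D ·ℤ z))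
  divisible⇐ x y l p = fn (bwd φ) c , (≗-sym (bwd-fwd φ (fn E x)) ⨾ fcong (bwd φ) (≗-sym (Et-ψ x) ⨾ inner) ⨾ fscale (bwd φ) D c)
    where
    c = coords y l
    inner : fn Et (fn (fwd ψ) x) ≗ℤ (D ·ℤ c)
    inner = θ-inj (fn Et (fn (fwd ψ) x)) (D ·ℤ c) (≗-sym (E-θ (fn (fwd ψ) x)) ⨾ p ⨾ ·ℤ-cong D (≗-sym (θ-coords y l)) ⨾ ≗-sym (fscale Θ D c))

  Ψ-sub : ∀ x y → (ι (fn Ψ x) -ℚ ι (fn Ψ y)) ≗ℚ ι (fn Ψ (x -ℤ y))
  Ψ-sub x y = ≗ℚ-sym (ι-- (fn Ψ x) (fn Ψ y)) ⨟ ι-cong (≗-sym (fsub Ψ x y))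

  tfun : TCar inΛℚ → TCar inΛ'ℚ
  tfun (u , x , p) = ι (fn Ψ x) , ι∈Λ′ (fn Ψ x) (θ∈ (fn (fwd ψ) x))

  diff : ∀ {u u' : Vecℚ d} (x x' : Vecℤ d) → u ≗ℚ ι x → u' ≗ℚ ι x' → (u -ℚ u') ≗ℚ ι (x -ℤ x')
  diff x x' p p' = -ℚ-cong p p' ⨟ ≗ℚ-sym (ι-- x x')

  equal⇒ : ∀ u u' → u ≗ℚ u' → TRelV inΛ'ℚ u u'
  equal⇒ u u' p = Λ′-lattice.separated⇐ u u' 0v (λ i → trans (cong (ℚ._- u' i) (p i)) (ℚₚ.+-inverseʳ (u' i))) (0∈ sL) 0v (0∈ sL)
    (f0 E (λ _ → refl) ⨾ λ i → sym (ℤₚ.*-zeroʳ D))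

  tIso : TIso inΛℚ inΛ'ℚ
  tIso = record
    { f = tfun
    ; resp = λ { (u , x , p) (u' , x' , p') r →
        let (y , _ , q) = Λ-lattice.separated⇒ u u' (x -ℤ x') (diff x x' p p') r in
        Λ′-lattice.separated⇐ (ι (fn Ψ x)) (ι (fn Ψ x')) (fn Ψ (x -ℤ x')) (Ψ-sub x x') (θ∈ (fn (fwd ψ) (x -ℤ x')))
          (θ (fn (fwd φ) y)) (θ∈ (fn (fwd φ) y)) (divisible⇒ (x -ℤ x') y q) }
    ; additive = λ { (u , x , p) (u' , x' , p') (u″ , x″ , p″) q →
        equal⇒ (ι (fn Ψ x″)) (ι (fn Ψ x) +ℚ ι (fn Ψ x')) (ι-cong (fcong Ψ (ι-inj {x = x″} {x +ℤ x'} (≗ℚ-sym p″ ⨟ q ⨟ +ℚ-cong p p' ⨟ ≗ℚ-sym (ι-+ x x'))) ⨾ fadd Ψ x x') ⨟ ι-+ (fn Ψ x) (fn Ψ x')) }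
    ; injective = λ { (u , x , p) (u' , x' , p') r →
        let (y , l , q) = Λ′-lattice.separated⇒ (ι (fn Ψ x)) (ι (fn Ψ x')) (fn Ψ (x -ℤ x')) (Ψ-sub x x') r
            (z , q') = divisible⇐ (x -ℤ x') y l q in
        Λ-lattice.separated⇐ u u' (x -ℤ x') (diff x x' p p') tt z tt q' }
    ; surjective = λ { (v , c , p) → let x = fn (bwd ψ) (coords (mvℤ B c) (BL∈ c)) in
        (ι x , x , λ _ → refl) , equal⇒ (ι (fn Ψ x)) v (ι-cong (fcong Θ (fwd-bwd ψ (coords (mvℤ B c) (BL∈ c))) ⨾ θ-coords (mvℤ B c) (BL∈ c)) ⨟ ≗ℚ-sym p) } }

-- Homomorphisms ℤⁿ → ℚ/ℤ

QZ-trans : ∀ p q r → p ≡QZ q → q ≡QZ r → p ≡QZ r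
QZ-trans p q r i j = int-≡ (h p q r) (int-+ i j)
  where
  h : ∀ p q r → (p ℚ.- q) ℚ.+ (q ℚ.- r) ≡ p ℚ.- r
  h = ring-∀ ℚ-ring

QZ-sum : ∀ m (k : Fin m → ℤ) (f g : Fin m → ℚ) → (∀ j → f j ≡QZ g j) →
         Sumℚ.sum m (λ j → ιℚ (k j) ℚ.* f j) ≡QZ Sumℚ.sum m (λ j → ιℚ (k j) ℚ.* g j)
QZ-sum zero    k f g p = + 0 , refl
QZ-sum (suc m) k f g p = int-≡ (h (ιℚ (k zero)) (f zero) (g zero) (Sumℚ.sum m (λ j → ιℚ (k (suc j)) ℚ.* f (suc j))) (Sumℚ.sum m (λ j → ιℚ (k (suc j)) ℚ.* g (suc j))))
    (int-+ (int-· (k zero) (p zero)) (QZ-sum m (k ∘ suc) (f ∘ suc) (g ∘ suc) (p ∘ suc)))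
  where
  h : ∀ k f g s t → k ℚ.* (f ℚ.- g) ℚ.+ (s ℚ.- t) ≡ (k ℚ.* f ℚ.+ s) ℚ.- (k ℚ.* g ℚ.+ t)
  h = ring-∀ ℚ-ring

-- Homomorphisms to ℚ/ℤ are represented by rational values; additivity and even the respect for `≗ℤ`
-- are demanded only modulo ℤ.
record HomQZ {n : ℕ} (X : Vecℤ n → ℚ) : Set where
  field
    X-cong : ∀ a c → a ≗ℤ c → X a ≡QZ X c
    X-add  : ∀ a c → X (a +ℤ c) ≡QZ (X a ℚ.+ X c)

  X-zero : ∀ a → a ≗ℤ 0v → IsInt (X a)
  X-zero a p = int-≡ (h (X a) (X (a +ℤ a))) (int-- (X-cong (a +ℤ a) a (λ i → trans (cong (ℤ._+ a i) (p i)) (ℤₚ.+-identityˡ (a i)))) (X-add a a))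
    where
    h : ∀ x y → (y ℚ.- x) ℚ.- (y ℚ.- (x ℚ.+ x)) ≡ x
    h = ring-∀ ℚ-ring

  X-scaleℕ : ∀ k a → X ((+ k) ·ℤ a) ≡QZ (ιℚ (+ k) ℚ.* X a)
  X-scaleℕ zero a = int-≡ (trans (sym (ℚₚ.+-identityʳ (X ((+ 0) ·ℤ a)))) (cong (λ z → X ((+ 0) ·ℤ a) ℚ.- z) (sym (ℚₚ.*-zeroˡ (X a)))))
    (X-zero ((+ 0) ·ℤ a) (λ i → ℤₚ.*-zeroˡ (a i)))
  X-scaleℕ (suc k) a = QZ-trans (X ((+ suc k) ·ℤ a)) (X s) (ιℚ (+ suc k) ℚ.* X a) (X-cong ((+ suc k) ·ℤ a) s (λ i → h (+ k) (a i)))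
      (int-≡ (trans (h′ (X s) (X a) (X ((+ k) ·ℤ a)) (ιℚ (+ k) ℚ.* X a)) (cong (λ z → X s ℚ.- z) collect)) (int-+ (X-add a ((+ k) ·ℤ a)) (X-scaleℕ k a)))
    where
    s = a +ℤ ((+ k) ·ℤ a)
    h : ∀ k a → (+ 1 ℤ.+ k) ℤ.* a ≡ a ℤ.+ k ℤ.* a
    h = solve-∀
    h′ : ∀ x y z w → (x ℚ.- (y ℚ.+ z)) ℚ.+ (z ℚ.- w) ≡ x ℚ.- (y ℚ.+ w)
    h′ = ring-∀ ℚ-ring
    collect : X a ℚ.+ ιℚ (+ k) ℚ.* X a ≡ ιℚ (+ suc k) ℚ.* X a
    collect = trans (cong (ℚ._+ ιℚ (+ k) ℚ.* X a) (sym (ℚₚ.*-identityˡ (X a))))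
      (trans (sym (ℚₚ.*-distribʳ-+ (X a) ℚ.1ℚ (ιℚ (+ k)))) (cong (ℚ._* X a) (sym (ιℚ-+ (+ 1) (+ k)))))

  X-scale : ∀ k a → X (k ·ℤ a) ≡QZ (ιℚ k ℚ.* X a)
  X-scale (+ k)    a = X-scaleℕ k a
  X-scale -[1+ k ] a = int-≡ (trans (h (X (-[1+ k ] ·ℤ a)) (X ((+ suc k) ·ℤ a)) (X s) (ιℚ (+ suc k) ℚ.* X a))
      (cong (λ z → X (-[1+ k ] ·ℤ a) ℚ.- z) (trans (neg (ιℚ (+ suc k)) (X a)) (cong (ℚ._* X a) (sym (ιℚ-neg (+ suc k)))))))
      (int-- (int-- (X-zero s (λ i → z (+ suc k) (a i))) (X-add (-[1+ k ] ·ℤ a) ((+ suc k) ·ℤ a))) (X-scaleℕ (suc k) a))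
    where
    s = (-[1+ k ] ·ℤ a) +ℤ ((+ suc k) ·ℤ a)
    z : ∀ k a → (ℤ.- k) ℤ.* a ℤ.+ k ℤ.* a ≡ + 0
    z = solve-∀
    h : ∀ x y s w → (s ℚ.- (s ℚ.- (x ℚ.+ y))) ℚ.- (y ℚ.- w) ≡ x ℚ.- (ℚ.- w)
    h = ring-∀ ℚ-ring
    neg : ∀ p q → ℚ.- (p ℚ.* q) ≡ (ℚ.- p) ℚ.* q
    neg = ring-∀ ℚ-ring

open HomQZ

HomQZ-tail : {n : ℕ} (X : Vecℤ (suc n) → ℚ) → HomQZ X → HomQZ (λ y → X (+ 0 ◂ y))
HomQZ-tail X hom = record
  { X-cong = λ a c p → X-cong hom (+ 0 ◂ a) (+ 0 ◂ c) (λ { zero → refl ; (suc i) → p i })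
  ; X-add = λ a c → QZ-trans (X (+ 0 ◂ (a +ℤ c))) (X ((+ 0 ◂ a) +ℤ (+ 0 ◂ c))) (X (+ 0 ◂ a) ℚ.+ X (+ 0 ◂ c))
      (X-cong hom (+ 0 ◂ (a +ℤ c)) ((+ 0 ◂ a) +ℤ (+ 0 ◂ c)) (fadd consˡ a c)) (X-add hom (+ 0 ◂ a) (+ 0 ◂ c)) }

QZ-expand : {n : ℕ} (X : Vecℤ n → ℚ) → HomQZ X → ∀ a → X a ≡QZ Sumℚ.sum n (λ j → ιℚ (a j) ℚ.* X (e j))
QZ-expand {zero}  X hom a = int-≡ (sym (ℚₚ.+-identityʳ (X a))) (X-zero hom a (λ ()))
QZ-expand {suc n} X hom a = QZ-trans (X a) (X (hd +ℤ tl)) (ιℚ (a zero) ℚ.* X (e zero) ℚ.+ S₁) (X-cong hom a (hd +ℤ tl) split)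
    (QZ-trans (X (hd +ℤ tl)) (X hd ℚ.+ X tl) (ιℚ (a zero) ℚ.* X (e zero) ℚ.+ S₁) (X-add hom hd tl)
      (int-≡ (h (X hd) (X tl) (ιℚ (a zero) ℚ.* X (e zero)) S₁) (int-+ (X-scale hom (a zero) (e zero)) tailInt)))
  where
  hd tl : Vecℤ (suc n)
  hd = a zero ·ℤ e zero
  tl = + 0 ◂ (a ∘ suc)
  split : a ≗ℤ (hd +ℤ tl)
  split zero    = sym (trans (ℤₚ.+-identityʳ (a zero ℤ.* + 1)) (ℤₚ.*-identityʳ (a zero)))
  split (suc k) = sym (trans (cong (ℤ._+ a (suc k)) (ℤₚ.*-zeroʳ (a zero))) (ℤₚ.+-identityˡ (a (suc k))))
  h : ∀ x y u v → (x ℚ.- u) ℚ.+ (y ℚ.- v) ≡ (x ℚ.+ y) ℚ.- (u ℚ.+ v)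
  h = ring-∀ ℚ-ring
  S₀ S₁ : ℚ
  S₀ = Sumℚ.sum n (λ j → ιℚ (a (suc j)) ℚ.* X (+ 0 ◂ e j))
  S₁ = Sumℚ.sum n (λ j → ιℚ (a (suc j)) ℚ.* X (e (suc j)))
  tailInt : X tl ≡QZ S₁
  tailInt = QZ-trans (X tl) S₀ S₁ (QZ-expand (λ y → X (+ 0 ◂ y)) (HomQZ-tail X hom) (a ∘ suc))
    (QZ-sum n (a ∘ suc) (λ j → X (+ 0 ◂ e j)) (λ j → X (e (suc j))) (λ j → X-cong hom (+ 0 ◂ e j) (e (suc j)) (λ { zero → refl ; (suc k) → refl })))

-- The pairing on 𝔅

module Antisymmetric {d : ℕ} (F B : Mat d) (setup : Setup F B)
    (b : Vecℚ d → Vecℚ d → ℚ) (good : Setting.GoodPairing F B b) (dual : Setting.IsDual F B b) where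

  open Integral F B setup
  open Quotients F B setup
  open Rational F hiding (A)
  open Setting F B
  open GoodPairing good
  open Pairing F B setup b good dual

  -- (F − 1)s ∈ (F − 1)Λ means s ∈ Λ + V^F, and w ∈ Λ′ ∩ W pairs integrally with Λ and trivially with V^F.
  pair-int : ∀ w → MW w → ∀ s t → AQ s ≗ℚ ι (fn A t) → IsInt (b (ι w) s)
  pair-int w (l , iw) s t p = int-≡ (sym (trans (b-congʳ (ι w) split) (trans (b-addʳ (ι w) (ι t) f)
      (trans (cong (b (ι w) (ι t) ℚ.+_) f⊥w) (ℚₚ.+-identityʳ (b (ι w) (ι t))))))) (L-int l t)
    where
    f : Vecℚ d
    f = s -ℚ ι t
    h : ∀ t u → u ≡ t ℚ.+ (u ℚ.- t)
    h = ring-∀ ℚ-ring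
    split : s ≗ℚ (ι t +ℚ f)
    split i = h (ιℚ (t i)) (s i)
    fixed : FixedV f
    fixed = AQ0⇒fixed {f} (AQ-- s (ι t) ⨟ -ℚ-cong p (AQ-ι t) ⨟ λ i → ℚₚ.+-inverseʳ (ιℚ (fn A t i)))
    f⊥w : b (ι w) f ≡ ℚ.0ℚ
    f⊥w = trans (symm (ι w) f) (trans (b-congʳ f (≗ℚ-sym (AQ-lift w iw))) (orthogonal {f} fixed (lift w)))

  -- Expand b((F - 1)v, (F - 1)v′) and use b(Fv, Fv′) = b(v, v′). The right-hand side is integral
  -- once (F - 1)v is in Λ′ and (F - 1)v′ in Λ, which is the antisymmetry modulo ℤ.
  skew : ∀ v v' → b (AQ v) v' ℚ.+ b (AQ v') v ≡ ℚ.- b (AQ v) (AQ v')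
  skew v v' = begin
    b (AQ v) v' ℚ.+ b (AQ v') v
      ≡⟨ cong₂ ℚ._+_ (b-subˡ (mvℚ F v) v v') (trans (b-subˡ (mvℚ F v') v' v) (cong₂ ℚ._-_ (symm (mvℚ F v') v) (symm v' v))) ⟩
    (b (mvℚ F v) v' ℚ.- b v v') ℚ.+ (b v (mvℚ F v') ℚ.- b v v')
      ≡⟨ h (b (mvℚ F v) v') (b v v') (b v (mvℚ F v')) ⟩
    ℚ.- ((b v v' ℚ.- b (mvℚ F v) v') ℚ.- (b v (mvℚ F v') ℚ.- b v v'))
      ≡⟨ cong ℚ.-_ (sym expand) ⟩
    ℚ.- b (AQ v) (AQ v') ∎
    where
    open ≡-Reasoning
    h : ∀ p q r → (p ℚ.- q) ℚ.+ (r ℚ.- q) ≡ ℚ.- ((q ℚ.- p) ℚ.- (r ℚ.- q))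
    h = ring-∀ ℚ-ring
    expand : b (AQ v) (AQ v') ≡ (b v v' ℚ.- b (mvℚ F v) v') ℚ.- (b v (mvℚ F v') ℚ.- b v v')
    expand = trans (b-subˡ (mvℚ F v) v (AQ v')) (cong₂ ℚ._-_
      (trans (b-subʳ (mvℚ F v) (mvℚ F v') v') (cong (ℚ._- b (mvℚ F v) v') (Finv v v'))) (b-subʳ v (mvℚ F v') v'))

  skew-int : ∀ w w' v v' → L w → AQ v ≗ℚ ι w → AQ v' ≗ℚ ι w' → IsInt (b (ι w) v' ℚ.+ b (ι w') v)
  skew-int w w' v v' l p p' = int-≡ (sym (trans (cong₂ ℚ._+_ (b-congˡ v' (≗ℚ-sym p)) (b-congˡ v (≗ℚ-sym p'))) (trans (skew v v')
      (trans (cong ℚ.-_ (trans (b-congˡ (AQ v') p) (b-congʳ (ι w) p'))) (sym (ℚₚ.+-identityˡ (ℚ.- b (ι w) (ι w')))))))) (int-- (int-ι (+ 0)) (L-int l w'))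

  lift-cong : ∀ {w w'} → w ≗ℤ w' → lift w ≗ℚ lift w'
  lift-cong p = ·ℚ-cong κ (ι-cong (fcong P p))

  lift-+ : ∀ w w' → lift (w +ℤ w') ≗ℚ (lift w +ℚ lift w')
  lift-+ w w' i = trans (cong (κ ℚ.*_) (trans (cong ιℚ (fadd P w w' i)) (ιℚ-+ (fn P w i) (fn P w' i)))) (ℚₚ.*-distribˡ-+ κ (ιℚ (fn P w i)) (ιℚ (fn P w' i)))

  lift-- : ∀ w w' → lift (w -ℤ w') ≗ℚ (lift w -ℚ lift w')
  lift-- w w' i = trans (cong (κ ℚ.*_) (trans (cong ιℚ (fsub P w w' i)) (ιℚ-- (fn P w i) (fn P w' i)))) (h κ (ιℚ (fn P w i)) (ιℚ (fn P w' i)))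
    where
    h : ∀ a b c → a ℚ.* (b ℚ.- c) ≡ a ℚ.* b ℚ.- a ℚ.* c
    h = ring-∀ ℚ-ring

  lift-· : ∀ c w → lift (c ·ℤ w) ≗ℚ (ιℚ c ·ℚ lift w)
  lift-· c w i = trans (cong (κ ℚ.*_) (trans (cong ιℚ (fscale P c w i)) (ιℚ-* c (fn P w i)))) (h κ (ιℚ c) (ιℚ (fn P w i)))
    where
    h : ∀ a b c → a ℚ.* (b ℚ.* c) ≡ b ℚ.* (a ℚ.* c)
    h = ring-∀ ℚ-ring

  lift-skew : ∀ {w w'} → MW w → MW w' → IsInt (b (ι w) (lift w') ℚ.+ b (ι w') (lift w))
  lift-skew {w} {w'} m m' = skew-int w w' (lift w) (lift w') (proj₁ m) (AQ-lift w (proj₂ m)) (AQ-lift w' (proj₂ m'))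

  -- A functional on Λ vanishing on Λ^F is represented in Λ′ ∩ W.
  θ∈MW : ∀ c → (∀ y → fn A y ≗ℤ 0v → dot c y ≡ + 0) → MW (θ c)
  θ∈MW c p = θ∈ c , A-MF⊥ {θ c} (B-zero (fn coE (θ c)) (λ y → trans (coE-selfadjoint (θ c) y) (trans (θ-spec c (fn coE y)) (cong ιℚ (p (fn coE y) (A-coE y))))))

  -- With A S a basis of AΛ, the coordinates of D w in it are read off by the functionals dual to that basis.
  radical : ∀ w → MW w → (∀ w' → MW w' → IsInt (b (ι w) (lift w'))) → AΛ w
  radical w m ort = fn S (proj₁ divisible) , ·ℤ-cancel D≢0 (≗-sym (proj₂ m) ⨾ GST (fn P w) ⨾ fcong (A ∘L S) (proj₂ divisible) ⨾ fscale (A ∘L S) D (proj₁ divisible))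
    where
    open Rank (rank A) hiding (D; D≢0)
    module R = Rank (rank A)
    a : Vecℤ k
    a = fn T (fn P w)
    row-of : Fin k → Vecℤ d
    row-of j = mat T j
    row-spec : ∀ j y → dot (row-of j) y ≡ fn T y j
    row-spec j y = matVec-mat T y j
    T-kernel : ∀ y → fn A y ≗ℤ 0v → fn T y ≗ℤ 0v
    T-kernel y p = ·ℤ-cancel R.D≢0 (≗-sym (CGS (fn T y)) ⨾ f0 C (≗-sym (GST y) ⨾ p) ⨾ λ i → sym (ℤₚ.*-zeroʳ R.D))
    mⱼ : ∀ j → MW (θ (row-of j))
    mⱼ j = θ∈MW (row-of j) (λ y p → trans (row-spec j y) (T-kernel y p j))
    value : ∀ j → b (ι (θ (row-of j))) (lift w) ≡ κ ℚ.* ιℚ (a j)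
    value j = trans (b-scaleʳ κ (ι (θ (row-of j))) (ι (fn P w))) (cong (κ ℚ.*_) (trans (θ-spec (row-of j) (fn P w)) (cong ιℚ (row-spec j (fn P w)))))
    h : ∀ p q → (p ℚ.+ q) ℚ.- q ≡ p
    h = ring-∀ ℚ-ring
    integral : ∀ j → IsInt (κ ℚ.* ιℚ (a j))
    integral j = int-≡ (trans (h (b (ι (θ (row-of j))) (lift w)) (b (ι w) (lift (θ (row-of j))))) (value j))
      (int-- (lift-skew {θ (row-of j)} {w} (mⱼ j) m) (ort (θ (row-of j)) (mⱼ j)))
    divisible : Multiple D a
    divisible = (λ j → proj₁ (integral j)) , λ j → ιℚ-injective (trans (sym (κD (ιℚ (a j)))) (trans (swap κ (ιℚ D) (ιℚ (a j)))
        (trans (cong (ιℚ D ℚ.*_) (proj₂ (integral j))) (sym (ιℚ-* D (proj₁ (integral j)))))))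
      where
      swap : ∀ p q r → p ℚ.* (q ℚ.* r) ≡ q ℚ.* (p ℚ.* r)
      swap = ring-∀ ℚ-ring

  -- The value uses the decompositions stored in the two elements; other decompositions change it by
  -- an integer only, as `homˡ` and `homʳ` establish.
  β : BCar → BCar → ℚ
  β u u' = b (ι (wOf u)) (vOf u')

  homʳ : ∀ x → IsHomQZ (β x)
  homʳ x = (λ y y' r → let (_ , t , q) = BRel⇒ y y' r in
      int-≡ (b-subʳ (ι (wOf x)) (vOf y) (vOf y')) (pair-int (wOf x) (w∈MW x) (vOf y -ℚ vOf y') t
        (AQ-- (vOf y) (vOf y') ⨟ -ℚ-cong (AQ-v y) (AQ-v y') ⨟ ≗ℚ-sym (ι-- (wOf y) (wOf y')) ⨟ ι-cong q)))
    , λ y y' z q → int-≡ (trans (b-subʳ (ι (wOf x)) (vOf z) (vOf y +ℚ vOf y')) (cong (λ r → β x z ℚ.- r) (b-addʳ (ι (wOf x)) (vOf y) (vOf y'))))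
        (pair-int (wOf x) (w∈MW x) (vOf z -ℚ (vOf y +ℚ vOf y')) ((xOf y +ℤ xOf y') -ℤ xOf z) (sums y y' z q))
    where
    sums : ∀ y y' z → proj₁ z ≗ℚ (proj₁ y +ℚ proj₁ y') → AQ (vOf z -ℚ (vOf y +ℚ vOf y')) ≗ℚ ι (fn A ((xOf y +ℤ xOf y') -ℤ xOf z))
    sums y y' z q = AQ-- (vOf z) (vOf y +ℚ vOf y') ⨟ -ℚ-cong (AQ-v z) (AQ-+ (vOf y) (vOf y') ⨟ +ℚ-cong (AQ-v y) (AQ-v y') ⨟ ≗ℚ-sym (ι-+ (wOf y) (wOf y'))) ⨟
        ≗ℚ-sym (ι-- (wOf z) (wOf y +ℤ wOf y')) ⨟ ι-cong (λ i → trans (rearrange (fn A (xOf y) i) (wOf y i) (fn A (xOf y') i) (wOf y' i) (fn A (xOf z) i) (wOf z i) (eq i))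
          (sym (trans (fsub A (xOf y +ℤ xOf y') (xOf z) i) (cong (ℤ._- fn A (xOf z) i) (fadd A (xOf y) (xOf y') i)))))
      where
      eq : (fn A (xOf z) +ℤ wOf z) ≗ℤ ((fn A (xOf y) +ℤ wOf y) +ℤ (fn A (xOf y') +ℤ wOf y'))
      eq = ι-inj (≗ℚ-sym (AQ-u z) ⨟ AQ-cong q ⨟ AQ-+ (proj₁ y) (proj₁ y') ⨟ +ℚ-cong (AQ-u y) (AQ-u y') ⨟
        ≗ℚ-sym (ι-+ (fn A (xOf y) +ℤ wOf y) (fn A (xOf y') +ℤ wOf y')))
      h₁ : ∀ w v v' z → w ℤ.- (v ℤ.+ v') ≡ (z ℤ.+ w) ℤ.- (z ℤ.+ (v ℤ.+ v'))
      h₁ = solve-∀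
      h₂ : ∀ a v a' v' z → ((a ℤ.+ v) ℤ.+ (a' ℤ.+ v')) ℤ.- (z ℤ.+ (v ℤ.+ v')) ≡ (a ℤ.+ a') ℤ.- z
      h₂ = solve-∀
      rearrange : ∀ a v a' v' z w → z ℤ.+ w ≡ (a ℤ.+ v) ℤ.+ (a' ℤ.+ v') → w ℤ.- (v ℤ.+ v') ≡ (a ℤ.+ a') ℤ.- z
      rearrange a v a' v' z w p = trans (h₁ w v v' z) (trans (cong (ℤ._- (z ℤ.+ (v ℤ.+ v'))) p) (h₂ a v a' v' z))

  antisym : ∀ x y → β x y ≡QZ (ℚ.- β y x)
  antisym x y = int-≡ (h (β x y) (β y x)) (skew-int (wOf x) (wOf y) (vOf x) (vOf y) (proj₁ (w∈MW x)) (AQ-v x) (AQ-v y))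
    where
    h : ∀ p q → p ℚ.+ q ≡ p ℚ.- (ℚ.- q)
    h = ring-∀ ℚ-ring

  -- Antisymmetry moves the laws over from the second variable.
  homˡ : ∀ y → IsHomQZ (λ x → β x y)
  homˡ y = (λ x x' r → int-≡ (h₁ (β x y) (β y x) (β x' y) (β y x'))
               (int-- (int-- (antisym x y) (antisym x' y)) (proj₁ (homʳ y) x x' r)))
         , λ x x' z q → int-≡ (h₂ (β z y) (β y z) (β x y) (β y x) (β x' y) (β y x'))
               (int-- (int-- (int-- (antisym z y) (antisym x y)) (antisym x' y)) (proj₂ (homʳ y) x x' z q))
    where
    h₁ : ∀ p q p' q' → ((p ℚ.- (ℚ.- q)) ℚ.- (p' ℚ.- (ℚ.- q'))) ℚ.- (q ℚ.- q') ≡ p ℚ.- p'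
    h₁ = ring-∀ ℚ-ring
    h₂ : ∀ p q r s t u → (((p ℚ.- (ℚ.- q)) ℚ.- (r ℚ.- (ℚ.- s))) ℚ.- (t ℚ.- (ℚ.- u))) ℚ.- (q ℚ.- (s ℚ.+ u)) ≡ p ℚ.- (r ℚ.+ t)
    h₂ = ring-∀ ℚ-ring

  nondeg : ∀ x → (∀ y → IsInt (β x y)) → inΛ+VF (proj₁ x)
  nondeg x p = to-Λ+VF (proj₁ x) (xOf x +ℤ proj₁ w∈) (AQ-u x ⨟ ι-cong (λ i → trans (+-congˡ (fn A (xOf x) i) (proj₂ w∈ i)) (sym (fadd A (xOf x) (proj₁ w∈) i))))
    where
    w∈ : AΛ (wOf x)
    w∈ = radical (wOf x) (w∈MW x) (λ w' m' → p (mkB w' m'))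

  -- The stored vectors v are replaced by the linear choice `lift`, which makes the form bilinear on
  -- all of ℤᵈ and not just modulo ℤ.
  γ₁ : Form d
  γ₁ = record
    { γ = λ w w' → b (ι w) (lift w')
    ; γ-cong = λ {x} {x'} {y} {y'} p q → trans (b-congˡ (lift y) (ι-cong p)) (b-congʳ (ι x') (lift-cong q))
    ; γ-subˡ = λ x x' y → trans (b-congˡ (lift y) (ι-- x x')) (b-subˡ (ι x) (ι x') (lift y))
    ; γ-subʳ = λ x y y' → trans (b-congʳ (ι x) (lift-- y y')) (b-subʳ (ι x) (lift y) (lift y'))
    ; γ-scaleˡ = λ c x y → trans (b-congˡ (lift y) (ι-· c x)) (scaleˡ (ιℚ c) (ι x) (lift y))
    ; γ-scaleʳ = λ c x y → trans (b-congʳ (ι x) (lift-· c y)) (b-scaleʳ (ιℚ c) (ι x) (lift y)) }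

  MW? : ∀ x → Dec (MW x)
  MW? x = L? x ×-dec InW? x

  radical⇒′ : ∀ {x y} → N₁ x → MW y → IsInt (b (ι x) (lift y))
  radical⇒′ {x} {y} n@(l , t , q) m = int-≡ (h (b (ι x) (lift y)) (b (ι y) (lift x)))
      (int-- (lift-skew {x} {y} (N₁⊆MW n) m) (pair-int y m (lift x) t (AQ-lift x (proj₂ (N₁⊆MW n)) ⨟ ι-cong q)))
    where
    h : ∀ p q → (p ℚ.+ q) ℚ.- q ≡ p
    h = ring-∀ ℚ-ring

  nondegenerate : Nondegenerate γ₁ MW N₁
  nondegenerate = record
    { sH = sMW ; sR = sN₁ ; R⊆H = N₁⊆MW ; H? = MW? ; R? = N₁?
    ; antisymmetric = λ {x} {y} → lift-skew {x} {y}
    ; radical⇒ = λ {x} {y} → radical⇒′ {x} {y}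
    ; radical⇐ = λ {x} m ort → proj₁ m , radical x m (λ w' m' → ort {w'} m') }

  squareB : ∀ n → HasCard BCar BRel n → IsSqOr2Sq n
  squareB n h = square-order nondegenerate n (card-→ B-Bij h) (<-wellFounded n)

  module TorsionSquare (k : ℕ) where

    -- The radical of the form k γ is the k-torsion.
    γₖ : Form d
    γₖ = record
      { γ = λ w w' → b (ι ((+ k) ·ℤ w)) (lift w')
      ; γ-cong = λ p q → γ-cong (·ℤ-cong (+ k) p) q
      ; γ-subˡ = λ x x' y → trans (γ-cong {y = y} (λ i → dist (+ k) (x i) (x' i)) (λ _ → refl)) (γ-subˡ ((+ k) ·ℤ x) ((+ k) ·ℤ x') y)
      ; γ-subʳ = λ x y y' → γ-subʳ ((+ k) ·ℤ x) y y'
      ; γ-scaleˡ = λ c x y → trans (γ-cong {y = y} (λ i → comm3 (+ k) c (x i)) (λ _ → refl)) (γ-scaleˡ c ((+ k) ·ℤ x) y)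
      ; γ-scaleʳ = λ c x y → γ-scaleʳ c ((+ k) ·ℤ x) y }
      where
      open Form γ₁
      dist : ∀ c a b → c ℤ.* (a ℤ.- b) ≡ c ℤ.* a ℤ.- c ℤ.* b
      dist = solve-∀
      comm3 : ∀ a b c → a ℤ.* (b ℤ.* c) ≡ b ℤ.* (a ℤ.* c)
      comm3 = solve-∀

    Tk : Vecℤ d → Set
    Tk = Torsion k

    sTk : Sub Tk
    sTk = ×-sub sMW (preimage-sub ((+ k) ·L idLin) (Im-sub A))

    Tk? : ∀ x → Dec (Tk x)
    Tk? x = MW? x ×-dec im? A ((+ k) ·ℤ x)

    N₁⊆Tk : N₁ ⊆ Tk
    N₁⊆Tk {x} n = N₁⊆MW n , ·∈ (Im-sub A) (+ k) (proj₂ n)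

    nondegenerateₖ : Nondegenerate γₖ MW Tk
    nondegenerateₖ = record
      { sH = sMW ; sR = sTk ; R⊆H = proj₁ ; H? = MW? ; R? = Tk?
      ; antisymmetric = λ {x} {y} mx my → int-≡ (trans (dist (ιℚ (+ k)) (b (ι x) (lift y)) (b (ι y) (lift x)))
          (cong₂ ℚ._+_ (sym (γ-scaleˡ (+ k) x y)) (sym (γ-scaleˡ (+ k) y x)))) (int-· (+ k) (lift-skew {x} {y} mx my))
      ; radical⇒ = λ {x} {y} (mx , ax) my → radical⇒′ {(+ k) ·ℤ x} {y} (·∈ sL (+ k) (proj₁ mx) , ax) my
      ; radical⇐ = λ {x} mx ort → mx , radical ((+ k) ·ℤ x) (·∈ sMW (+ k) mx) (λ w' m' → ort {w'} m') }
      where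
      open Form γ₁
      dist : ∀ c a b → c ℚ.* (a ℚ.+ b) ≡ c ℚ.* a ℚ.+ c ℚ.* b
      dist = ring-∀ ℚ-ring

    split : ∃[ a ] ∃[ c ] (Index MW Tk a × Index Tk N₁ c × nB ≡ a ℕ.* c)
    split = index-split sMW sTk sN₁ N₁⊆Tk proj₁ Tk? index-MW-N₁

    -- |𝔅[k]| is the quotient of |𝔅| by |𝔅/𝔅[k]|, which are both a square or twice a square.
    squareBₖ : ∀ n → HasCard (BeCar k) (BeRel k) n → IsSqOr2Sq n
    squareBₖ n h = subst IsSqOr2Sq (index-unique {H = Tk} {N₁} sN₁ ic (card-→ (Be-Bij k) h))
        (IsSqOr2Sq-quotient a c (index-positive {H = MW} {Tk} sMW ia)
          (subst IsSqOr2Sq nB≡ (square-order nondegenerate nB index-MW-N₁ (<-wellFounded nB)))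
          (square-order nondegenerateₖ a ia (<-wellFounded a)))
      where
      a = proj₁ split
      c = proj₁ (proj₂ split)
      ia : Index MW Tk a
      ia = proj₁ (proj₂ (proj₂ split))
      ic : Index Tk N₁ c
      ic = proj₁ (proj₂ (proj₂ (proj₂ split)))
      nB≡ : nB ≡ a ℕ.* c
      nB≡ = proj₂ (proj₂ (proj₂ (proj₂ split)))

-- Every character of 𝔅 comes from the pairing

module Characters {d : ℕ} (F B : Mat d) (setup : Setup F B)
    (b : Vecℚ d → Vecℚ d → ℚ) (good : Setting.GoodPairing F B b) (dual : Setting.IsDual F B b)
    (χ : Setting.BCar F B → ℚ) (χ-hom : Setting.IsHomQZ F B χ) where

  open Integral F B setup
  open Quotients F B setup
  open Rational F hiding (A)
  open Setting F B
  open Pairing F B setup b good dual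
  open Antisymmetric F B setup b good dual
  open Basis basisW

  lpart : Lin (d ℕ.+ rk) d
  lpart = lin (λ z i → z (i Fin.↑ˡ rk)) (λ p i → p (i Fin.↑ˡ rk)) (λ _ _ _ → refl) (λ _ _ _ → refl)

  rpart : Lin (d ℕ.+ rk) rk
  rpart = lin (λ z j → z (d Fin.↑ʳ j)) (λ p j → p (d Fin.↑ʳ j)) (λ _ _ _ → refl) (λ _ _ _ → refl)

  G : Lin (d ℕ.+ rk) d
  G = (A ∘L lpart) +L (φ ∘L rpart)

  -- G S is a basis of AΛ + (Λ′ ∩ W) = A(Λ + {v : Av ∈ Λ′}), on which χ can be lifted to ℚ freely.
  open Rank (rank G) renaming (D to D′; D≢0 to D′≢0)

  G-append : ∀ y c → fn G (y ⧺ c) ≗ℤ (fn A y +ℤ fn φ c)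
  G-append y c = +ℤ-cong (fcong A (Vecₚ.lookup-++ˡ y c)) (fcong φ (Vecₚ.lookup-++ʳ y c))

  -- `C` recovers `D′` times the coordinates T z from G z alone.
  T-determined : ∀ z z' → fn G z ≗ℤ fn G z' → fn T z ≗ℤ fn T z'
  T-determined z z' p = ·ℤ-cancel D′≢0 (≗-sym (CGS (fn T z)) ⨾ fcong C (≗-sym (GST z) ⨾ p ⨾ GST z') ⨾ CGS (fn T z'))

  W-part : Vecℤ k → Vecℤ d
  W-part a = fn φ (fn rpart (fn S a))

  W-part∈ : ∀ a → MW (W-part a)
  W-part∈ a = φ∈ (fn rpart (fn S a))

  wOf-mkB : ∀ w m → wOf (mkB w m) ≗ℤ w
  wOf-mkB w m = ≗-sym (proj₂ (proj₁ m))

  mkB-rel : ∀ w m w' m' → AΛ (w -ℤ w') → BRel (mkB w m) (mkB w' m')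
  mkB-rel w m w' m' p = BRel⇐ (mkB w m) (mkB w' m') (≗∈ (Im-sub A) (-ℤ-cong (≗-sym (wOf-mkB w m)) (≗-sym (wOf-mkB w' m'))) p)

  abstract
    -- The lattice vector with coordinates `a` is a sum of parts in AΛ and in Λ′ ∩ W; χ is evaluated
    -- at the second part. Another splitting changes that part by an element of AΛ, which χ ignores
    -- modulo ℤ.
    X : Vecℤ k → ℚ
    X a = χ (mkB (W-part a) (W-part∈ a))

    X-hom : HomQZ X
    X-hom = record
      { X-cong = λ a c p → proj₁ χ-hom (mkB (W-part a) (W-part∈ a)) (mkB (W-part c) (W-part∈ c))
          (mkB-rel (W-part a) (W-part∈ a) (W-part c) (W-part∈ c) (refl∈ (Im-sub A) (W-part a) (W-part c) (fcong (φ ∘L rpart ∘L S) p)))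
      ; X-add = λ a c → proj₂ χ-hom (mkB (W-part a) (W-part∈ a)) (mkB (W-part c) (W-part∈ c))
          (mkB (W-part (a +ℤ c)) (W-part∈ (a +ℤ c)))
          (λ i → trans (cong (ℚ.0ℚ ℚ.+_) (trans (lift-cong (fadd (φ ∘L rpart ∘L S) a c) i) (lift-+ (W-part a) (W-part c) i)))
            (zeros (lift (W-part a) i) (lift (W-part c) i))) }
      where
      zeros : ∀ x y → ℚ.0ℚ ℚ.+ (x ℚ.+ y) ≡ (ℚ.0ℚ ℚ.+ x) ℚ.+ (ℚ.0ℚ ℚ.+ y)
      zeros x y = trans (ℚₚ.+-identityˡ (x ℚ.+ y)) (sym (cong₂ ℚ._+_ (ℚₚ.+-identityˡ x) (ℚₚ.+-identityˡ y)))

    X-rel : ∀ a w (m : MW w) → AΛ (W-part a -ℤ w) → X a ≡QZ χ (mkB w m)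
    X-rel a w m p = proj₁ χ-hom (mkB (W-part a) (W-part∈ a)) (mkB w m) (mkB-rel (W-part a) (W-part∈ a) w m p)

  -- z and S (T z) have the same image under `G`, so their Λ′ ∩ W parts differ by A of the
  -- difference of their Λ parts.
  W-part-T : ∀ z → AΛ (W-part (fn T z) -ℤ fn φ (fn rpart z))
  W-part-T z = t , diff
    where
    z' : Vecℤ (d ℕ.+ rk)
    z' = fn S (fn T z)
    t : Vecℤ d
    t = fn lpart z -ℤ fn lpart z'
    h₁ : ∀ r a r' → r' ℤ.- r ≡ (a ℤ.- (a ℤ.+ r)) ℤ.+ r'
    h₁ = solve-∀
    h₂ : ∀ a a' r' → (a ℤ.- (a' ℤ.+ r')) ℤ.+ r' ≡ a ℤ.- a'
    h₂ = solve-∀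
    move : ∀ a r a' r' → a ℤ.+ r ≡ a' ℤ.+ r' → r' ℤ.- r ≡ a ℤ.- a'
    move a r a' r' q = trans (h₁ r a r') (trans (cong (λ t → (a ℤ.- t) ℤ.+ r') q) (h₂ a a' r'))
    eq : ∀ i → fn A (fn lpart z) i ℤ.+ fn φ (fn rpart z) i ≡ fn A (fn lpart z') i ℤ.+ fn φ (fn rpart z') i
    eq = GST z
    diff : (W-part (fn T z) -ℤ fn φ (fn rpart z)) ≗ℤ fn A t
    diff i = trans (move (fn A (fn lpart z) i) (fn φ (fn rpart z) i) (fn A (fn lpart z') i) (fn φ (fn rpart z') i) (eq i))
      (sym (fsub A (fn lpart z) (fn lpart z') i))

  X-T : ∀ z w (m : MW w) → AΛ (fn φ (fn rpart z) -ℤ w) → X (fn T z) ≡QZ χ (mkB w m)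
  X-T z w m p = X-rel (fn T z) w m (trans∈ (Im-sub A) (W-part (fn T z)) (fn φ (fn rpart z)) w (W-part-T z) p)

  -- The lift of `X` to an honest homomorphism into ℚ, obtained by keeping its values on the basis;
  -- this is possible because the lattice is free.
  Xl : Vecℤ k → ℚ
  Xl a = Sumℚ.sum k (λ j → ιℚ (a j) ℚ.* X (e j))

  Xl-cong : ∀ {a c} → a ≗ℤ c → Xl a ≡ Xl c
  Xl-cong p = Sumℚ.sum-cong k (λ j → cong (λ z → ιℚ z ℚ.* X (e j)) (p j))

  Xl-add : ∀ a c → Xl (a +ℤ c) ≡ Xl a ℚ.+ Xl c
  Xl-add a c = trans (Sumℚ.sum-cong k (λ j → trans (cong (ℚ._* X (e j)) (ιℚ-+ (a j) (c j))) (ℚₚ.*-distribʳ-+ (X (e j)) (ιℚ (a j)) (ιℚ (c j)))))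
    (Sumℚ.sum-+ k (λ j → ιℚ (a j) ℚ.* X (e j)) (λ j → ιℚ (c j) ℚ.* X (e j)))

  Xl-scale : ∀ s a → Xl (s ·ℤ a) ≡ ιℚ s ℚ.* Xl a
  Xl-scale s a = trans (Sumℚ.sum-cong k (λ j → trans (cong (ℚ._* X (e j)) (ιℚ-* s (a j))) (ℚₚ.*-assoc (ιℚ s) (ιℚ (a j)) (X (e j)))))
    (Sumℚ.sum-*ˡ k (ιℚ s) (λ j → ιℚ (a j) ℚ.* X (e j)))

  X≡Xl : ∀ a → X a ≡QZ Xl a
  X≡Xl = QZ-expand X X-hom

  0MW : MW 0v
  0MW = 0∈ sMW

  χ-0 : IsInt (χ (mkB 0v 0MW))
  χ-0 = int-≡ (h (χ (mkB 0v 0MW))) (int-- (int-ι (+ 0)) (proj₂ χ-hom (mkB 0v 0MW) (mkB 0v 0MW) (mkB 0v 0MW) (λ i → doubled i)))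
    where
    h : ∀ x → ιℚ (+ 0) ℚ.- (x ℚ.- (x ℚ.+ x)) ≡ x
    h x = trans (ℚₚ.+-identityˡ (ℚ.- (x ℚ.- (x ℚ.+ x)))) (h′ x)
      where
      h′ : ∀ x → ℚ.- (x ℚ.- (x ℚ.+ x)) ≡ x
      h′ = ring-∀ ℚ-ring
    zero-lift : ∀ i → lift 0v i ≡ ℚ.0ℚ
    zero-lift i = trans (cong (λ t → κ ℚ.* ιℚ t) (f0 P (λ _ → refl) i)) (ℚₚ.*-zeroʳ κ)
    doubled : ∀ i → ℚ.0ℚ ℚ.+ lift 0v i ≡ (ℚ.0ℚ ℚ.+ lift 0v i) ℚ.+ (ℚ.0ℚ ℚ.+ lift 0v i)
    doubled i = trans (cong (ℚ.0ℚ ℚ.+_) (zero-lift i)) (sym (cong₂ (λ p q → (ℚ.0ℚ ℚ.+ p) ℚ.+ (ℚ.0ℚ ℚ.+ q)) (zero-lift i) (zero-lift i)))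

  -- The lifted character at A y. It is integral because χ is trivial on AΛ, and it vanishes on Λ^F,
  -- so `θ∈MW` represents it by a vector of Λ′ ∩ W.
  onΛ : Vecℤ d → ℚ
  onΛ y = Xl (fn T (y ⧺ 0v))

  onΛ-int : ∀ y → IsInt (onΛ y)
  onΛ-int y = int-≡ (h (onΛ y) (X (fn T (y ⧺ 0v))) (χ (mkB 0v 0MW))) (int-+ (int-- (X-T (y ⧺ 0v) 0v 0MW in-AΛ) (X≡Xl (fn T (y ⧺ 0v)))) χ-0)
    where
    in-AΛ : AΛ (fn φ (fn rpart (y ⧺ 0v)) -ℤ 0v)
    in-AΛ = refl∈ (Im-sub A) (fn φ (fn rpart (y ⧺ 0v))) 0v (f0 φ (Vecₚ.lookup-++ʳ y 0v))
    h : ∀ l x c → ((x ℚ.- c) ℚ.- (x ℚ.- l)) ℚ.+ c ≡ l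
    h = ring-∀ ℚ-ring

  G-Λ : ∀ y → fn G (y ⧺ 0v) ≗ℤ fn A y
  G-Λ y = G-append y 0v ⨾ λ i → trans (+-congˡ (fn A y i) (f0 φ (λ _ → refl) i)) (ℤₚ.+-identityʳ (fn A y i))

  c₀ : Vecℤ d
  c₀ i = proj₁ (onΛ-int (e i))

  onΛ-dot : ∀ y → onΛ y ≡ ιℚ (dot c₀ y)
  onΛ-dot y = trans (expandℚ onΛ
      (λ {x} {y} p → Xl-cong (T-determined (x ⧺ 0v) (y ⧺ 0v) (G-Λ x ⨾ fcong A p ⨾ ≗-sym (G-Λ y))))
      (λ x y → trans (Xl-cong (T-determined ((x +ℤ y) ⧺ 0v) ((x ⧺ 0v) +ℤ (y ⧺ 0v)) (G-Λ (x +ℤ y) ⨾ fadd A x y ⨾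
          +ℤ-cong (≗-sym (G-Λ x)) (≗-sym (G-Λ y)) ⨾ ≗-sym (fadd G (x ⧺ 0v) (y ⧺ 0v))) ⨾ fadd T (x ⧺ 0v) (y ⧺ 0v))) (Xl-add (fn T (x ⧺ 0v)) (fn T (y ⧺ 0v))))
      (λ s x → trans (Xl-cong (T-determined ((s ·ℤ x) ⧺ 0v) (s ·ℤ (x ⧺ 0v)) (G-Λ (s ·ℤ x) ⨾ fscale A s x ⨾
          ·ℤ-cong s (≗-sym (G-Λ x)) ⨾ ≗-sym (fscale G s (x ⧺ 0v))) ⨾ fscale T s (x ⧺ 0v))) (Xl-scale s (fn T (x ⧺ 0v)))) y)
    (trans (Sumℚ.sum-cong d (λ j → trans (cong (ιℚ (y j) ℚ.*_) (proj₂ (onΛ-int (e j)))) (trans (sym (ιℚ-* (y j) (c₀ j))) (cong ιℚ (ℤₚ.*-comm (y j) (c₀ j))))))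
      (sym (ιℚ-sum d (λ j → c₀ j ℤ.* y j))))

  Xl-0 : ∀ {a} → a ≗ℤ 0v → Xl a ≡ ℚ.0ℚ
  Xl-0 p = Sumℚ.sum-zero k (λ j → trans (cong (λ z → ιℚ z ℚ.* X (e j)) (p j)) (ℚₚ.*-zeroˡ (X (e j))))

  w₀ : Vecℤ d
  w₀ = θ c₀

  w₀∈ : MW w₀
  w₀∈ = θ∈MW c₀ (λ y p → ιℚ-injective (trans (sym (onΛ-dot y)) (Xl-0 (T-determined (y ⧺ 0v) 0v (G-Λ y ⨾ p ⨾ ≗-sym (f0 G (λ _ → refl))) ⨾ f0 T (λ _ → refl)))))

  x₀ : BCar
  x₀ = mkB w₀ w₀∈

  -- With m v = y integral, A y = m w. So m b(w₀, v) is the lifted character at A y, that is m times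
  -- its value at w; m cancels in ℚ, and the value at w is χ(u) modulo ℤ.
  represented : ∀ u → β x₀ u ≡QZ χ u
  represented u = int-≡ (trans (h (χ (mkB w (w∈MW u))) (X (fn T z)) (Xl (fn T z)) (χ u)) (cong (ℚ._- χ u) (sym β≡)))
      (int-+ (int-- (X-T z w (w∈MW u) near) (X≡Xl (fn T z))) (proj₁ χ-hom (mkB w (w∈MW u)) u (BRel⇐ (mkB w (w∈MW u)) u (refl∈ (Im-sub A) (wOf (mkB w (w∈MW u))) w (wOf-mkB w (w∈MW u))))))
    where
    h : ∀ c x l c' → ((x ℚ.- c) ℚ.- (x ℚ.- l)) ℚ.+ (c ℚ.- c') ≡ l ℚ.- c'
    h = ring-∀ ℚ-ring
    w = wOf u
    v = vOf u
    c = proj₁ (span w (w∈MW u))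
    w≡ : w ≗ℤ fn φ c
    w≡ = proj₂ (span w (w∈MW u))
    z : Vecℤ (d ℕ.+ rk)
    z = 0v ⧺ c
    near : AΛ (fn φ (fn rpart z) -ℤ w)
    near = refl∈ (Im-sub A) (fn φ (fn rpart z)) w (fcong φ (Vecₚ.lookup-++ʳ (0v {d}) c) ⨾ ≗-sym w≡)
    m = proj₁ (denominators v)
    m≢0 = proj₁ (proj₂ (denominators v))
    y = proj₁ (proj₂ (proj₂ (denominators v)))
    mv≡y : (ιℚ m ·ℚ v) ≗ℚ ι y
    mv≡y = proj₂ (proj₂ (proj₂ (denominators v)))
    Ay : fn A y ≗ℤ (m ·ℤ w)
    Ay = ι-inj (≗ℚ-sym (AQ-ι y) ⨟ AQ-cong (≗ℚ-sym mv≡y) ⨟ AQ-· (ιℚ m) v ⨟ ·ℚ-cong (ιℚ m) (AQ-v u) ⨟ ≗ℚ-sym (ι-· m w))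
    Gz : fn G z ≗ℤ w
    Gz = G-append 0v c ⨾ (λ i → trans (cong (ℤ._+ fn φ c i) (f0 A (λ _ → refl) i)) (ℤₚ.+-identityˡ (fn φ c i))) ⨾ ≗-sym w≡
    Ty : fn T (y ⧺ 0v) ≗ℤ (m ·ℤ fn T z)
    Ty = T-determined (y ⧺ 0v) (m ·ℤ z) (G-Λ y ⨾ Ay ⨾ ·ℤ-cong m (≗-sym Gz) ⨾ ≗-sym (fscale G m z)) ⨾ fscale T m z
    β≡ : β x₀ u ≡ Xl (fn T z)
    β≡ = ℚ-cancel m≢0 (trans (sym (b-scaleʳ (ιℚ m) (ι (wOf x₀)) v)) (trans (b-congʳ (ι (wOf x₀)) mv≡y) (trans (B-cong {y = y} (wOf-mkB w₀ w₀∈) (λ _ → refl))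
      (trans (θ-spec c₀ y) (trans (sym (onΛ-dot y)) (trans (Xl-cong Ty) (Xl-scale m (fn T z))))))))

theorem1p1p1 : {d : ℕ} (F B : Mat d) →
    (∀ x → (mvℤ F (mvℤ F x -ℤ x) -ℤ (mvℤ F x -ℤ x)) ≗ℤ (λ _ → + 0) →
    (mvℤ F x -ℤ x) ≗ℤ (λ _ → + 0)) →
    ¬ (detℤ B ≡ + 0) →
    (∀ c → ∃[ c' ] (mvℤ F (mvℤ B c) ≗ℤ mvℤ B c')) →
    (r : ℕ) (p : Poly) →
    (charPoly F ≐ pMul (pPow (pAdd pX (pConst -[1+ 0 ])) r) p
    ⊎ charPoly F ≐ pNeg (pMul (pPow (pAdd pX (pConst -[1+ 0 ])) r) p)) →
    + 0 ℤ.< eval p (+ 1) →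
    let open Setting F B in
    Σ ℕ (λ nQ → Σ ℕ (λ nFix → Σ ℕ (λ nB → Σ ℕ (λ nT' →
    HasCard (QFixCar inΛ') (QFixRel inΛ') nQ
    × HasCard FixQCar FixQRel nFix
    × HasCard BCar BRel nB
    × HasCard (TCar inΛ'ℚ) (TRel inΛ'ℚ) nT'
    × (+ (nQ ℕ.* nB ℕ.* nT') ≡ + nFix ℤ.* eval p (+ 1))
    × (+ (nT' ℕ.* nB) ∣ eval p (+ 1))
    × (∀ (e : ℕ) → 1 ≤ e → Σ ℕ (λ nQe → Σ ℕ (λ nBe →
    HasCard (QFixCar (inΛ'e (+ e))) (QFixRel (inΛ'e (+ e))) nQe
    × HasCard (BeCar e) (BeRel e) nBe
    × nQe ≡ nQ ℕ.* nBe ℕ.* (e ^ r))))))))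
    ×
    ((b : Vecℚ d → Vecℚ d → ℚ) → GoodPairing b → IsDual b →
    TIso inΛℚ inΛ'ℚ
    × PerfectAntisymPairing
    × (∀ n → HasCard BCar BRel n → IsSqOr2Sq n)
    × (∀ (e : ℕ) → 1 ≤ e → ∀ n → HasCard (BeCar e) (BeRel e) n → IsSqOr2Sq n))
theorem1p1p1 F B ker det≢0 F-stable r p factor p>0 =
  -- (Λ/Λ′)^F has order `ny ℕ.* nFix`. As p(1) is the product of `nB`, `ny` and `nT`, the cofactor
  -- in the divisibility is `ny`.
  ((ny ℕ.* nFix) , nFix , nB , nT , index-HQ-L , index-Fx-MF , card-B , card-T , total , ℕD.divides ny p₁-factors , scaled) ,
  λ b good dual →
    let open Antisymmetric F B setup b good dual in
    Separation.tIso F B setup b good dual ,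
    record
      { β = β ; homˡ = homˡ ; homʳ = homʳ ; antisym = antisym ; nondeg = nondeg
      ; onto = λ χ hom → let open Characters F B setup b good dual χ hom in x₀ , represented } ,
    squareB ,
    λ e _ → TorsionSquare.squareBₖ e
  where
  setup : Setup F B
  setup = record { ker = ker ; det≢0 = det≢0 ; F-stable = F-stable }
  open Integral F B setup
  open Quotients F B setup
  p₁≢0 : eval p (+ 1) ≢ + 0
  p₁≢0 q = ℤₚ.<-irrefl (sym q) p>0
  open CharIndex F B setup r p factor p₁≢0
  p₁ = eval p (+ 1)
  p₁≡ : p₁ ≡ + ∣ p₁ ∣
  p₁≡ = sym (ℤₚ.0≤i⇒+∣i∣≡i (ℤₚ.<⇒≤ p>0))
  p₁-product : ∣ p₁ ∣ ≡ (nB ℕ.* ny) ℕ.* nT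
  p₁-product = trans (proj₂ conclusion) n₀-factors
  p₁-factors : ∣ p₁ ∣ ≡ ny ℕ.* (nT ℕ.* nB)
  p₁-factors = trans p₁-product (trans (cong (ℕ._* nT) (ℕₚ.*-comm nB ny)) (trans (ℕₚ.*-assoc ny nB nT) (cong (ny ℕ.*_) (ℕₚ.*-comm nB nT))))
  total : + ((ny ℕ.* nFix) ℕ.* nB ℕ.* nT) ≡ + nFix ℤ.* p₁
  total = trans (cong +_ (trans (h ny nFix nB nT) (cong (nFix ℕ.*_) (sym p₁-product)))) (trans (ℤₚ.pos-* nFix ∣ p₁ ∣) (cong (+ nFix ℤ.*_) (sym p₁≡)))
    where
    h : ∀ a b c t → (a ℕ.* b) ℕ.* c ℕ.* t ≡ b ℕ.* ((c ℕ.* a) ℕ.* t)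
    h = ℕ-solve-∀
  open Setting F B using (QFixCar; QFixRel; inΛ'e; BeCar; BeRel)
  scaled : ∀ k → 1 ≤ k → Σ ℕ (λ nQe → Σ ℕ (λ nBe → HasCard (QFixCar (inΛ'e (+ k))) (QFixRel (inΛ'e (+ k))) nQe
           × HasCard (BeCar k) (BeRel k) nBe × nQe ≡ (ny ℕ.* nFix) ℕ.* nBe ℕ.* (k ^ r)))
  scaled k 1≤k = ((nBₖ ℕ.* ny) ℕ.* (nFix ℕ.* k ^ r′)) , nBₖ , index-HQₖ , card-← (Be-Bij k) index-Rₖ-N₁ ,
      trans (cong (λ t → (nBₖ ℕ.* ny) ℕ.* (nFix ℕ.* k ^ t)) (sym (proj₁ conclusion))) (h nBₖ ny nFix (k ^ r))
    where
    open Scaled k (λ q → ℕₚ.<-irrefl (sym q) 1≤k)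
    h : ∀ a b c t → (a ℕ.* b) ℕ.* (c ℕ.* t) ≡ b ℕ.* c ℕ.* a ℕ.* t
    h = ℕ-solve-∀
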